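{- Let $H$ be a hexagonal system with a perfect matching. Then $H$ has no triphenylene as a nice subgraph if and only if $af(H,M)=fr(H,M)$ for every perfect matching $M$ of $H$.
   Context: A hexagonal system is a 2-connected finite plane graph in which every interior face is bounded by a regular hexagon of side length one; its interior faces are called hexagons. A triphenylene is the hexagonal system consisting of four hexagons: a central hexagon together with three hexagons each sharing one edge with the central hexagon, where the three shared edges are pairwise non-adjacent (so the three outer hexagons are pairwise non-adjacent). A subgraph $H_0$ of $H$ is nice if $H-V(H_0)$ has a perfect matching; "$H$ has a triphenylene as a nice subgraph" means some nice subgraph of $H$ is a triphenylene (formed by four hexagons of $H$). For a perfect matching $M$, a cycle is $M$-alternating if its edges alternate between $M$ and non-$M$ edges. A set $S\subseteq E(H)\setminus M$ is an anti-forcing set of $M$ if $H-S$ has $M$ as its unique perfect matching; $af(H,M)$ is the minimum size of an anti-forcing set of $M$. $fr(H,M)$ is the number of hexagons of $H$ that are $M$-alternating cycles. -}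

module Defs where

open import Data.Integer using (ℤ; +_; _+_; _*_)
import Data.Integer.Properties as ℤP
open import Data.Product using (Σ; ∃; ∃-syntax; _×_; _,_; proj₁; proj₂)
open import Data.Product.Properties using (≡-dec)
open import Data.Sum using (_⊎_; inj₁; inj₂)
open import Data.Nat using (ℕ; _≤_) renaming (_+_ to _+ℕ_)
open import Data.List using (List; []; _∷_; length; filter; deduplicate; concatMap)
open import Data.List.Relation.Unary.Any using (Any)
open import Data.List.Relation.Unary.Unique.Propositional using (Unique)
open import Data.List.Membership.Propositional using (_∈_; _∉_)
import Data.List.Membership.DecPropositional as DecMem
open import Relation.Nullary using (¬_; Dec; yes; no)
open import Relation.Nullary.Decidable using (_×-dec_; _⊎-dec_; ¬?)
open import Relation.Binary.Definitions using (DecidableEquality)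
open import Relation.Binary.PropositionalEquality using (_≡_; _≢_; refl; cong)

-- The hexagonal lattice, drawn as the "brick wall":
--   vertices  : ℤ × ℤ
--   edges     : horizontal (x,y)–(x+1,y) for all x,y;
--               vertical   (x,y)–(x,y+1) when x+y is even.
-- Its faces are the bricks with lower-left corner (x,y), x+y even,
-- each bounded by a 6-cycle; this plane graph is the hexagonal lattice.

Vert : Set
Vert = ℤ × ℤ

_≟V_ : DecidableEquality Vert
_≟V_ = ≡-dec ℤP._≟_ ℤP._≟_

-- an edge is named by its left (resp. lower) endpoint
data Edge : Set where
  hor : Vert → Edge
  ver : Vert → Edge

_≟E_ : DecidableEquality Edge
hor u ≟E hor v with u ≟V v
... | yes refl = yes refl
... | no u≢v = no λ { refl → u≢v refl }
hor u ≟E ver v = no λ ()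
ver u ≟E hor v = no λ ()
ver u ≟E ver v with u ≟V v
... | yes refl = yes refl
... | no u≢v = no λ { refl → u≢v refl }

end₁ end₂ : Edge → Vert
end₁ (hor v) = v
end₁ (ver v) = v
end₂ (hor (x , y)) = (x + + 1 , y)
end₂ (ver (x , y)) = (x , y + + 1)

Incident : Vert → Edge → Set
Incident v e = (v ≡ end₁ e) ⊎ (v ≡ end₂ e)

Joins : Edge → Vert → Vert → Set
Joins e u v = (end₁ e ≡ u × end₂ e ≡ v) ⊎ (end₁ e ≡ v × end₂ e ≡ u)

-- A hexagon (lattice face) with index (a,b) is the brick with lower-left
-- corner (2a+b, b); every brick arises exactly once.
Hex : Set
Hex = ℤ × ℤ

corner : Hex → Vert
corner (a , b) = (+ 2 * a + b , b)

hexVerts : Hex → List Vert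
hexVerts h with corner h
... | (x , y) = (x , y) ∷ (x + + 1 , y) ∷ (x + + 2 , y)
              ∷ (x , y + + 1) ∷ (x + + 1 , y + + 1) ∷ (x + + 2 , y + + 1) ∷ []

-- the six edges of a hexagon, in cyclic order
hexE₁ hexE₂ hexE₃ hexE₄ hexE₅ hexE₆ : Hex → Edge
hexE₁ h with corner h
... | (x , y) = hor (x , y)
hexE₂ h with corner h
... | (x , y) = hor (x + + 1 , y)
hexE₃ h with corner h
... | (x , y) = ver (x + + 2 , y)
hexE₄ h with corner h
... | (x , y) = hor (x + + 1 , y + + 1)
hexE₅ h with corner h
... | (x , y) = hor (x , y + + 1)
hexE₆ h with corner h
... | (x , y) = ver (x , y)

hexEdges : Hex → List Edge
hexEdges h = hexE₁ h ∷ hexE₂ h ∷ hexE₃ h ∷ hexE₄ h ∷ hexE₅ h ∷ hexE₆ h ∷ []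

record Graph : Set₁ where
  field
    V : Vert → Set
    E : Edge → Set
open Graph public

_∖V_ : Graph → (Vert → Set) → Graph
G ∖V P = record { V = λ v → V G v × ¬ P v
                ; E = λ e → E G e × ¬ P (end₁ e) × ¬ P (end₂ e) }

_∖E_ : Graph → List Edge → Graph
G ∖E S = record { V = V G ; E = λ e → E G e × e ∉ S }

data Walk (G : Graph) : Vert → Vert → Set where
  here : ∀ {u} → Walk G u u
  step : ∀ {u v w} (e : Edge) → E G e → Joins e u v → Walk G v w → Walk G u w

Connected : Graph → Set
Connected G = ∀ u v → V G u → V G v → Walk G u v

TwoConnected : Graph → Set
TwoConnected G =
  (∃[ a ] ∃[ b ] ∃[ c ] (V G a × V G b × V G c × a ≢ b × a ≢ c × b ≢ c))
  × Connected G
  × (∀ w → V G w → Connected (G ∖V (λ v → v ≡ w)))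

record IsPerfectMatching (G : Graph) (M : List Edge) : Set where
  field
    inE    : ∀ {e} → e ∈ M → E G e
    covers : ∀ {v} → V G v → ∃[ e ] (e ∈ M × Incident v e)
    once   : ∀ {v e e′} → e ∈ M → e′ ∈ M → Incident v e → Incident v e′ → e ≡ e′

graphOf : List Hex → Graph
graphOf S = record { V = λ v → Any (λ h → v ∈ hexVerts h) S
                   ; E = λ e → Any (λ h → e ∈ hexEdges h) S }

numVerts numEdges : List Hex → ℕ
numVerts S = length (deduplicate _≟V_ (concatMap hexVerts S))
numEdges S = length (deduplicate _≟E_ (concatMap hexEdges S))

-- S lists distinct hexagons, the graph is 2-connected, and the bounded
-- faces of the graph are exactly the hexagons of S.  The hexagons of S are
-- distinct bounded faces and (Euler, connected plane graph) the number of
-- bounded faces is |E| - |V| + 1, so the last condition is |S| = |E|-|V|+1.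
record IsHexagonalSystem (S : List Hex) : Set where
  field
    distinct     : Unique S
    twoConnected : TwoConnected (graphOf S)
    facesAreHex  : length S +ℕ numVerts S ≡ numEdges S +ℕ 1

IsAntiForcingSet : List Hex → List Edge → List Edge → Set
IsAntiForcingSet S M A =
  (∀ {e} → e ∈ A → E (graphOf S) e × e ∉ M)
  × IsPerfectMatching (graphOf S ∖E A) M
  × (∀ M′ → IsPerfectMatching (graphOf S ∖E A) M′ → ∀ e → (e ∈ M′ → e ∈ M) × (e ∈ M → e ∈ M′))

AfIs : List Hex → List Edge → ℕ → Set
AfIs S M k =
  (∃[ A ] (IsAntiForcingSet S M A × Unique A × length A ≡ k))
  × (∀ A → IsAntiForcingSet S M A → Unique A → k ≤ length A)

module _ (M : List Edge) where
  open DecMem _≟E_ using (_∈?_)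

  Alternating : Hex → Set
  Alternating h =
      (hexE₁ h ∈ M × hexE₂ h ∉ M × hexE₃ h ∈ M × hexE₄ h ∉ M × hexE₅ h ∈ M × hexE₆ h ∉ M)
    ⊎ (hexE₁ h ∉ M × hexE₂ h ∈ M × hexE₃ h ∉ M × hexE₄ h ∈ M × hexE₅ h ∉ M × hexE₆ h ∈ M)

  alternating? : (h : Hex) → Dec (Alternating h)
  alternating? h =
      (e₁ ∈? M ×-dec ¬? (e₂ ∈? M) ×-dec e₃ ∈? M ×-dec ¬? (e₄ ∈? M) ×-dec e₅ ∈? M ×-dec ¬? (e₆ ∈? M))
    ⊎-dec (¬? (e₁ ∈? M) ×-dec e₂ ∈? M ×-dec ¬? (e₃ ∈? M) ×-dec e₄ ∈? M ×-dec ¬? (e₅ ∈? M) ×-dec e₆ ∈? M)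
    where
      e₁ = hexE₁ h ; e₂ = hexE₂ h ; e₃ = hexE₃ h
      e₄ = hexE₄ h ; e₅ = hexE₅ h ; e₆ = hexE₆ h

fr : List Hex → List Edge → ℕ
fr S M = length (filter (alternating? M) S)

NonAdjacent : Edge → Edge → Set
NonAdjacent e e′ = ∀ v → Incident v e → ¬ Incident v e′

InHexes : List Hex → Vert → Set
InHexes hs v = Any (λ h → v ∈ hexVerts h) hs

HasNiceTriphenylene : List Hex → Set
HasNiceTriphenylene S =
  ∃[ h₀ ] ∃[ h₁ ] ∃[ h₂ ] ∃[ h₃ ]
    ( h₀ ∈ S × h₁ ∈ S × h₂ ∈ S × h₃ ∈ S
    × h₀ ≢ h₁ × h₀ ≢ h₂ × h₀ ≢ h₃ × h₁ ≢ h₂ × h₁ ≢ h₃ × h₂ ≢ h₃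
    × (∃[ e₁ ] ∃[ e₂ ] ∃[ e₃ ]
         ( e₁ ∈ hexEdges h₀ × e₁ ∈ hexEdges h₁
         × e₂ ∈ hexEdges h₀ × e₂ ∈ hexEdges h₂
         × e₃ ∈ hexEdges h₀ × e₃ ∈ hexEdges h₃
         × NonAdjacent e₁ e₂ × NonAdjacent e₁ e₃ × NonAdjacent e₂ e₃))
    × (∃[ M₀ ] IsPerfectMatching (graphOf S ∖V InHexes (h₀ ∷ h₁ ∷ h₂ ∷ h₃ ∷ [])) M₀))

{-# OPTIONS --safe #-}

-- Colour the vertices of the lattice black and white and orient the dual edge
-- of every lattice edge so that the black end is, say, on its left; every
-- hexagon then has three out-arcs and three in-arcs, in alternation.  Delete
-- the arcs that cross edges of M; a hexagon is M-alternating iff it is a sink or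
-- a source of what remains.  Each edge outside M lies on at most one
-- alternating hexagon and an anti-forcing set meets each of them, so fr ≤ af.
--
-- If a nice triphenylene exists, match it so that only its central hexagon is
-- alternating.  Its perimeter is then an alternating cycle none of whose
-- edges outside M lies on an alternating hexagon, so fr < af.
--
-- Conversely let A contain one in-arc n → t for every sink t and, dually, one
-- out-arc for every source.  If there is no nice triphenylene, n can be chosen
-- outside the system or with an arc n → n′ to a hexagon n′ that is not a sink
-- (or is outside): otherwise flipping the sinks other than t entered from the
-- three predecessors of t exposes a nice triphenylene around t.  The form equal to 1
-- on arcs and to -2 on crossings of M is closed, so it is the differential of
-- a height; if M′ is a perfect matching avoiding A, then M′ - M is likewise the
-- differential of a function f vanishing outside the system.  f is monotone
-- along arcs and constant across A.  Following arcs, and at a sink t the path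
-- t, n, n′, the height increases, hence one leaves the system and f ≤ 0; dually
-- f ≥ 0.  So f = 0 and M′ = M.
module Submission where

open import Defs
open import Data.Bool using (Bool; true; false; _∧_; _∨_; not)
import Data.Bool.Properties as BoolP
open import Data.Empty using (⊥; ⊥-elim)
open import Data.Integer as ℤ using (ℤ; +_; -[1+_]; _+_; _-_; -_; _*_; ∣_∣)
import Data.Integer.Properties as ℤP
open import Data.Integer.Tactic.RingSolver using (solve-∀)
open import Algebra.Properties.AbelianGroup ℤP.+-0-abelianGroup using (∙-cancelʳ)
open import Data.Maybe using (Maybe; just; nothing)
open import Data.Nat as ℕ using (ℕ; zero; suc)
import Data.Nat.Properties as ℕP
open import Data.Product using (Σ; ∃; ∃-syntax; _×_; _,_; proj₁; proj₂; uncurry)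
open import Data.Product.Properties using (≡-dec)
open import Data.Sum as Sum using (_⊎_; inj₁; inj₂; [_,_]′)
open import Data.List using (List; []; _∷_; _++_; length; map; concatMap; deduplicate; filter)
open import Data.List.Properties using (length-map; length-++; concatMap-cong; map-concatMap)
open import Data.List.Membership.Propositional using (_∈_; _∉_; find; lose)
open import Data.List.Membership.Propositional.Properties
  using (∈-map⁻; ∈-map⁺; ∈-concatMap⁺; ∈-concatMap⁻; ∈-deduplicate⁺; ∈-deduplicate⁻;
         ∈-filter⁺; ∈-filter⁻; ∈-∃++; ∈-++⁻; ∈-++⁺ˡ; ∈-++⁺ʳ)
import Data.List.Membership.DecPropositional as DecMem
open import Data.List.Relation.Unary.All as All using (All; []; _∷_)
import Data.List.Relation.Unary.All.Properties as AllP
open import Data.List.Relation.Unary.AllPairs using ([]; _∷_)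
open import Data.List.Relation.Unary.Any as Any using (here; there)
open import Data.List.Relation.Unary.Unique.Propositional using (Unique)
import Data.List.Relation.Unary.Unique.Propositional.Properties as UniqueP
import Data.List.Relation.Unary.Unique.DecPropositional.Properties as DecUniqueP
open import Function.Bundles using (_⇔_; mk⇔)
open import Relation.Binary.Definitions using (DecidableEquality)
open import Relation.Binary.PropositionalEquality
open import Relation.Nullary using (¬_; Dec; yes; no; contradiction)
open import Relation.Nullary.Decidable using (⌊_⌋; ¬?; _⊎-dec_; _×-dec_)

-- That the system has no holes is given only as Euler's count. Closed forms are therefore not
-- integrated along paths: a potential is a solution of a linear system with more unknowns than
-- equations. Elimination over the integers yields it only up to a positive factor `suc κ`, which
-- does no harm, since only signs and zeros of `f` and rises of the height matter.
--
-- The danger for a walk along arcs is to get stuck at a sink. An arc of A may be passed backwards,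
-- because `f` is constant across it, but this costs height. The next arc only regains the loss; the
-- gain comes from a third one, and that one exists because n′ is not a sink.
--
-- A single matching of the triphenylene, called tight below, links the two directions: flipping
-- produces it when a sink has no exit, and it is also the matching for which a nice triphenylene
-- makes equality fail.
--
-- Arcs live on the whole lattice, so that every vertex has three of them whatever its degree in the
-- system.

data Dir : Set where
  d₀ d₁ d₂ : Dir

_≟D_ : DecidableEquality Dir
d₀ ≟D d₀ = yes refl
d₀ ≟D d₁ = no λ ()
d₀ ≟D d₂ = no λ ()
d₁ ≟D d₀ = no λ ()
d₁ ≟D d₁ = yes refl
d₁ ≟D d₂ = no λ ()
d₂ ≟D d₀ = no λ ()
d₂ ≟D d₁ = no λ ()
d₂ ≟D d₂ = yes refl

data Parity : Set where
  even odd : Parity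

opposite : Parity → Parity
opposite even = odd
opposite odd  = even

-- The cyclic order in which the three arcs around a vertex of the given
-- parity follow each other.
data Perm : Parity → Dir → Dir → Dir → Set where
  p012 : Perm odd d₀ d₁ d₂
  p120 : Perm odd d₁ d₂ d₀
  p201 : Perm odd d₂ d₀ d₁
  p021 : Perm even d₀ d₂ d₁
  p210 : Perm even d₂ d₁ d₀
  p102 : Perm even d₁ d₀ d₂

rotate : ∀ {c i j l} → Perm c i j l → Perm c j l i
rotate p012 = p120
rotate p120 = p201
rotate p201 = p012
rotate p021 = p210
rotate p210 = p102
rotate p102 = p021

mirror : ∀ {c i j l} → Perm c i j l → Perm (opposite c) l j i
mirror p012 = p210
mirror p120 = p021
mirror p201 = p102
mirror p021 = p120
mirror p210 = p012
mirror p102 = p201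

first≢second : ∀ {c i j l} → Perm c i j l → i ≢ j
first≢second p012 ()
first≢second p120 ()
first≢second p201 ()
first≢second p021 ()
first≢second p210 ()
first≢second p102 ()

first≢third : ∀ {c i j l} → Perm c i j l → i ≢ l
first≢third π i≡l = first≢second (rotate (rotate π)) (sym i≡l)

-- The out-arc of direction `i` and the in-arc of direction `l` of a hexagon are opposite edges if
-- `i ≡ l`, and share a vertex otherwise. The permutation found here belongs to that vertex; most
-- local arguments below evaluate the matching there.
perm-from : ∀ {i l} → i ≢ l → ∃[ c ] ∃[ j ] Perm c i j l
perm-from {d₀} {d₀} i≢l = contradiction refl i≢l
perm-from {d₀} {d₁} i≢l = even , d₂ , p021
perm-from {d₀} {d₂} i≢l = odd , d₁ , p012
perm-from {d₁} {d₀} i≢l = odd , d₂ , p120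
perm-from {d₁} {d₁} i≢l = contradiction refl i≢l
perm-from {d₁} {d₂} i≢l = even , d₀ , p102
perm-from {d₂} {d₀} i≢l = even , d₁ , p210
perm-from {d₂} {d₁} i≢l = odd , d₀ , p201
perm-from {d₂} {d₂} i≢l = contradiction refl i≢l

perm-covers : ∀ {c i j l} → Perm c i j l → ∀ k → k ≡ i ⊎ k ≡ j ⊎ k ≡ l
perm-covers p012 d₀ = inj₁ refl
perm-covers p012 d₁ = inj₂ (inj₁ refl)
perm-covers p012 d₂ = inj₂ (inj₂ refl)
perm-covers p120 d₁ = inj₁ refl
perm-covers p120 d₂ = inj₂ (inj₁ refl)
perm-covers p120 d₀ = inj₂ (inj₂ refl)
perm-covers p201 d₂ = inj₁ refl
perm-covers p201 d₀ = inj₂ (inj₁ refl)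
perm-covers p201 d₁ = inj₂ (inj₂ refl)
perm-covers p021 d₀ = inj₁ refl
perm-covers p021 d₂ = inj₂ (inj₁ refl)
perm-covers p021 d₁ = inj₂ (inj₂ refl)
perm-covers p210 d₂ = inj₁ refl
perm-covers p210 d₁ = inj₂ (inj₁ refl)
perm-covers p210 d₀ = inj₂ (inj₂ refl)
perm-covers p102 d₁ = inj₁ refl
perm-covers p102 d₀ = inj₂ (inj₁ refl)
perm-covers p102 d₂ = inj₂ (inj₂ refl)

perm-at : ∀ c i → ∃[ j ] ∃[ l ] Perm c i j l
perm-at even d₀ = _ , _ , p021
perm-at even d₁ = _ , _ , p102
perm-at even d₂ = _ , _ , p210
perm-at odd d₀ = _ , _ , p012
perm-at odd d₁ = _ , _ , p120
perm-at odd d₂ = _ , _ , p201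

avoid : ∀ (a b : Dir) → ∃[ i ] (i ≢ a × i ≢ b)
avoid d₀ d₀ = d₁ , (λ ()) , λ ()
avoid d₀ d₁ = d₂ , (λ ()) , λ ()
avoid d₀ d₂ = d₁ , (λ ()) , λ ()
avoid d₁ d₀ = d₂ , (λ ()) , λ ()
avoid d₁ d₁ = d₂ , (λ ()) , λ ()
avoid d₁ d₂ = d₀ , (λ ()) , λ ()
avoid d₂ d₀ = d₁ , (λ ()) , λ ()
avoid d₂ d₁ = d₀ , (λ ()) , λ ()
avoid d₂ d₂ = d₀ , (λ ()) , λ ()

some-or-all : ∀ {p q} {P : Dir → Set p} {Q : Dir → Set q} →
              (∀ i → P i ⊎ Q i) → ∃ P ⊎ (∀ i → Q i)
some-or-all f with f d₀ | f d₁ | f d₂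
... | inj₁ p | _ | _ = inj₁ (d₀ , p)
... | inj₂ _ | inj₁ p | _ = inj₁ (d₁ , p)
... | inj₂ _ | inj₂ _ | inj₁ p = inj₁ (d₂ , p)
... | inj₂ x | inj₂ y | inj₂ z = inj₂ λ { d₀ → x ; d₁ → y ; d₂ → z }

next : Dir → Dir
next d₀ = d₁
next d₁ = d₂
next d₂ = d₀

next≢ : ∀ {i} → next i ≢ i
next≢ {d₀} ()
next≢ {d₁} ()
next≢ {d₂} ()

next²≢ : ∀ {i} → next (next i) ≢ i
next²≢ {d₀} ()
next²≢ {d₁} ()
next²≢ {d₂} ()

next-next-next : ∀ i → next (next (next i)) ≡ i
next-next-next d₀ = refl
next-next-next d₁ = refl
next-next-next d₂ = refl

true≢false : ∀ {b} → b ≡ true → b ≡ false → ⊥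
true≢false refl ()

true-or-false : ∀ b → b ≡ true ⊎ b ≡ false
true-or-false true  = inj₁ refl
true-or-false false = inj₂ refl

data One (a b c : Bool) : Set where
  one₁ : a ≡ true → b ≡ false → c ≡ false → One a b c
  one₂ : a ≡ false → b ≡ true → c ≡ false → One a b c
  one₃ : a ≡ false → b ≡ false → c ≡ true → One a b c

record None (a b c : Bool) : Set where
  constructor none
  field
    none₁ : a ≡ false
    none₂ : b ≡ false
    none₃ : c ≡ false
open None public

rotate-one : ∀ {a b c} → One a b c → One b c a
rotate-one (one₁ x y z) = one₃ y z x
rotate-one (one₂ x y z) = one₁ y z x
rotate-one (one₃ x y z) = one₂ y z x

mirror-one : ∀ {a b c} → One a b c → One c b a
mirror-one (one₁ x y z) = one₃ z y x
mirror-one (one₂ x y z) = one₂ z y x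
mirror-one (one₃ x y z) = one₁ z y x

-- The dual of the hexagonal lattice: its triangles are oriented cyclically,
-- and `nx`, `pv` follow the arcs of the three directions forwards and
-- backwards.  The colouring is the proper 3-colouring of the hexagons.
record Lattice : Set₁ where
  field
    Face   : Set
    _≟F_   : DecidableEquality Face
    nx pv  : Dir → Face → Face
    nx-pv  : ∀ i p → nx i (pv i p) ≡ p
    pv-nx  : ∀ i p → pv i (nx i p) ≡ p
    close  : ∀ {c i j l} → Perm c i j l → ∀ p → nx l (nx j (nx i p)) ≡ p
    nx-dir : ∀ {i j} p → nx i p ≡ nx j p → i ≡ j
    colour : Face → Dir
    colour-nx : ∀ i p → colour (nx i p) ≡ next (colour p)

-- Reversal turns sources into sinks and exchanges the two classes of vertices, so that statements
-- about sinks have their duals for free. Two colours trade places because a backward arc lowers the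
-- colour by one modulo 3.
reverse : Lattice → Lattice
reverse L = record
  { Face = Face ; _≟F_ = _≟F_ ; nx = pv ; pv = nx ; nx-pv = pv-nx ; pv-nx = nx-pv
  ; close = λ {c} {i} {j} {l} π p →
      trans (cong (λ q → pv l (pv j (pv i q))) (sym (close (mirror π) p)))
      (trans (cong (λ q → pv l (pv j q)) (pv-nx i _))
      (trans (cong (pv l) (pv-nx j _)) (pv-nx l p)))
  ; nx-dir = λ {i} {j} p eq → nx-dir (pv i p)
      (trans (nx-pv i p) (sym (trans (cong (nx j) eq) (nx-pv j p))))
  ; colour = λ p → flip (colour p)
  ; colour-nx = λ i p → trans (cong flip (back i p)) (flip-next (colour p))
  }
  where
  open Lattice L
  flip : Dir → Dir
  flip d₀ = d₀
  flip d₁ = d₂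
  flip d₂ = d₁
  flip-next : ∀ i → flip (next (next i)) ≡ next (flip i)
  flip-next d₀ = refl
  flip-next d₁ = refl
  flip-next d₂ = refl
  back : ∀ i p → colour (pv i p) ≡ next (next (colour p))
  back i p = trans (sym (next-next-next _))
    (cong (λ x → next (next x)) (trans (sym (colour-nx i (pv i p))) (cong colour (nx-pv i p))))

-- Matchings as sets of arcs: sinks, flips and triphenylenes

module Oriented (L : Lattice) where
  open Lattice L public
  open DecMem _≟F_ public using (_∈?_)

  record Triangle (c : Parity) (p q r : Face) (i j l : Dir) : Set where
    constructor triangle
    field
      perm : Perm c i j l
      pq   : nx i p ≡ q
      qr   : nx j q ≡ r
      rp   : nx l r ≡ p
  open Triangle public

  turn : ∀ {c p q r i j l} → Triangle c p q r i j l → Triangle c q r p j l i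
  turn (triangle π a b c) = triangle (rotate π) b c a

  triangle-at : ∀ {c i j l} → Perm c i j l → ∀ p → Triangle c p (nx i p) (pv l p) i j l
  triangle-at {c} {i} {j} {l} π p =
    triangle π refl (trans (sym (pv-nx l _)) (cong (pv l) (close π p))) (nx-pv l p)

  third≡pv : ∀ {c p q r i j l} → Triangle c p q r i j l → r ≡ pv l p
  third≡pv {l = l} τ = trans (sym (pv-nx l _)) (cong (pv l) (rp τ))

  -- an arc (h , i) stands for the edge between the faces h and nx i h
  ArcSet : Set
  ArcSet = Face → Dir → Bool

  Sink Source : ArcSet → Face → Set
  Sink m h   = ∀ i → m h i ≡ true
  Source m h = ∀ i → m (pv i h) i ≡ true

  Touches : (Face → Set) → Face → Face → Face → Set
  Touches T p q r = T p ⊎ T q ⊎ T r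

  nx≢ : ∀ i p → nx i p ≢ p
  nx≢ i p eq = next≢ (trans (sym (colour-nx i p)) (cong colour eq))

  nx²≢ : ∀ i j p → nx i (nx j p) ≢ p
  nx²≢ i j p eq = next²≢ (trans (cong next (sym (colour-nx j p)))
                          (trans (sym (colour-nx i (nx j p))) (cong colour eq)))

  pv-dir : ∀ {i j} p → pv i p ≡ pv j p → i ≡ j
  pv-dir {i} {j} p eq = nx-dir (pv i p)
    (trans (nx-pv i p) (sym (trans (cong (nx j) eq) (nx-pv j p))))

  module Region (S : List Face) where

    record Matching (m : ArcSet) : Set where
      field
        within : ∀ {h i} → m h i ≡ true → h ∈ S ⊎ nx i h ∈ S
        law    : ∀ {c p q r i j l} → Triangle c p q r i j l → Touches (_∈ S) p q r →
                 One (m p i) (m q j) (m r l)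

    -- a perfect matching of the graph from which the vertices of the faces
    -- in T have been deleted
    record MatchingOff (T : Face → Set) (m : ArcSet) : Set where
      field
        within : ∀ {h i} → m h i ≡ true → h ∈ S ⊎ nx i h ∈ S
        law    : ∀ {c p q r i j l} → Triangle c p q r i j l → Touches (_∈ S) p q r →
                 ¬ Touches T p q r → One (m p i) (m q j) (m r l)
        off    : ∀ {c p q r i j l} → Triangle c p q r i j l → Touches T p q r →
                 None (m p i) (m q j) (m r l)

    module _ {m : ArcSet} (M : Matching m) where
      open Matching M

      sink-in : ∀ {h} → h ∈ S → Sink m h → ∀ i → m (pv i h) i ≡ false
      sink-in {h} h∈S sink i with perm-from {next i} {i} next≢
      ... | c , j , π with law (triangle-at π h) (inj₁ h∈S)
      ... | one₁ x y z = z
      ... | one₂ x y z = ⊥-elim (true≢false (sink (next i)) x)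
      ... | one₃ x y z = ⊥-elim (true≢false (sink (next i)) x)

      source-out : ∀ {h} → h ∈ S → Source m h → ∀ i → m h i ≡ false
      source-out {h} h∈S source i with perm-from {i} {next i} (λ eq → next≢ (sym eq))
      ... | c , j , π with law (triangle-at π h) (inj₁ h∈S)
      ... | one₁ x y z = ⊥-elim (true≢false (source (next i)) z)
      ... | one₂ x y z = x
      ... | one₃ x y z = x

      -- At an end of the arc the source has a matched in-arc and the sink a matched out-arc, and
      -- these are two different edges at one vertex. This is why an edge outside the matching lies
      -- on at most one alternating hexagon.
      open-arc-unique : ∀ {h i} → Source m h → Sink m (nx i h) → h ∈ S → ⊥
      open-arc-unique {h} {i} source sink h∈S with perm-from {i} {next i} (λ eq → next≢ (sym eq))
      ... | c , j , π with law (triangle-at π h) (inj₁ h∈S)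
      ... | one₁ x y z = true≢false (source (next i)) z
      ... | one₂ x y z = true≢false (source (next i)) z
      ... | one₃ x y z = true≢false (sink j) y

    module Flip {m : ArcSet} (M : Matching m) (F : Face → Bool)
                (F-sink : ∀ {h} → F h ≡ true → h ∈ S × Sink m h) where
      open Matching M

      -- All chosen sinks are rotated at once: their out-arcs leave the matching and their in-arcs
      -- enter it. The rotations do not interfere, because two sinks at a common vertex would both
      -- have a matched out-arc there.
      flipped : ArcSet
      flipped h i = (m h i ∧ not (F h)) ∨ F (nx i h)

      private
        only-one : ∀ {c p q r i j l} → Triangle c p q r i j l → F p ≡ true →
                   F q ≡ false × F r ≡ false
        only-one {p = p} {q} {r} {i} {j} {l} τ Fp with F q in Fq | F r in Fr
                 | law τ (inj₁ (proj₁ (F-sink Fp)))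
        ... | true | _ | one₁ x y z = ⊥-elim (true≢false (proj₂ (F-sink Fq) j) y)
        ... | _ | true | one₁ x y z = ⊥-elim (true≢false (proj₂ (F-sink Fr) l) z)
        ... | false | false | one₁ x y z = refl , refl
        ... | _ | _ | one₂ x y z = ⊥-elim (true≢false (proj₂ (F-sink Fp) i) x)
        ... | _ | _ | one₃ x y z = ⊥-elim (true≢false (proj₂ (F-sink Fp) i) x)

        at-flipped : ∀ {c p q r i j l} → Triangle c p q r i j l → F p ≡ true →
                     One (flipped p i) (flipped q j) (flipped r l)
        at-flipped {p = p} {q} {r} {i} {j} {l} τ Fp
          with only-one τ Fp | law τ (inj₁ (proj₁ (F-sink Fp)))
        ... | Fq , Fr | one₂ x y z = ⊥-elim (true≢false (proj₂ (F-sink Fp) i) x)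
        ... | Fq , Fr | one₃ x y z = ⊥-elim (true≢false (proj₂ (F-sink Fp) i) x)
        ... | Fq , Fr | one₁ x y z
          rewrite pq τ | qr τ | rp τ | x | y | z | Fp | Fq | Fr = one₃ refl refl refl

        away : ∀ {c p q r i j l} → Triangle c p q r i j l →
               F p ≡ false → F q ≡ false → F r ≡ false →
               One (m p i) (m q j) (m r l) → One (flipped p i) (flipped q j) (flipped r l)
        away {i = i} {j} {l} τ Fp Fq Fr o rewrite pq τ | qr τ | rp τ | Fp | Fq | Fr = keep o
          where
          simp : ∀ {x b} → x ≡ b → (x ∧ true) ∨ false ≡ b
          simp {true} eq = eq
          simp {false} eq = eq
          keep : ∀ {a b c} → One a b c →
                 One ((a ∧ true) ∨ false) ((b ∧ true) ∨ false) ((c ∧ true) ∨ false)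
          keep (one₁ x y z) = one₁ (simp x) (simp y) (simp z)
          keep (one₂ x y z) = one₂ (simp x) (simp y) (simp z)
          keep (one₃ x y z) = one₃ (simp x) (simp y) (simp z)

      flip-matching : Matching flipped
      flip-matching .Matching.within {h} {i} eq with m h i in mh | F (nx i h) in Fq
      ... | true | _ = within mh
      ... | false | true = inj₂ (proj₁ (F-sink Fq))
      ... | false | false = ⊥-elim (true≢false eq refl)
      flip-matching .Matching.law {p = p} {q} {r} τ act
        with true-or-false (F p) | true-or-false (F q) | true-or-false (F r)
      ... | inj₁ Fp | _ | _ = at-flipped τ Fp
      ... | inj₂ _ | inj₁ Fq | _ = rotate-one (rotate-one (at-flipped (turn τ) Fq))
      ... | inj₂ _ | inj₂ _ | inj₁ Fr = rotate-one (at-flipped (turn (turn τ)) Fr)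
      ... | inj₂ Fp | inj₂ Fq | inj₂ Fr = away τ Fp Fq Fr (law τ act)

    -- the hexagons of a triphenylene
    data Block (t : Face) : Face → Set where
      centre : Block t t
      outer  : ∀ a → Block t (pv a t)

    block? : ∀ t h → Dec (Block t h)
    block? t h with h ≟F t
    ... | yes refl = yes centre
    ... | no h≢t with some-or-all {P = λ a → h ≡ pv a t} {Q = λ a → h ≢ pv a t} (λ a → dec-sum (h ≟F pv a t))
      where
      dec-sum : ∀ {A : Set} → Dec A → A ⊎ ¬ A
      dec-sum (yes x) = inj₁ x
      dec-sum (no x) = inj₂ x
    ... | inj₁ (a , refl) = yes (outer a)
    ... | inj₂ h≢pv = no λ { centre → h≢t refl ; (outer a) → h≢pv a refl }

    -- The triphenylene is then matched within itself, by three edges of the centre and two of each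
    -- outer hexagon. It is that matching of its eighteen vertices in which the central hexagon
    -- alone alternates.
    record Tight (t : Face) (m : ArcSet) : Set where
      field
        tight-sink  : Sink m t
        tight-outer : ∀ {a i} → i ≢ a → m (pv a t) i ≡ true

    Locked : ArcSet → Face → Dir → Set
    Locked m t a = pv a t ∈ S ×
      (∀ k → m (pv a t) k ≡ true ⊎ (nx k (pv a t) ∈ S × Sink m (nx k (pv a t))))

    -- Flip every sink other than t that is entered from an outer face: the
    -- arc used for entering it becomes a matching edge.
    tighten : ∀ {m t} → Matching m → t ∈ S → Sink m t → (∀ a → Locked m t a) →
              ∃[ m′ ] (Matching m′ × Tight t m′)
    tighten {m} {t} M t∈S sink locked = flipped , flip-matching , record
      { tight-sink = λ i → keep-true (sink i) (F-false λ { (a , k , k≢a , eq , _) →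
                 k≢a (nx-dir (pv a t) (trans (sym eq) (sym (nx-pv a t)))) })
      ; tight-outer = λ {a} {i} i≢a → outer-true a i i≢a }
      where
      open Matching M
      Target : Face → Set
      Target h = ∃[ a ] ∃[ k ] (k ≢ a × h ≡ nx k (pv a t) × m (pv a t) k ≡ false)
      target? : ∀ h a k → (k ≢ a × h ≡ nx k (pv a t) × m (pv a t) k ≡ false)
                        ⊎ ¬ (k ≢ a × h ≡ nx k (pv a t) × m (pv a t) k ≡ false)
      target? h a k with k ≟D a | h ≟F nx k (pv a t) | true-or-false (m (pv a t) k)
      ... | no k≢a | yes eq | inj₂ o = inj₁ (k≢a , eq , o)
      ... | yes eq | _ | _ = inj₂ λ x → proj₁ x eq
      ... | no _ | no neq | _ = inj₂ λ x → neq (proj₁ (proj₂ x))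
      ... | no _ | yes _ | inj₁ c = inj₂ λ x → true≢false c (proj₂ (proj₂ x))
      targets? : ∀ h → Dec (Target h)
      targets? h with some-or-all (λ a → some-or-all (target? h a))
      ... | inj₁ x = yes x
      ... | inj₂ no-target = no λ { (a , k , x) → no-target a k x }
      F : Face → Bool
      F h = ⌊ targets? h ⌋
      F-true : ∀ {h} → F h ≡ true → Target h
      F-true {h} eq with targets? h
      F-true _ | yes x = x
      F-true () | no _
      F-false : ∀ {h} → ¬ Target h → F h ≡ false
      F-false {h} ¬x with targets? h
      ... | yes x = ⊥-elim (¬x x)
      ... | no _ = refl
      F-sink : ∀ {h} → F h ≡ true → h ∈ S × Sink m h
      F-sink Fh with F-true Fh
      ... | a , k , k≢a , refl , o with proj₂ (locked a) k
      ... | inj₁ c = ⊥-elim (true≢false c o)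
      ... | inj₂ x = x
      open Flip M F F-sink
      keep-true : ∀ {h i} → m h i ≡ true → F h ≡ false → flipped h i ≡ true
      keep-true mh Fh rewrite mh | Fh = refl
      is-target : ∀ {h} → Target h → F h ≡ true
      is-target {h} x with targets? h
      ... | yes _ = refl
      ... | no ¬x = ⊥-elim (¬x x)
      now-true : ∀ {h i} → m h i ≡ false → F (nx i h) ≡ true → flipped h i ≡ true
      now-true mh Fq rewrite mh = Fq
      outer-true : ∀ a i → i ≢ a → flipped (pv a t) i ≡ true
      outer-true a i i≢a with true-or-false (m (pv a t) i)
      -- An outer hexagon is never flipped itself: its arc into the sink `t` is unmatched, so it is
      -- not a sink.
      ... | inj₁ c = keep-true c (F-false λ x →
        true≢false (proj₂ (F-sink (is-target x)) a) (sink-in M t∈S sink a))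
      ... | inj₂ o = now-true o (is-target (a , i , i≢a , refl , o))

    module _ {m t} (M : Matching m) (block⊆S : ∀ {h} → Block t h → h ∈ S) (tight : Tight t m) where
      open Matching M
      open Tight tight

      -- Testing the tail of an arc suffices: at every vertex of the block the matched arc is one
      -- that starts in the block.
      restricted : ArcSet
      restricted h i = m h i ∧ not ⌊ block? t h ⌋

      private
        outside : ∀ {h} i → ¬ Block t h → restricted h i ≡ m h i
        outside {h} i ¬b with block? t h
        ... | yes b = ⊥-elim (¬b b)
        ... | no _ with m h i
        ...   | true = refl
        ...   | false = refl
        inside : ∀ {h} i → Block t h → restricted h i ≡ false
        inside {h} i b with block? t h
        ... | no ¬b = ⊥-elim (¬b b)
        ... | yes _ with m h i
        ...   | true = refl
        ...   | false = refl
        still-false : ∀ {h i} → m h i ≡ false → restricted h i ≡ false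
        still-false {h} {i} eq rewrite eq = refl

        matched-first : ∀ {c p q r i j l} → Triangle c p q r i j l → Block t p → m p i ≡ true →
                        None (restricted p i) (restricted q j) (restricted r l)
        matched-first {i = i} τ b eq with law τ (inj₁ (block⊆S b))
        ... | one₁ x y z = none (inside i b) (still-false y) (still-false z)
        ... | one₂ x y z = ⊥-elim (true≢false eq x)
        ... | one₃ x y z = ⊥-elim (true≢false eq x)

        off-first : ∀ {c p q r i j l} → Triangle c p q r i j l → Block t p →
                    None (restricted p i) (restricted q j) (restricted r l)
        off-first {i = i} τ centre = matched-first τ centre (tight-sink i)
        off-first {i = i} τ (outer a) with i ≟D a
        ... | no i≢a = matched-first τ (outer a) (tight-outer i≢a)
        -- The arc from an outer hexagon into the centre is unmatched; its ends are covered by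
        -- out-arcs of the centre.
        ... | yes refl with trans (sym (pq τ)) (nx-pv i t)
        ...   | refl with matched-first (turn τ) centre (tight-sink _)
        ...     | none y z x = none x y z

      restrict-matching : MatchingOff (Block t) restricted
      restrict-matching .MatchingOff.within {h} {i} eq with m h i in mh
      ... | true = within mh
      ... | false = ⊥-elim (true≢false eq refl)
      restrict-matching .MatchingOff.law {i = i} {j} {l} τ act ¬b
        rewrite outside i (λ b → ¬b (inj₁ b)) | outside j (λ b → ¬b (inj₂ (inj₁ b)))
              | outside l (λ b → ¬b (inj₂ (inj₂ b))) = law τ act
      restrict-matching .MatchingOff.off τ (inj₁ b) = off-first τ b
      restrict-matching .MatchingOff.off τ (inj₂ (inj₁ b)) with off-first (turn τ) b
      ... | none y z x = none x y z
      restrict-matching .MatchingOff.off τ (inj₂ (inj₂ b)) with off-first (turn (turn τ)) b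
      ... | none z x y = none x y z

    module Extend {t m₀} (M₀ : MatchingOff (Block t) m₀) (block⊆S : ∀ {h} → Block t h → h ∈ S)
                  (Q : ArcSet)
                  (Q-within : ∀ {h i} → Q h i ≡ true → Block t h ⊎ Block t (nx i h))
                  (Q-one : ∀ {c p q r i j l} → Triangle c p q r i j l → Block t p →
                           One (Q p i) (Q q j) (Q r l)) where
      open MatchingOff M₀

      extended : ArcSet
      extended h i = m₀ h i ∨ Q h i

      private
        on : ∀ {a b c a′ b′ c′} → None a b c → One a′ b′ c′ → One (a ∨ a′) (b ∨ b′) (c ∨ c′)
        on (none refl refl refl) o = o
        away : ∀ {a b c a′ b′ c′} → One a b c → None a′ b′ c′ → One (a ∨ a′) (b ∨ b′) (c ∨ c′)
        away (one₁ refl refl refl) (none refl refl refl) = one₁ refl refl refl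
        away (one₂ refl refl refl) (none refl refl refl) = one₂ refl refl refl
        away (one₃ refl refl refl) (none refl refl refl) = one₃ refl refl refl

        touching : ∀ {c p q r i j l} → Triangle c p q r i j l → Touches (Block t) p q r →
                   One (Q p i) (Q q j) (Q r l)
        touching τ (inj₁ b) = Q-one τ b
        touching τ (inj₂ (inj₁ b)) = rotate-one (rotate-one (Q-one (turn τ) b))
        touching τ (inj₂ (inj₂ b)) = rotate-one (Q-one (turn (turn τ)) b)

        Q-false : ∀ {h i} → ¬ Block t h → ¬ Block t (nx i h) → Q h i ≡ false
        Q-false {h} {i} ¬b ¬b′ with true-or-false (Q h i)
        ... | inj₂ eq = eq
        ... | inj₁ eq with Q-within eq
        ...   | inj₁ b = ⊥-elim (¬b b)
        ...   | inj₂ b = ⊥-elim (¬b′ b)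

        missing : ∀ {c p q r i j l} → Triangle c p q r i j l → ¬ Touches (Block t) p q r →
                  None (Q p i) (Q q j) (Q r l)
        missing {p = p} {q} {r} τ ¬b = none
          (Q-false ¬p (λ b → ¬q (subst (Block t) (pq τ) b)))
          (Q-false ¬q (λ b → ¬r (subst (Block t) (qr τ) b)))
          (Q-false ¬r (λ b → ¬p (subst (Block t) (rp τ) b)))
          where
          ¬p : ¬ Block t p
          ¬p b = ¬b (inj₁ b)
          ¬q : ¬ Block t q
          ¬q b = ¬b (inj₂ (inj₁ b))
          ¬r : ¬ Block t r
          ¬r b = ¬b (inj₂ (inj₂ b))

      touches? : ∀ p q r → Dec (Touches (Block t) p q r)
      touches? p q r = block? t p ⊎-dec (block? t q ⊎-dec block? t r)

      extend-matching : Matching extended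
      extend-matching .Matching.within {h} {i} eq with m₀ h i in mh
      ... | true = within mh
      ... | false with Q-within eq
      ...   | inj₁ b = inj₁ (block⊆S b)
      ...   | inj₂ b = inj₂ (block⊆S b)
      extend-matching .Matching.law {p = p} {q} {r} τ act with touches? p q r
      ... | yes b = on (off τ b) (touching τ b)
      ... | no ¬b = away (law τ act ¬b) (missing τ ¬b)

      Q⊆extended : ∀ {h i} → Q h i ≡ true → extended h i ≡ true
      Q⊆extended {h} {i} eq with m₀ h i
      ... | true = refl
      ... | false = eq

    -- The nine edges by which a tight matching covers the block. All of them lie on the perimeter,
    -- since the three interior edges are the in-arcs of the centre.
    data Spoke (t : Face) : Face → Dir → Set where
      from-centre : ∀ i → Spoke t t i
      from-outer  : ∀ {a i} → i ≢ a → Spoke t (pv a t) i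

    -- The other nine edges of the perimeter. As the perimeter runs through all eighteen vertices of
    -- the block, these form a second perfect matching of it, obtained from the spokes by flipping
    -- the perimeter.
    data Inward (t : Face) : Face → Dir → Set where
      inward : ∀ {h i} a → nx i h ≡ pv a t → Inward t h i

    spoke? : ∀ t h i → Dec (Spoke t h i)
    spoke? t h i with block? t h
    ... | no ¬b = no λ { (from-centre _) → ¬b centre ; (from-outer {a} _) → ¬b (outer a) }
    ... | yes centre = yes (from-centre i)
    ... | yes (outer a) with i ≟D a
    ...   | no i≢a = yes (from-outer i≢a)
    ...   | yes refl = no (spoke-false refl)
      where
      spoke-false : ∀ {h} → h ≡ pv i t → ¬ Spoke t h i
      spoke-false eq (from-centre _) = nx≢ i t (trans (cong (nx i) eq) (nx-pv i t))
      spoke-false eq (from-outer {a} i≢a) = i≢a (sym (pv-dir t eq))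

    inward? : ∀ t h i → Dec (Inward t h i)
    inward? t h i with nx i h ≟F pv d₀ t | nx i h ≟F pv d₁ t | nx i h ≟F pv d₂ t
    ... | yes x | _ | _ = yes (inward d₀ x)
    ... | no _ | yes x | _ = yes (inward d₁ x)
    ... | no _ | no _ | yes x = yes (inward d₂ x)
    ... | no x | no y | no z = no λ { (inward d₀ e) → x e ; (inward d₁ e) → y e ; (inward d₂ e) → z e }

    module Triphenylene {t m₀} (M₀ : MatchingOff (Block t) m₀)
                        (block⊆S : ∀ {h} → Block t h → h ∈ S) where
      private
        dec≡true : ∀ {A : Set} (d : Dec A) → A → ⌊ d ⌋ ≡ true
        dec≡true (yes _) _ = refl
        dec≡true (no ¬a) a = ⊥-elim (¬a a)
        dec≡false : ∀ {A : Set} (d : Dec A) → ¬ A → ⌊ d ⌋ ≡ false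
        dec≡false (no _) _ = refl
        dec≡false (yes a) ¬a = ⊥-elim (¬a a)
        dec-holds : ∀ {A : Set} (d : Dec A) → ⌊ d ⌋ ≡ true → A
        dec-holds (yes a) _ = a
        dec-holds (no _) ()

        colour-pv : ∀ a p → next (colour (pv a p)) ≡ colour p
        colour-pv a p = trans (sym (colour-nx a (pv a p))) (cong colour (nx-pv a p))

        -- The colouring keeps faces apart: all outer hexagons have the colour preceding that of
        -- `t`, their successors have the colour of `t`, and two steps from an outer hexagon lead to
        -- the third colour, which does not occur in the block.
        nx-not-block : ∀ i {h} → Block t h → h ≢ t → nx i h ≢ t → ¬ Block t (nx i h)
        nx-not-block i centre h≢t _ _ = h≢t refl
        nx-not-block i {h} (outer a) _ q≢t b = go refl b
          where
          go : ∀ {q} → q ≡ nx i h → Block t q → ⊥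
          go eq centre = q≢t (sym eq)
          go eq (outer a′) = next≢ (trans (cong next (trans (sym (colour-nx i h)) (cong colour (sym eq))))
            (trans (colour-pv a′ t) (sym (colour-pv a t))))

        nx-centre-not-block : ∀ i → ¬ Block t (nx i t)
        nx-centre-not-block i b = go refl b
          where
          go : ∀ {q} → q ≡ nx i t → Block t q → ⊥
          go eq centre = nx≢ i t (sym eq)
          go eq (outer a) = nx²≢ a i t (trans (cong (nx a) (sym eq)) (nx-pv a t))

        nx²-outer-not-block : ∀ i j a → ¬ Block t (nx j (nx i (pv a t)))
        nx²-outer-not-block i j a b = go refl b
          where
          go : ∀ {q} → q ≡ nx j (nx i (pv a t)) → Block t q → ⊥
          go eq centre = next≢ (trans (cong next (sym (colour-pv a t)))
            (trans (cong next (sym (colour-nx i _))) (trans (sym (colour-nx j _)) (sym (cong colour eq)))))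
          go eq (outer a′) = next²≢ (trans (cong next (sym (colour-nx i _))) (trans (sym (colour-nx j _))
            (trans (sym (cong colour eq)) (next-injective (trans (colour-pv a′ t) (sym (colour-pv a t)))))))
            where
            next-injective : ∀ {i j} → next i ≡ next j → i ≡ j
            next-injective {i} {j} eq = trans (sym (next-next-next i))
              (trans (cong (λ x → next (next x)) eq) (next-next-next j))

        not-spoke : ∀ {h i} → ¬ Block t h → ¬ Spoke t h i
        not-spoke ¬b (from-centre _) = ¬b centre
        not-spoke ¬b (from-outer {a} _) = ¬b (outer a)

        spokes inwards : ArcSet
        spokes h i = ⌊ spoke? t h i ⌋
        inwards h i = ⌊ inward? t h i ⌋

        spokes-within : ∀ {h i} → spokes h i ≡ true → Block t h ⊎ Block t (nx i h)
        spokes-within {h} {i} eq with dec-holds (spoke? t h i) eq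
        ... | from-centre _ = inj₁ centre
        ... | from-outer {a} _ = inj₁ (outer a)

        inwards-within : ∀ {h i} → inwards h i ≡ true → Block t h ⊎ Block t (nx i h)
        inwards-within {h} {i} eq with dec-holds (inward? t h i) eq
        ... | inward a e = inj₂ (subst (Block t) (sym e) (outer a))

        spokes-centre : ∀ {c q r i j l} → Triangle c t q r i j l →
                        One (spokes t i) (spokes q j) (spokes r l)
        spokes-centre {q = q} {r} {i} {j} {l} τ = one₁
          (dec≡true (spoke? t t i) (from-centre i))
          (dec≡false (spoke? t q j) (not-spoke λ b → nx-centre-not-block i (subst (Block t) (sym (pq τ)) b)))
          (dec≡false (spoke? t r l) (go (third≡pv τ)))
          where
          go : ∀ {r} → r ≡ pv l t → ¬ Spoke t r l
          go eq (from-centre _) = nx≢ l t (trans (cong (nx l) eq) (nx-pv l t))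
          go eq (from-outer {a} l≢a) = l≢a (sym (pv-dir t eq))

        spokes-one : ∀ {c p q r i j l} → Triangle c p q r i j l → Block t p →
                     One (spokes p i) (spokes q j) (spokes r l)
        spokes-one τ centre = spokes-centre τ
        spokes-one {q = q} {r} {i} {j} {l} τ (outer a) with i ≟D a
        ... | yes refl with trans (sym (pq τ)) (nx-pv i t)
        ...   | refl = rotate-one (rotate-one (spokes-centre (turn τ)))
        spokes-one {q = q} {r} {i} {j} {l} τ (outer a) | no i≢a = one₁
          (dec≡true (spoke? t (pv a t) i) (from-outer i≢a))
          (dec≡false (spoke? t q j) (not-spoke λ b → nx-not-block i (outer a)
            (λ e → nx≢ a t (trans (cong (nx a) (sym e)) (nx-pv a t)))
            (λ e → i≢a (nx-dir (pv a t) (trans e (sym (nx-pv a t)))))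
            (subst (Block t) (sym (pq τ)) b)))
          (dec≡false (spoke? t r l) (not-spoke λ b → nx²-outer-not-block i j a
            (subst (Block t) (trans (sym (qr τ)) (cong (nx j) (sym (pq τ)))) b)))

        not-outer : ∀ {q} → ¬ Block t q → ∀ a → q ≢ pv a t
        not-outer ¬b a eq = ¬b (subst (Block t) (sym eq) (outer a))

        not-inward : ∀ {h i q} → nx i h ≡ q → (∀ a → q ≢ pv a t) → ¬ Inward t h i
        not-inward e ¬o (inward a e′) = ¬o a (trans (sym e) e′)

        inwards-one : ∀ {c p q r i j l} → Triangle c p q r i j l → Block t p →
                      One (inwards p i) (inwards q j) (inwards r l)
        inwards-one {q = q} {r} {i} {j} {l} τ centre = one₂
          (dec≡false (inward? t t i) (not-inward refl (not-outer (nx-centre-not-block i))))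
          (dec≡true (inward? t q j) (inward l (trans (qr τ) (third≡pv τ))))
          (dec≡false (inward? t r l) (not-inward (rp τ) λ a e → nx≢ a t (trans (cong (nx a) e) (nx-pv a t))))
        inwards-one {q = q} {r} {i} {j} {l} τ (outer a) = one₃
          (dec≡false (inward? t (pv a t) i) (not-inward refl λ a′ e → next≢
            (trans (colour-pv a′ t) (trans (sym (colour-pv a t))
            (trans (sym (colour-nx i (pv a t))) (cong colour e))))))
          (dec≡false (inward? t q j) (not-inward (trans (cong (nx j) (sym (pq τ))) refl)
            (not-outer (nx²-outer-not-block i j a))))
          (dec≡true (inward? t r l) (inward a (rp τ)))

        module Sp = Extend M₀ block⊆S spokes spokes-within spokes-one
        module In = Extend M₀ block⊆S inwards inwards-within inwards-one

      m m′ : ArcSet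
      m  = Sp.extended
      m′ = In.extended

      m-matching : Matching m
      m-matching = Sp.extend-matching

      m′-matching : Matching m′
      m′-matching = In.extend-matching

      m-tight : Tight t m
      m-tight = record
        { tight-sink = λ i → Sp.Q⊆extended (dec≡true (spoke? t t i) (from-centre i))
        ; tight-outer = λ {a} {i} i≢a → Sp.Q⊆extended (dec≡true (spoke? t (pv a t) i) (from-outer i≢a)) }

      m′⊆ : ∀ {h i} → m′ h i ≡ true → m h i ≡ true ⊎ Inward t h i
      m′⊆ {h} {i} eq with m₀ h i
      ... | true = inj₁ refl
      ... | false = inj₂ (dec-holds (inward? t h i) eq)

      inward-in-m′ : ∀ {h i} → Inward t h i → m′ h i ≡ true
      inward-in-m′ {h} {i} x = In.Q⊆extended (dec≡true (inward? t h i) x)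

    module _ {t m} (M : Matching m) (block⊆S : ∀ {h} → Block t h → h ∈ S) (tight : Tight t m) where
      open Matching M
      open Tight tight

      inward-open : ∀ {h i} → Inward t h i → m h i ≡ false
      inward-open {h} {i} (inward a e) with avoid a i
      -- By `k≢a` the out-arc of direction `k` is a spoke, and by `k≢i` it meets the in-arc of
      -- direction `i`.
      ... | k , k≢a , k≢i with perm-from k≢i
      ... | c , j , π with law (triangle-at π (pv a t)) (inj₁ (block⊆S (outer a)))
      ... | one₁ x y z = subst (λ p → m p i ≡ false) (trans (cong (pv i) (sym e)) (pv-nx i h)) z
      ... | one₂ x y z = ⊥-elim (true≢false (tight-outer k≢a) x)
      ... | one₃ x y z = ⊥-elim (true≢false (tight-outer k≢a) x)

      outer-not-sink : ∀ a → ¬ Sink m (pv a t)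
      outer-not-sink a sink = true≢false (sink a) (sink-in M (block⊆S centre) tight-sink a)

      -- The reason is that of `open-arc-unique`: the arc ends at an outer hexagon with two matched
      -- out-arcs, and a matched in-arc of `h` would meet one of them.
      inward-not-source : ∀ {h i} → Inward t h i → ¬ Source m h
      inward-not-source {h} {i} (inward a e) source with avoid a i
      ... | j , j≢a , j≢i with perm-from (λ eq → j≢i (sym eq))
      ... | c , l , π with law (triangle-at (rotate (rotate (mirror π))) h)
                         (inj₂ (inj₁ (subst (_∈ S) (sym e) (block⊆S (outer a)))))
      ... | one₁ x y z = true≢false (source l) z
      ... | one₂ x y z = true≢false (source l) z
      ... | one₃ x y z = true≢false (subst (λ q → m q j ≡ true) (sym e) (tight-outer j≢a)) y

-- Bounds on integers

bounded : ∀ {A : Set} (g : A → ℤ) (xs : List A) → ∃[ B ] (∀ {x} → x ∈ xs → g x ℤ.≤ B)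
bounded g [] = + 0 , λ ()
bounded g (x ∷ xs) with bounded g xs
... | B , h = g x ℤ.⊔ B , λ { (here refl) → ℤP.i≤i⊔j (g x) B
                             ; (there p) → ℤP.≤-trans (h p) (ℤP.i≤j⊔i (g x) B) }

≤∣∣ : ∀ i → i ℤ.≤ + ∣ i ∣
≤∣∣ (+ n)    = ℤP.≤-refl
≤∣∣ -[1+ n ] = ℤ.-≤+

<∣∣ : ∀ B a → B ℤ.< a + + suc ∣ B - a ∣
<∣∣ B a = begin-strict
  B                       ≡⟨ lemma B a ⟩
  a + (B - a)             ≤⟨ ℤP.+-monoʳ-≤ a (≤∣∣ (B - a)) ⟩
  a + + ∣ B - a ∣         <⟨ ℤP.+-monoʳ-< a (ℤ.+<+ (ℕ.s≤s ℕP.≤-refl)) ⟩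
  a + + suc ∣ B - a ∣     ∎
  where
  open ℤP.≤-Reasoning
  import Data.Nat.Properties as ℕP
  lemma : ∀ B a → B ≡ a + (B - a)
  lemma = solve-∀

-- Descent along the height

module Descent (L : Lattice) (S : List (Lattice.Face L)) where
  open Oriented L
  open Region S

  -- The equality is the contribution of the arc chosen for the anti-forcing set: neither of the two
  -- matchings contains it, so `f` does not change across it.
  Escape : ArcSet → (Face → ℤ) → Face → Set
  Escape m f h = ∃[ i ] (f h ≡ f (pv i h) × (pv i h ∉ S ⊎
    ∃[ k ] (m (pv i h) k ≡ false × (nx k (pv i h) ∉ S ⊎ ¬ Sink m (nx k (pv i h))))))

  module _ {m : ArcSet} (M : Matching m) {f ht : Face → ℤ} {κ : ℕ}
           (f-off  : ∀ {h} → h ∉ S → f h ≡ + 0)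
           (f-mono : ∀ {h i} → m h i ≡ false → f h ℤ.≤ f (nx i h))
           (ht-up  : ∀ {h i} → h ∈ S → nx i h ∈ S → m h i ≡ false → ht (nx i h) ≡ ht h + + suc κ)
           (escape : ∀ {h} → h ∈ S → Sink m h → Escape m f h) where

    private
      sink-or-open : ∀ h → ∃[ i ] (m h i ≡ false) ⊎ Sink m h
      sink-or-open h = some-or-all λ i → swap (true-or-false (m h i))
        where
        swap : ∀ {A B : Set} → A ⊎ B → B ⊎ A
        swap (inj₁ x) = inj₂ x
        swap (inj₂ y) = inj₁ y

      off≤ : ∀ {h} → h ∉ S → f h ℤ.≤ + 0
      off≤ h∉S = ℤP.≤-reflexive (f-off h∉S)

      climb : ∀ {B} (n : ℕ) {x y} → B ℤ.< x + + suc n → y ≡ x + + suc κ → B ℤ.< y + + n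
      climb {B} n {x} {y} lt refl = begin-strict
        B                       <⟨ lt ⟩
        x + + suc n             ≤⟨ ℤP.i≤i+j (x + + suc n) (+ κ) ⟩
        x + + suc n + + κ       ≡⟨ lemma x (+ n) (+ κ) ⟩
        x + + suc κ + + n       ∎
        where
        open ℤP.≤-Reasoning
        lemma : ∀ x n k → x + (+ 1 + n) + k ≡ x + (+ 1 + k) + n
        lemma = solve-∀

    -- Heights on the finite region stay below `B`, so `n` is fuel for the walk: each recursive call
    -- happens at a hexagon higher by `suc κ`, which is at least the one unit of fuel spent. Without
    -- fuel the hexagon would be higher than the bound.
    nonpositive-within : ∀ {B} → (∀ {h} → h ∈ S → ht h ℤ.≤ B) →
                         ∀ n {h} → h ∈ S → B ℤ.< ht h + + n → f h ℤ.≤ + 0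
    nonpositive-within {B} ≤B zero {h} h∈S lt =
      ⊥-elim (ℤP.<-irrefl refl (ℤP.<-≤-trans (subst (B ℤ.<_) (ℤP.+-identityʳ (ht h)) lt) (≤B h∈S)))
    nonpositive-within {B} ≤B (suc n) {h} h∈S lt with sink-or-open h
    ... | inj₁ (i , o) with nx i h ∈? S
    ...   | no q∉S = ℤP.≤-trans (f-mono o) (off≤ q∉S)
    ...   | yes q∈S = ℤP.≤-trans (f-mono o)
              (nonpositive-within ≤B n q∈S (climb n {ht h} lt (ht-up h∈S q∈S o)))
    nonpositive-within {B} ≤B (suc n) {h} h∈S lt | inj₂ sink with escape h∈S sink
    ... | i , eq , inj₁ ∉S = ℤP.≤-trans (ℤP.≤-reflexive eq) (off≤ ∉S)
    ... | i , eq , inj₂ (k , o , rest) with pv i h ∈? S | nx k (pv i h) ∈? S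
    ...   | no ∉S | _ = ℤP.≤-trans (ℤP.≤-reflexive eq) (off≤ ∉S)
    ...   | yes _ | no ∉S = ℤP.≤-trans (ℤP.≤-reflexive eq) (ℤP.≤-trans (f-mono o) (off≤ ∉S))
    ...   | yes b∈S | yes q∈S with rest | sink-or-open (nx k (pv i h))
    ...     | inj₁ q∉S | _ = ⊥-elim (q∉S q∈S)
    ...     | inj₂ ¬sink | inj₂ sink′ = ⊥-elim (¬sink sink′)
    ...     | inj₂ ¬sink | inj₁ (j , o′) =
            ℤP.≤-trans (ℤP.≤-reflexive eq) (ℤP.≤-trans (f-mono o) (ℤP.≤-trans (f-mono o′) last-step))
      where
      q = nx k (pv i h)
      -- One unmatched arc backwards and one forwards: the detour is level. The strict gain is left
      -- to the next arc, which exists because `q` is not a sink.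
      level : ht q ≡ ht h
      level = trans (ht-up b∈S q∈S o) (sym (trans (sym (cong ht (nx-pv i h)))
        (ht-up b∈S (subst (_∈ S) (sym (nx-pv i h)) h∈S) (sink-in M h∈S sink i))))
      last-step : f (nx j q) ℤ.≤ + 0
      last-step with nx j q ∈? S
      ... | no ∉S = off≤ ∉S
      ... | yes r∈S = nonpositive-within ≤B n r∈S
              (climb n {ht h} lt (trans (ht-up q∈S r∈S o′) (cong (_+ + suc κ) level)))

    nonpositive : ∀ h → f h ℤ.≤ + 0
    nonpositive h with h ∈? S
    ... | no h∉S = off≤ h∉S
    ... | yes h∈S with bounded ht S
    ...   | B , ≤B = nonpositive-within ≤B _ h∈S (<∣∣ B (ht h))

-- Transport of matchings to the reversed lattice

module Reversal (L : Lattice) (S : List (Lattice.Face L)) where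
  open Oriented L
  open Region S
  private
    module Rev = Oriented (reverse L)
    module RevS = Rev.Region S

  -- An arc is indexed by its tail, and reversal makes the former head the tail; hence the shift of
  -- the index.
  reversed restored : ArcSet → ArcSet
  reversed m h i = m (pv i h) i
  restored m h i = m (nx i h) i

  reverse-triangle : ∀ {c p q r i j l} → Triangle c p q r i j l → Rev.Triangle (opposite c) p r q l j i
  reverse-triangle {i = i} {j} {l} τ = Rev.triangle (mirror (perm τ))
    (sym (third≡pv τ)) (sym (third≡pv (turn (turn τ)))) (sym (third≡pv (turn τ)))

  restore-triangle : ∀ {c p q r i j l} → Rev.Triangle c p q r i j l → Triangle (opposite c) p r q l j i
  restore-triangle {i = i} {j} {l} τ = triangle (mirror (Rev.perm τ))
    (sym (Rev.third≡pv τ)) (sym (Rev.third≡pv (Rev.turn (Rev.turn τ)))) (sym (Rev.third≡pv (Rev.turn τ)))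

  swap-touches : ∀ {T p q r} → Touches T p q r → Touches T p r q
  swap-touches (inj₁ x) = inj₁ x
  swap-touches (inj₂ (inj₁ x)) = inj₂ (inj₂ x)
  swap-touches (inj₂ (inj₂ x)) = inj₂ (inj₁ x)

  module _ {T : Face → Set} {m : ArcSet} where

    reverse-off : MatchingOff T m → RevS.MatchingOff T (reversed m)
    reverse-off M = record
      { within = λ {h} {i} eq → within′ i (within eq)
      ; law = λ τ t ¬t → one τ (law (restore-triangle τ) (swap-touches {_∈ S} t) λ x → ¬t (swap-touches {T} x))
      ; off = λ τ t → no-one τ (off (restore-triangle τ) (swap-touches {T} t)) }
      where
      open MatchingOff M
      within′ : ∀ i {h} → pv i h ∈ S ⊎ nx i (pv i h) ∈ S → h ∈ S ⊎ pv i h ∈ S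
      within′ i (inj₁ x) = inj₂ x
      within′ i {h} (inj₂ x) = inj₁ (subst (_∈ S) (nx-pv i h) x)
      one : ∀ {c p q r i j l} → Rev.Triangle c p q r i j l → One (m p l) (m r j) (m q i) →
            One (m (pv i p) i) (m (pv j q) j) (m (pv l r) l)
      one τ o rewrite Rev.pq τ | Rev.qr τ | Rev.rp τ = mirror-one o
      no-one : ∀ {c p q r i j l} → Rev.Triangle c p q r i j l → None (m p l) (m r j) (m q i) →
               None (m (pv i p) i) (m (pv j q) j) (m (pv l r) l)
      no-one τ (none x y z) rewrite Rev.pq τ | Rev.qr τ | Rev.rp τ = none z y x

    restore-off : RevS.MatchingOff T m → MatchingOff T (restored m)
    restore-off M = record
      { within = λ {h} {i} eq → within′ i (within eq)
      ; law = λ τ t ¬t → one τ (law (reverse-triangle τ) (swap-touches {_∈ S} t) λ x → ¬t (swap-touches {T} x))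
      ; off = λ τ t → no-one τ (off (reverse-triangle τ) (swap-touches {T} t)) }
      where
      open RevS.MatchingOff M
      within′ : ∀ i {h} → nx i h ∈ S ⊎ pv i (nx i h) ∈ S → h ∈ S ⊎ nx i h ∈ S
      within′ i (inj₁ x) = inj₂ x
      within′ i {h} (inj₂ x) = inj₁ (subst (_∈ S) (pv-nx i h) x)
      one : ∀ {c p q r i j l} → Triangle c p q r i j l → One (m p l) (m r j) (m q i) →
            One (m (nx i p) i) (m (nx j q) j) (m (nx l r) l)
      one τ o rewrite pq τ | qr τ | rp τ = mirror-one o
      no-one : ∀ {c p q r i j l} → Triangle c p q r i j l → None (m p l) (m r j) (m q i) →
               None (m (nx i p) i) (m (nx j q) j) (m (nx l r) l)
      no-one τ (none x y z) rewrite pq τ | qr τ | rp τ = none z y x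

  untouched : ¬ (⊥ ⊎ ⊥ ⊎ ⊥)
  untouched (inj₁ ())
  untouched (inj₂ (inj₁ ()))
  untouched (inj₂ (inj₂ ()))

  reverse-matching : ∀ {m} → Matching m → RevS.Matching (reversed m)
  reverse-matching {m} M = record { within = within ; law = λ τ t → law τ t untouched }
    where
    -- A perfect matching is one off the empty set of faces, so a single proof reverses both kinds.
    nothing-off : MatchingOff (λ _ → ⊥) m
    nothing-off = record { within = Matching.within M ; law = λ τ t _ → Matching.law M τ t
                         ; off = λ τ t → ⊥-elim (untouched t) }
    open RevS.MatchingOff (reverse-off nothing-off)

  restore-matching : ∀ {m} → RevS.Matching m → Matching (restored m)
  restore-matching {m} M = record { within = within ; law = λ τ t → law τ t untouched }
    where
    nothing-off : RevS.MatchingOff (λ _ → ⊥) m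
    nothing-off = record { within = RevS.Matching.within M ; law = λ τ t _ → RevS.Matching.law M τ t
                         ; off = λ τ t → ⊥-elim (untouched t) }
    open MatchingOff (restore-off nothing-off)

-- Exits from a sink, or a triphenylene around it

module Sinks (L : Lattice) (S : List (Lattice.Face L)) where
  open Oriented L
  open Region S

  Exit : ArcSet → Face → Dir → Set
  Exit m h i = pv i h ∉ S ⊎ ∃[ k ] (m (pv i h) k ≡ false × (nx k (pv i h) ∉ S ⊎ ¬ Sink m (nx k (pv i h))))

  sink-or-not : ∀ m h → Sink m h ⊎ ¬ Sink m h
  sink-or-not m h with some-or-all {P = λ i → m h i ≡ false} {Q = λ i → m h i ≡ true} (λ i → swap (true-or-false (m h i)))
    where
    swap : ∀ {A B : Set} → A ⊎ B → B ⊎ A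
    swap (inj₁ x) = inj₂ x
    swap (inj₂ y) = inj₁ y
  ... | inj₁ (i , eq) = inj₂ λ sink → true≢false (sink i) eq
  ... | inj₂ sink = inj₁ sink

  exit-or-locked : ∀ m t → ∃ (Exit m t) ⊎ (∀ i → Locked m t i)
  exit-or-locked m t = some-or-all at
    where
    beyond : ∀ i k → (m (pv i t) k ≡ false × (nx k (pv i t) ∉ S ⊎ ¬ Sink m (nx k (pv i t))))
                   ⊎ (m (pv i t) k ≡ true ⊎ (nx k (pv i t) ∈ S × Sink m (nx k (pv i t))))
    beyond i k with true-or-false (m (pv i t) k) | nx k (pv i t) ∈? S | sink-or-not m (nx k (pv i t))
    ... | inj₁ c | _ | _ = inj₂ (inj₁ c)
    ... | inj₂ o | no ∉S | _ = inj₁ (o , inj₁ ∉S)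
    ... | inj₂ o | yes ∈S | inj₂ ¬s = inj₁ (o , inj₂ ¬s)
    ... | inj₂ o | yes ∈S | inj₁ s = inj₂ (inj₂ (∈S , s))
    at : ∀ i → Exit m t i ⊎ Locked m t i
    at i with pv i t ∈? S | some-or-all (beyond i)
    ... | no ∉S | _ = inj₁ (inj₁ ∉S)
    ... | yes ∈S | inj₁ (k , x) = inj₁ (inj₂ (k , x))
    ... | yes ∈S | inj₂ x = inj₂ (∈S , x)

  BlockMatching : Face → Set
  BlockMatching t = (∀ {h} → Block t h → h ∈ S) × ∃ (MatchingOff (Block t))

  exit-or-block : ∀ {m t} → Matching m → t ∈ S → Sink m t → ∃ (Exit m t) ⊎ BlockMatching t
  exit-or-block {m} {t} M t∈S sink with exit-or-locked m t
  ... | inj₁ x = inj₁ x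
  ... | inj₂ locked with tighten M t∈S sink locked
  ...   | m′ , M′ , tight = inj₂ (block⊆S , _ , restrict-matching M′ block⊆S tight)
    where
    block⊆S : ∀ {h} → Block t h → h ∈ S
    block⊆S centre = t∈S
    block⊆S (outer a) = proj₁ (locked a)

  module FlipSink {m t} (M : Matching m) (t∈S : t ∈ S) (sink : Sink m t) where
    private
      is-t : Face → Bool
      is-t h = ⌊ h ≟F t ⌋
      is-t-sink : ∀ {h} → is-t h ≡ true → h ∈ S × Sink m h
      is-t-sink {h} eq with h ≟F t
      is-t-sink _ | yes refl = t∈S , sink
      is-t-sink () | no _
    open Flip M is-t is-t-sink public using (flipped; flip-matching)

    flipped⊆ : ∀ {h i} → flipped h i ≡ true → m h i ≡ true ⊎ nx i h ≡ t
    flipped⊆ {h} {i} eq with nx i h ≟F t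
    ... | yes x = inj₂ x
    ... | no _ with m h i
    ...   | true = inj₁ refl
    ...   | false = ⊥-elim (true≢false eq refl)

    flipped-in : ∀ i → flipped (pv i t) i ≡ true
    flipped-in i with nx i (pv i t) ≟F t
    ... | yes _ = BoolP.∨-zeroʳ _
    ... | no ≢t = ⊥-elim (≢t (nx-pv i t))

-- Linear algebra over ℤ

extract : ∀ {A : Set} {P : A → Set} → (∀ x → Dec (P x)) → ∀ xs →
          All P xs ⊎ ∃[ x ] ∃[ ys ] (¬ P x × length xs ≡ suc (length ys)
            × (∀ {Q : A → Set} → Q x → All Q ys → All Q xs))
extract P? [] = inj₁ []
extract P? (x ∷ xs) with P? x | extract P? xs
... | no ¬p | _ = inj₂ (x , xs , ¬p , refl , λ q qs → q ∷ qs)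
... | yes p | inj₁ ps = inj₁ (p ∷ ps)
... | yes p | inj₂ (y , ys , ¬py , len , back) =
  inj₂ (y , x ∷ ys , ¬py , cong suc len , λ { q (q′ ∷ qs) → q′ ∷ back q qs })

module Elimination {C : Set} (_≟_ : DecidableEquality C) where

  -- Linearity is stated for this very `λ`, so that it applies by definitional equality to the
  -- combination built in `nontrivial-zero`, in place of extensionality of functions.
  IsLinear : ((C → ℤ) → ℤ) → Set
  IsLinear φ = ∀ a b u w → φ (λ j → a * u j + b * w j) ≡ a * φ u + b * φ w

  Form : Set
  Form = Σ ((C → ℤ) → ℤ) IsLinear

  unit : C → C → ℤ
  unit j i with i ≟ j
  ... | yes _ = + 1
  ... | no _  = + 0

  unit-self : ∀ j → unit j j ≡ + 1
  unit-self j with j ≟ j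
  ... | yes _ = refl
  ... | no j≢j = ⊥-elim (j≢j refl)

  unit-other : ∀ {i j} → i ≢ j → unit j i ≡ + 0
  unit-other {i} {j} i≢j with i ≟ j
  ... | yes i≡j = ⊥-elim (i≢j i≡j)
  ... | no _ = refl

  -- fraction-free Gaussian elimination with pivot ψ
  eliminate : C → Form → Form → Form
  eliminate j (ψ , ψ-lin) (φ , φ-lin) =
    (λ u → ψ (unit j) * φ u - φ (unit j) * ψ u) ,
    λ a b u w → trans (cong₂ (λ x y → ψ (unit j) * x - φ (unit j) * y) (φ-lin a b u w) (ψ-lin a b u w))
                      (lemma (ψ (unit j)) (φ (unit j)) a b (φ u) (φ w) (ψ u) (ψ w))
    where
    lemma : ∀ s t a b x y z v → s * (a * x + b * y) - t * (a * z + b * v)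
            ≡ a * (s * x - t * z) + b * (s * y - t * v)
    lemma = solve-∀

  -- Induction on the columns. If all forms vanish on the unit vector of `j`, that vector is the
  -- zero sought. Otherwise a form with nonzero pivot eliminates `j` from the others and afterwards
  -- determines the entry at `j`; scaling the rest by the pivot replaces division. The result stays
  -- nonzero because the recursive solution has a nonzero entry, and that entry is not at `j`.
  nontrivial-zero : (φs : List Form) (cols : List C) → Unique cols → length φs ℕ.< length cols →
    ∃[ u ] ((∀ {j} → j ∉ cols → u j ≡ + 0) × (∃[ j ] u j ≢ + 0) × All (λ φ → proj₁ φ u ≡ + 0) φs)
  nontrivial-zero φs (j ∷ js) (j∉js ∷ js!) (ℕ.s≤s len)
    with extract (λ φ → proj₁ φ (unit j) ℤP.≟ + 0) φs
  ... | inj₁ zeros = unit j , (λ i∉ → unit-other λ eq → i∉ (here eq)) ,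
        (j , λ eq → 1≢0 (trans (sym (unit-self j)) eq)) , zeros
    where
    1≢0 : + 1 ≢ + 0
    1≢0 ()
  ... | inj₂ (ψ* @ (ψ , ψ-lin) , rest , pivot , split , back)
    with nontrivial-zero (map (eliminate j ψ*) rest) js js!
           (subst (ℕ._≤ length js) (trans split (cong suc (sym (length-map _ rest)))) len)
  ... | u , support , (i , ui≢0) , zeros = w , w-support , (i , wi≢0) ,
        back ψw≡0 (All.map (λ {φ} → φw≡0 φ) (AllP.map⁻ zeros))
    where
    s t : ℤ
    s = ψ (unit j)
    t = - ψ u
    w : C → ℤ
    w k = s * u k + t * unit j k
    w-support : ∀ {k} → k ∉ j ∷ js → w k ≡ + 0
    w-support k∉ rewrite support (λ k∈ → k∉ (there k∈)) | unit-other (λ eq → k∉ (here eq)) = lemma s t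
      where
      lemma : ∀ s t → s * + 0 + t * + 0 ≡ + 0
      lemma = solve-∀
    i≢j : i ≢ j
    i≢j refl = ui≢0 (support λ i∈ → All.lookup j∉js i∈ refl)
    wi≢0 : w i ≢ + 0
    wi≢0 eq rewrite unit-other i≢j with ℤP.i*j≡0⇒i≡0∨j≡0 s (trans (lemma (s * u i) t) eq)
      where
      lemma : ∀ x t → x ≡ x + t * + 0
      lemma = solve-∀
    ... | inj₁ s≡0 = pivot s≡0
    ... | inj₂ u≡0 = ui≢0 u≡0
    ψw≡0 : ψ w ≡ + 0
    ψw≡0 = trans (ψ-lin s t u (unit j)) (lemma s (ψ u))
      where
      lemma : ∀ s x → s * x + - x * s ≡ + 0
      lemma = solve-∀
    φw≡0 : ∀ φ → proj₁ (eliminate j ψ* φ) u ≡ + 0 → proj₁ φ w ≡ + 0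
    φw≡0 (φ , φ-lin) eq = trans (φ-lin s t u (unit j)) (trans (lemma s (φ u) (ψ u) (φ (unit j))) eq)
      where
      lemma : ∀ s x y z → s * x + - y * z ≡ s * x - z * y
      lemma = solve-∀

module _ {A : Set} (g : A → ℤ) where
  maximiser : ∀ x xs → ∃[ m ] (m ∈ x ∷ xs × ∀ {y} → y ∈ x ∷ xs → g y ℤ.≤ g m)
  maximiser x [] = x , here refl , λ { (here refl) → ℤP.≤-refl }
  maximiser x (x′ ∷ xs) with maximiser x′ xs
  ... | m , m∈ , max with ℤP.≤-total (g x) (g m)
  ...   | inj₁ x≤m = m , there m∈ , λ { (here refl) → x≤m ; (there p) → max p }
  ...   | inj₂ m≤x = x , here refl , λ { (here refl) → ℤP.≤-refl ; (there p) → ℤP.≤-trans (max p) m≤x }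

  maximum : ∀ {x} {xs} → x ∈ xs → ∃[ m ] (m ∈ xs × ∀ {y} → y ∈ xs → g y ℤ.≤ g m)
  maximum {xs = x′ ∷ xs} _ = maximiser x′ xs

-- The dual of the brick wall

cycle : ℕ → Dir
cycle zero = d₀
cycle (suc n) = next (cycle n)

-- Reduction modulo 3; `-(n + 1)` is congruent to `2n + 2`. It is applied to `a - b`, which each arc
-- changes by 1 or by -2.
residue : ℤ → Dir
residue (+ n)    = cycle n
residue -[1+ n ] = next (next (cycle (n ℕ.+ n)))

hexLattice : Lattice
hexLattice = record
  { Face = Hex ; _≟F_ = ≡-dec ℤP._≟_ ℤP._≟_ ; nx = forth ; pv = back
  ; nx-pv = step-back ; pv-nx = back-step
  ; close = closing ; nx-dir = step-dir ; colour = colouring ; colour-nx = colouring-step }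
  where
  -- In the brick wall, `d₀`, `d₁` and `d₂` leave a brick through its lower left, right and upper
  -- left edge.
  forth back : Dir → Hex → Hex
  forth d₀ (a , b) = a , b - + 1
  forth d₁ (a , b) = a + + 1 , b
  forth d₂ (a , b) = a - + 1 , b + + 1
  back d₀ (a , b) = a , b + + 1
  back d₁ (a , b) = a - + 1 , b
  back d₂ (a , b) = a + + 1 , b - + 1
  -+ : ∀ x → x + + 1 - + 1 ≡ x
  -+ = solve-∀
  +- : ∀ x → x - + 1 + + 1 ≡ x
  +- = solve-∀
  step-back : ∀ i p → forth i (back i p) ≡ p
  step-back d₀ (a , b) = cong (a ,_) (-+ b)
  step-back d₁ (a , b) = cong (_, b) (+- a)
  step-back d₂ (a , b) = cong₂ _,_ (-+ a) (+- b)
  back-step : ∀ i p → back i (forth i p) ≡ p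
  back-step d₀ (a , b) = cong (a ,_) (+- b)
  back-step d₁ (a , b) = cong (_, b) (-+ a)
  back-step d₂ (a , b) = cong₂ _,_ (+- a) (-+ b)
  closing : ∀ {c i j l} → Perm c i j l → ∀ p → forth l (forth j (forth i p)) ≡ p
  closing p012 (a , b) = cong₂ _,_ (-+ a) (+- b)
  closing p120 (a , b) = cong₂ _,_ (-+ a) (-+ b)
  closing p201 (a , b) = cong₂ _,_ (+- a) (-+ b)
  closing p021 (a , b) = cong₂ _,_ (+- a) (+- b)
  closing p210 (a , b) = cong₂ _,_ (+- a) (-+ b)
  closing p102 (a , b) = cong₂ _,_ (-+ a) (+- b)
  move : ∀ {x y} z → x + y ≡ x + z → y ≡ z
  move {x} {y} z eq = trans (sym (lemma x y)) (trans (cong (_- x) eq) (lemma x z))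
    where
    lemma : ∀ x y → x + y - x ≡ y
    lemma = solve-∀
  unmoved : ∀ {x} y → x ≡ x + y → y ≡ + 0
  unmoved {x} y eq = sym (move {x} y (trans (ℤP.+-identityʳ x) eq))
  step-dir : ∀ {i j} p → forth i p ≡ forth j p → i ≡ j
  step-dir {d₀} {d₀} p eq = refl
  step-dir {d₁} {d₁} p eq = refl
  step-dir {d₂} {d₂} p eq = refl
  step-dir {d₀} {d₁} (a , b) eq with unmoved {a} (+ 1) (cong proj₁ eq)
  ... | ()
  step-dir {d₀} {d₂} (a , b) eq with unmoved {a} (- + 1) (cong proj₁ eq)
  ... | ()
  step-dir {d₁} {d₀} (a , b) eq with unmoved {a} (+ 1) (cong proj₁ (sym eq))
  ... | ()
  step-dir {d₁} {d₂} (a , b) eq with unmoved {b} (+ 1) (cong proj₂ eq)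
  ... | ()
  step-dir {d₂} {d₀} (a , b) eq with unmoved {a} (- + 1) (cong proj₁ (sym eq))
  ... | ()
  step-dir {d₂} {d₁} (a , b) eq with unmoved {b} (+ 1) (cong proj₂ (sym eq))
  ... | ()
  residue-suc : ∀ z → residue (z + + 1) ≡ next (residue z)
  residue-suc (+ n) rewrite ℕP.+-comm n 1 = refl
  residue-suc -[1+ zero ] = refl
  residue-suc -[1+ suc n ] rewrite ℕP.+-suc n n = sym (next-next-next _)
  colouring : Hex → Dir
  colouring (a , b) = residue (a - b)
  colouring-step : ∀ i p → colouring (forth i p) ≡ next (colouring p)
  colouring-step d₀ (a , b) = trans (cong residue (lemma a b)) (residue-suc (a - b))
    where
    lemma : ∀ a b → a - (b - + 1) ≡ a - b + + 1
    lemma = solve-∀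
  colouring-step d₁ (a , b) = trans (cong residue (lemma a b)) (residue-suc (a - b))
    where
    lemma : ∀ a b → a + + 1 - b ≡ a - b + + 1
    lemma = solve-∀
  colouring-step d₂ (a , b) = trans (sym (next-next-next _)) (cong next (trans
    (cong next (sym (residue-suc z))) (trans (sym (residue-suc (z + + 1))) (cong residue (lemma a b)))))
    where
    z = a - + 1 - (b + + 1)
    lemma : ∀ a b → a - + 1 - (b + + 1) + + 1 + + 1 ≡ a - b
    lemma = solve-∀

open Oriented hexLattice public

-- A vertex is named by its parity and the one brick of which it is the lower left corner (even) or
-- the middle of the lower side (odd). `end c i p` is the brick naming the end of parity `c` of the
-- arc `(p , i)`.
end : Parity → Dir → Hex → Hex
end even d₀ p = p
end even d₁ p = nx d₁ p
end even d₂ p = pv d₀ p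
end odd  d₀ p = p
end odd  d₁ p = pv d₀ p
end odd  d₂ p = nx d₂ p

nx-injective : ∀ i {p q} → nx i p ≡ nx i q → p ≡ q
nx-injective i {p} {q} eq = trans (sym (pv-nx i p)) (trans (cong (pv i) eq) (pv-nx i q))

pv-injective : ∀ i {p q} → pv i p ≡ pv i q → p ≡ q
pv-injective i {p} {q} eq = trans (sym (nx-pv i p)) (trans (cong (nx i) eq) (nx-pv i q))

end-injective : ∀ c i {p q} → end c i p ≡ end c i q → p ≡ q
end-injective even d₀ eq = eq
end-injective even d₁ eq = nx-injective d₁ eq
end-injective even d₂ eq = pv-injective d₀ eq
end-injective odd  d₀ eq = eq
end-injective odd  d₁ eq = pv-injective d₀ eq
end-injective odd  d₂ eq = nx-injective d₂ eq

end-perm : ∀ {c i j l} → Perm c i j l → ∀ p → end c j (nx i p) ≡ end c i p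
end-perm p021 p = pv-nx d₀ p
end-perm p102 p = refl
end-perm p210 p = trans (sym (pv-nx d₀ _)) (cong (pv d₀) (close p210 p))
end-perm p012 p = pv-nx d₀ p
end-perm p120 p = trans (sym (pv-nx d₀ _)) (cong (pv d₀) (close p120 p))
end-perm p201 p = refl

end-turn : ∀ {c p q r i j l} → Triangle c p q r i j l → end c j q ≡ end c i p
end-turn {c} {p} {j = j} (triangle π a b _) = trans (cong (end c j) (sym a)) (end-perm π p)

data AtVertex (p q r : Hex) (i j l : Dir) : Hex → Dir → Set where
  at₁ : AtVertex p q r i j l p i
  at₂ : AtVertex p q r i j l q j
  at₃ : AtVertex p q r i j l r l

at-vertex : ∀ {c p q r i j l} → Triangle c p q r i j l →
            ∀ h k → end c k h ≡ end c i p → AtVertex p q r i j l h k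
at-vertex {c} {p} {q} {r} {i} {j} {l} τ h k eq = go (perm-covers (perm τ) k)
  where
  go : k ≡ i ⊎ k ≡ j ⊎ k ≡ l → AtVertex p q r i j l h k
  go (inj₁ refl) with end-injective c i eq
  ... | refl = at₁
  go (inj₂ (inj₁ refl)) with end-injective c j (trans eq (sym (end-turn τ)))
  ... | refl = at₂
  go (inj₂ (inj₂ refl)) with end-injective c l (trans eq (trans (sym (end-turn τ)) (sym (end-turn (turn τ)))))
  ... | refl = at₃

cong₃ : ∀ {A B : Set} (f : A → A → A → B) {a a′ b b′ c c′} →
        a ≡ a′ → b ≡ b′ → c ≡ c′ → f a b c ≡ f a′ b′ c′
cong₃ f refl refl refl = refl

-- Potentials from Euler's formula

data Unknown : Set where
  scale  : Unknown
  face   : Hex → Unknown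
  vertex : Parity × Hex → Unknown

_≟P_ : DecidableEquality Parity
even ≟P even = yes refl
even ≟P odd  = no λ ()
odd  ≟P even = no λ ()
odd  ≟P odd  = yes refl

_≟U_ : DecidableEquality Unknown
scale    ≟U scale    = yes refl
scale    ≟U face _   = no λ ()
scale    ≟U vertex _ = no λ ()
face _   ≟U scale    = no λ ()
face p   ≟U face q with p ≟F q
... | yes refl = yes refl
... | no p≢q = no λ { refl → p≢q refl }
face _   ≟U vertex _ = no λ ()
vertex _ ≟U scale    = no λ ()
vertex _ ≟U face _   = no λ ()
vertex u ≟U vertex v with ≡-dec _≟P_ _≟F_ u v
... | yes refl = yes refl
... | no u≢v = no λ { refl → u≢v refl }

open Elimination _≟U_

Present : List Hex → Parity → Hex → Set
Present S c g = ∃[ h ] ∃[ i ] (h ∈ S × end c i h ≡ g)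

record Cells (S : List Hex) : Set₁ where
  field
    edges    : List (Hex × Dir)
    vertices : List (Parity × Hex)
    S!        : Unique S
    vertices! : Unique vertices
    edge∈     : ∀ {h i} → h ∈ S ⊎ nx i h ∈ S → (h , i) ∈ edges
    vertex∈   : ∀ {c g} → Present S c g → (c , g) ∈ vertices
    ∈vertex   : ∀ {c g} → (c , g) ∈ vertices → Present S c g
    euler     : length S ℕ.+ length vertices ≡ length edges ℕ.+ 1
    root      : Hex
    root∈S    : root ∈ S
    -- Connectedness as an induction principle along edges, which keeps walks out of the potential
    -- theory.
    connected : (P : Parity → Hex → Set) →
                (∀ c h i → h ∈ S ⊎ nx i h ∈ S → P c (end c i h) → P (opposite c) (end (opposite c) i h)) →
                ∀ {c g c′ g′} → Present S c g → P c g → Present S c′ g′ → P c′ g′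

module Potentials {S : List Hex} (cells : Cells S) where
  open Cells cells

  Edge? : ∀ h i → Dec (h ∈ S ⊎ nx i h ∈ S)
  Edge? h i = (h ∈? S) ⊎-dec (nx i h ∈? S)

  touch-present : ∀ {c p q r i j l} → Triangle c p q r i j l → Touches (_∈ S) p q r →
                  Present S c (end c i p)
  touch-present {p = p} {i = i} τ (inj₁ p∈) = p , i , p∈ , refl
  touch-present {q = q} {j = j} τ (inj₂ (inj₁ q∈)) = q , j , q∈ , end-turn τ
  touch-present {r = r} {l = l} τ (inj₂ (inj₂ r∈)) = r , l , r∈ , trans (end-turn (turn τ)) (end-turn τ)

  edge-present : ∀ c h i → h ∈ S ⊎ nx i h ∈ S → Present S c (end c i h)
  edge-present c h i (inj₁ h∈) = h , i , h∈ , refl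
  edge-present c h i (inj₂ q∈) with perm-at c i
  ... | j , l , π = nx i h , j , q∈ , end-perm π h

  -- The direction `d₁` raises the first coordinate, so a hexagon of largest first coordinate among
  -- those with `P` will do. It serves to find where a support ends and, for a constant `P`, to find
  -- a boundary edge.
  leaves : (P : Hex → Set) → (∀ h → Dec (P h)) → ∀ {h} → h ∈ S → P h →
           ∃[ q ] (q ∈ S × P q × ¬ (nx d₁ q ∈ S × P (nx d₁ q)))
  leaves P P? h∈S Ph with maximum proj₁ (∈-filter⁺ P? h∈S Ph)
  ... | m , m∈ , max with ∈-filter⁻ P? {xs = S} m∈
  ...   | m∈S , Pm = m , m∈S , Pm , λ (n∈S , Pn) → ℤP.<-irrefl refl (ℤP.suc[i]≤j⇒i<j
            (subst (ℤ._≤ proj₁ m) (ℤP.+-comm (proj₁ m) (+ 1)) (max (∈-filter⁺ P? n∈S Pn))))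

  Labelling : Set
  Labelling = Parity → Hex → ℤ

  drop : Labelling → Parity → Hex → Dir → ℤ
  drop U c h i = U c (end c i h) - U (opposite c) (end (opposite c) i h)

  -- A vertex of degree two lacks one of its three arcs. Giving the missing arc the value 0 lets the
  -- mean value equation always have three terms.
  HalfEdge : Labelling → Parity → Hex → Dir → ℤ → Set
  HalfEdge U c h i y = (h ∈ S ⊎ nx i h ∈ S → drop U c h i ≡ y) × (¬ (h ∈ S ⊎ nx i h ∈ S) → y ≡ + 0)

  data Harmonic (U : Labelling) (c : Parity) (p q r : Hex) (i j l : Dir) : Set where
    harmonic : ∀ {x y z} → x + y + z ≡ + 0 → HalfEdge U c p i x → HalfEdge U c q j y → HalfEdge U c r l z →
               Harmonic U c p q r i j l

  PinnedOrHarmonic : Labelling → Set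
  PinnedOrHarmonic U = ∀ {c p q r i j l} → Triangle c p q r i j l → Touches (_∈ S) p q r →
                       U c (end c i p) ≡ + 0 ⊎ Harmonic U c p q r i j l

  nonneg-sum-zero : ∀ {x y z} → + 0 ℤ.≤ x → + 0 ℤ.≤ y → + 0 ℤ.≤ z → x + y + z ≡ + 0 → x ≡ + 0
  nonneg-sum-zero {x} {y} {z} x≥0 y≥0 z≥0 eq = ℤP.≤-antisym x≤0 x≥0
    where
    open ℤP.≤-Reasoning
    x≤0 : x ℤ.≤ + 0
    x≤0 = begin
      x             ≡⟨ lemma x ⟩
      x + + 0 + + 0 ≤⟨ ℤP.+-mono-≤ (ℤP.+-monoʳ-≤ x y≥0) z≥0 ⟩
      x + y + z     ≡⟨ eq ⟩
      + 0           ∎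
      where
      lemma : ∀ x → x ≡ x + + 0 + + 0
      lemma = solve-∀

  -- Maximum principle. Where `U` takes its maximum no drop is negative; if that maximum is positive
  -- the vertex is not pinned, the drops add up to zero, and all neighbours share the value. It
  -- would thus spread to the vertex where `U` vanishes.
  nonpositive-labelling : ∀ {U} → PinnedOrHarmonic U → ∀ {c₀ g₀} → Present S c₀ g₀ → U c₀ g₀ ≡ + 0 →
                          ∀ {c g} → Present S c g → U c g ℤ.≤ + 0
  nonpositive-labelling {U} ph {c₀} {g₀} pres₀ zero₀ {c} pres
    with maximum (λ v → U (proj₁ v) (proj₂ v)) (vertex∈ {c} pres)
  ... | (c* , g*) , v*∈ , max with U c* g* ℤP.≤? + 0
  ...   | yes ≤0 = ℤP.≤-trans (max (vertex∈ {c} pres)) ≤0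
  ...   | no ≰0 = ⊥-elim (top≢0 (trans (sym (connected AtTop spread (∈vertex v*∈) refl pres₀)) zero₀))
    where
    top≢0 : U c* g* ≢ + 0
    top≢0 eq = ℤP.<-irrefl (sym eq) (ℤP.≰⇒> ≰0)
    AtTop : Parity → Hex → Set
    AtTop c g = U c g ≡ U c* g*
    drop≥0 : ∀ c {h i y} → U c (end c i h) ≡ U c* g* → HalfEdge U c h i y → + 0 ℤ.≤ y
    drop≥0 c {h} {i} top (on , off) with Edge? h i
    ... | no ¬b = ℤP.≤-reflexive (sym (off ¬b))
    ... | yes b = subst (+ 0 ℤ.≤_) (on b) (ℤP.i≤j⇒0≤j-i
          (subst (U (opposite c) (end (opposite c) i h) ℤ.≤_) (sym top) (max (vertex∈ (edge-present (opposite c) h i b)))))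
    spread : ∀ c h i → h ∈ S ⊎ nx i h ∈ S → AtTop c (end c i h) → AtTop (opposite c) (end (opposite c) i h)
    spread c h i b top with perm-at c i
    ... | j , l , π = go (ph τ (touch b))
      where
      τ = triangle-at π h
      touch : h ∈ S ⊎ nx i h ∈ S → Touches (_∈ S) h (nx i h) (pv l h)
      touch (inj₁ x) = inj₁ x
      touch (inj₂ x) = inj₂ (inj₁ x)
      go : U c (end c i h) ≡ + 0 ⊎ Harmonic U c h (nx i h) (pv l h) i j l →
           AtTop (opposite c) (end (opposite c) i h)
      go (inj₁ eq) = ⊥-elim (top≢0 (trans (sym top) eq))
      go (inj₂ (harmonic sum hx hy hz)) = trans (sym (ℤP.i-j≡0⇒i≡j _ _ (trans (proj₁ hx b)
        (nonneg-sum-zero (drop≥0 c top hx)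
          (drop≥0 c {i = j} (trans (cong (U c) (end-turn τ)) top) hy)
          (drop≥0 c {i = l} (trans (cong (U c) (trans (end-turn (turn τ)) (end-turn τ))) top) hz) sum)))) top

  negate : ∀ {U} → PinnedOrHarmonic U → PinnedOrHarmonic (λ c g → - U c g)
  negate {U} ph τ t with ph τ t
  ... | inj₁ eq = inj₁ (cong -_ eq)
  ... | inj₂ (harmonic {x} {y} {z} sum hx hy hz) =
    inj₂ (harmonic (trans (lemma x y z) (cong -_ sum)) (half hx) (half hy) (half hz))
    where
    lemma : ∀ x y z → - x + - y + - z ≡ - (x + y + z)
    lemma = solve-∀
    lemma₂ : ∀ x y → - x - - y ≡ - (x - y)
    lemma₂ = solve-∀
    half : ∀ {c h i y} → HalfEdge U c h i y → HalfEdge (λ c g → - U c g) c h i (- y)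
    half {c} {h} {i} (on , off) = (λ b → trans (lemma₂ (U c (end c i h)) _) (cong -_ (on b))) , λ ¬b → cong -_ (off ¬b)

  zero-labelling : ∀ {U} → PinnedOrHarmonic U → ∀ {c₀ g₀} → Present S c₀ g₀ → U c₀ g₀ ≡ + 0 →
                   ∀ {c g} → Present S c g → U c g ≡ + 0
  zero-labelling {U} ph pres₀ zero₀ {c} {g} pres = ℤP.≤-antisym
    (nonpositive-labelling ph pres₀ zero₀ pres)
    (subst (+ 0 ℤ.≤_) (ℤP.neg-involutive (U c g))
      (ℤP.neg-mono-≤ (nonpositive-labelling (negate {U} ph) pres₀ (cong -_ zero₀) pres)))

  unknowns : List Unknown
  unknowns = scale ∷ map face S ++ map vertex vertices

  unknowns! : Unique unknowns
  unknowns! = All.tabulate (λ {u} u∈ eq → not-scale (subst (_∈ _) (sym eq) u∈)) ∷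
    UniqueP.++⁺ (UniqueP.map⁺ (λ { refl → refl }) S!) (UniqueP.map⁺ (λ { refl → refl }) vertices!)
      λ (x∈ , y∈) → disjoint x∈ y∈
    where
    not-scale : scale ∉ map face S ++ map vertex vertices
    not-scale s∈ with ∈-++⁻ (map face S) s∈
    ... | inj₁ x with ∈-map⁻ face x
    ...   | _ , _ , ()
    not-scale s∈ | inj₂ x with ∈-map⁻ vertex x
    ...   | _ , _ , ()
    disjoint : ∀ {u} → u ∈ map face S → u ∈ map vertex vertices → ⊥
    disjoint x y with ∈-map⁻ face x | ∈-map⁻ vertex y
    ... | _ , _ , refl | _ , _ , ()

  face-unknown : ∀ {h} → face h ∈ unknowns → h ∈ S
  face-unknown (there u∈) with ∈-++⁻ (map face S) u∈
  ... | inj₁ x with ∈-map⁻ face x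
  ...   | _ , h∈ , refl = h∈
  face-unknown (there u∈) | inj₂ x with ∈-map⁻ vertex x
  ...   | _ , _ , ()

  vertex-unknown : ∀ {v} → vertex v ∈ unknowns → v ∈ vertices
  vertex-unknown (there u∈) with ∈-++⁻ (map face S) u∈
  ... | inj₂ x with ∈-map⁻ vertex x
  ...   | _ , v∈ , refl = v∈
  vertex-unknown (there u∈) | inj₁ x with ∈-map⁻ face x
  ...   | _ , _ , ()

  evaluate : Unknown → Form
  evaluate j = (λ u → u j) , λ a b u w → refl

  more-unknowns : ∀ pin (row : Hex × Dir → Form) → length (pin ∷ map row edges) ℕ.< length unknowns
  more-unknowns pin row = ℕ.s≤s (ℕP.≤-reflexive (begin
    suc (length (map row edges))                          ≡⟨ cong suc (length-map row edges) ⟩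
    suc (length edges)                                    ≡⟨ ℕP.+-comm 1 (length edges) ⟩
    length edges ℕ.+ 1                                    ≡⟨ euler ⟨
    length S ℕ.+ length vertices                          ≡⟨ cong₂ ℕ._+_ (length-map face S) (length-map vertex vertices) ⟨
    length (map face S) ℕ.+ length (map vertex vertices)  ≡⟨ length-++ (map face S) ⟨
    length (map face S ++ map vertex vertices)            ∎))
    where open ≡-Reasoning

  record Solution (pin : Form) (row : Hex × Dir → Form) : Set where
    field
      u        : Unknown → ℤ
      face-off : ∀ {h} → h ∉ S → u (face h) ≡ + 0
      pinned   : proj₁ pin u ≡ + 0
      equation : ∀ {h i} → h ∈ S ⊎ nx i h ∈ S → proj₁ (row (h , i)) u ≡ + 0
      -- The form in which nontriviality is used: once the vertex part is zero, a zero scale that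
      -- forces the face part to vanish would make the whole solution zero.
      scale≢0  : (∀ {c g} → Present S c g → u (vertex (c , g)) ≡ + 0) →
                 (u scale ≡ + 0 → ∀ {h} → h ∈ S → u (face h) ≡ + 0) → u scale ≢ + 0

  solution : ∀ pin row → Solution pin row
  solution pin row with nontrivial-zero (pin ∷ map row edges) unknowns unknowns! (more-unknowns pin row)
  ... | u , support , (j , uj≢0) , (p ∷ rows) = record
    { u = u
    ; face-off = λ h∉ → support λ x → h∉ (face-unknown x)
    ; pinned = p
    ; equation = λ b → All.lookup (AllP.map⁻ rows) (edge∈ b)
    ; scale≢0 = λ vz fz sz → uj≢0 (all-zero vz (fz sz) sz j)
    }
    where
    open import Data.List.Membership.DecPropositional _≟U_ using () renaming (_∈?_ to _∈U?_)
    all-zero : (∀ {c g} → Present S c g → u (vertex (c , g)) ≡ + 0) →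
               (∀ {h} → h ∈ S → u (face h) ≡ + 0) → u scale ≡ + 0 → ∀ j → u j ≡ + 0
    all-zero vz fz sz j with j ∈U? unknowns
    ... | no j∉ = support j∉
    all-zero vz fz sz scale | yes _ = sz
    all-zero vz fz sz (face h) | yes j∈ = fz (face-unknown j∈)
    all-zero vz fz sz (vertex v) | yes j∈ = vz (∈vertex (vertex-unknown j∈))

  -- A discrete Hodge decomposition: a multiple of `x`, the difference of a face function across the
  -- edge and the difference of a vertex function along it add up to zero. Summed around a vertex
  -- the face terms telescope and a closed `x` contributes nothing, so the vertex function is
  -- harmonic.
  edgeForm : (Hex → Dir → ℤ) → Hex × Dir → Form
  edgeForm x (h , i) =
    (λ u → u scale * x h i + (u (face (nx i h)) - u (face h))
           + (u (vertex (even , end even i h)) - u (vertex (odd , end odd i h)))) ,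
    λ a b u w → lemma a b (x h i) (u scale) (w scale) (u (face (nx i h))) (w (face (nx i h)))
                      (u (face h)) (w (face h)) (u (vertex (even , end even i h))) (w (vertex (even , end even i h)))
                      (u (vertex (odd , end odd i h))) (w (vertex (odd , end odd i h)))
    where
    lemma : ∀ a b x k k′ s s′ t t′ e e′ o o′ →
      (a * k + b * k′) * x + (a * s + b * s′ - (a * t + b * t′)) + (a * e + b * e′ - (a * o + b * o′))
      ≡ a * (k * x + (s - t) + (e - o)) + b * (k′ * x + (s′ - t′) + (e′ - o′))
    lemma = solve-∀

  -- Only the sign of the scale is normalised; its absolute value survives as the factor `suc κ` of
  -- the potential. The minus sign moves the differential to the other side of the edge equation.
  sign : ∀ k → k ≢ + 0 → ∃[ κ ] ∃[ s ] s * k ≡ - + suc κ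
  sign (+ zero) k≢0 = ⊥-elim (k≢0 refl)
  sign (+ suc n) _ = n , - + 1 , ℤP.-1*i≡-i (+ suc n)
  sign -[1+ n ] _ = n , + 1 , ℤP.*-identityˡ -[1+ n ]

  rescale : ∀ {k κ s} x r r′ → s * k ≡ - + suc κ → k * x + (r′ - r) ≡ + 0 → s * r′ ≡ s * r + + suc κ * x
  rescale {k} {κ} {s} x r r′ sk eq = begin
    s * r′                                            ≡⟨ lemma s k x r r′ ⟩
    s * r + - (s * k) * x + s * (k * x + (r′ - r))    ≡⟨ cong₂ (λ y z → s * r + - y * x + s * z) sk eq ⟩
    s * r + - - + suc κ * x + s * + 0                 ≡⟨ lemma₂ s r (+ suc κ) x ⟩
    s * r + + suc κ * x                               ∎
    where
    open ≡-Reasoning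
    lemma : ∀ s k x r r′ → s * r′ ≡ s * r + - (s * k) * x + s * (k * x + (r′ - r))
    lemma = solve-∀
    lemma₂ : ∀ s r κ x → s * r + - - κ * x + s * + 0 ≡ s * r + κ * x
    lemma₂ = solve-∀

  root-present : ∀ c → Present S c (end c d₁ root)
  root-present c = root , d₁ , root∈S , refl

  -- In `edgeForm` the odd end is always subtracted from the even one, whereas `drop` starts from
  -- the end of parity `c`.
  orient : Parity → ℤ
  orient even = - + 1
  orient odd  = + 1

  drop-orient : ∀ c (U : Labelling) y h i → y + (U even (end even i h) - U odd (end odd i h)) ≡ + 0 →
                drop U c h i ≡ orient c * y
  drop-orient even U y h i eq = trans (lemma (U even (end even i h)) _ y) (trans (cong (λ z → - + 1 * y + z) eq) (ℤP.+-identityʳ _))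
    where
    lemma : ∀ e o y → e - o ≡ - + 1 * y + (y + (e - o))
    lemma = solve-∀
  drop-orient odd U y h i eq = trans (lemma (U even (end even i h)) _ y) (trans (cong (λ z → + 1 * y + - z) eq) (ℤP.+-identityʳ _))
    where
    lemma : ∀ e o y → o - e ≡ + 1 * y + - (y + (e - o))
    lemma = solve-∀

  circulation : ∀ s k {x y z} p q r → x + y + z ≡ + 0 →
    s * (k * x + (q - p)) + s * (k * y + (r - q)) + s * (k * z + (p - r)) ≡ + 0
  circulation s k {x} {y} {z} p q r eq = trans (lemma s k x y z p q r) (trans (cong (s * k *_) eq) (ℤP.*-zeroʳ (s * k)))
    where
    lemma : ∀ s k x y z p q r → s * (k * x + (q - p)) + s * (k * y + (r - q)) + s * (k * z + (p - r))
            ≡ s * k * (x + y + z)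
    lemma = solve-∀

  unscaled : ∀ {k x r r′} → k ≡ + 0 → k * x + (r′ - r) ≡ + 0 → r′ ≡ r
  unscaled {r = r} {r′} refl eq = ℤP.i-j≡0⇒i≡j r′ r (trans (sym (ℤP.+-identityˡ (r′ - r))) eq)

  Potential InnerPotential : (Hex → Dir → ℤ) → Set
  Potential x = ∃[ κ ] Σ (Hex → ℤ) λ f →
    (∀ {h} → h ∉ S → f h ≡ + 0) × (∀ h i → f (nx i h) ≡ f h + + suc κ * x h i)
  InnerPotential x = ∃[ κ ] Σ (Hex → ℤ) λ f →
    ∀ {h i} → h ∈ S → nx i h ∈ S → f (nx i h) ≡ f h + + suc κ * x h i

  -- The first homology of the system vanishes: by Euler's formula there is
  -- one more unknown than there are equations, and the maximum principle
  -- kills the vertex part of a solution.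
  abstract
    circulation-potential : (x : Hex → Dir → ℤ) →
      (∀ {h i} → ¬ (h ∈ S ⊎ nx i h ∈ S) → x h i ≡ + 0) →
      (∀ {c p q r i j l} → Triangle c p q r i j l → Touches (_∈ S) p q r → x p i + x q j + x r l ≡ + 0) →
      Potential x
    circulation-potential x x-off x-div = finish (sign k (scale≢0 U≡0 λ k≡0 {h} h∈ → R≡0 k≡0 h∈))
      where
      open Solution (solution (evaluate (vertex (even , end even d₁ root))) (edgeForm x))
      k : ℤ
      k = u scale
      R : Hex → ℤ
      R h = u (face h)
      U : Labelling
      U c g = u (vertex (c , g))
      flow : Hex → Dir → ℤ
      flow h i = k * x h i + (R (nx i h) - R h)
      flow-off : ∀ {h i} → ¬ (h ∈ S ⊎ nx i h ∈ S) → flow h i ≡ + 0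
      flow-off {h} {i} ¬b rewrite x-off ¬b | face-off (λ h∈ → ¬b (inj₁ h∈)) | face-off (λ q∈ → ¬b (inj₂ q∈)) = lemma k
        where
        lemma : ∀ k → k * + 0 + (+ 0 - + 0) ≡ + 0
        lemma = solve-∀
      half : ∀ c h i → HalfEdge U c h i (orient c * flow h i)
      half c h i = (λ b → drop-orient c U (flow h i) h i (equation b))
                 , λ ¬b → trans (cong (orient c *_) (flow-off ¬b)) (ℤP.*-zeroʳ (orient c))
      ph : PinnedOrHarmonic U
      ph {c} {p} {q} {r} {i} {j} {l} τ t = inj₂ (harmonic
        (trans (cong₃ (λ q r p → orient c * (k * x _ i + (R q - R _))
            + orient c * (k * x _ j + (R r - R _)) + orient c * (k * x _ l + (R p - R _)))
                  (pq τ) (qr τ) (rp τ))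
          (circulation (orient c) k (R p) (R q) (R r) (x-div τ t)))
        (half c p i) (half c q j) (half c r l))
      U≡0 : ∀ {c g} → Present S c g → U c g ≡ + 0
      U≡0 = zero-labelling {U} ph (root-present even) pinned
      flow≡0 : ∀ h i → flow h i ≡ + 0
      flow≡0 h i with Edge? h i
      ... | no ¬b = flow-off ¬b
      ... | yes b = trans (sym (trans (cong₂ (λ e o → flow h i + (e - o)) (U≡0 (edge-present even h i b)) (U≡0 (edge-present odd h i b)))
                      (ℤP.+-identityʳ (flow h i)))) (equation b)
      R≡0 : k ≡ + 0 → ∀ {h} → h ∈ S → R h ≡ + 0
      R≡0 k≡0 {h} h∈ with R h ℤP.≟ + 0
      ... | yes eq = eq
      -- With scale zero `R` does not change across any edge, so a nonzero value would be carried
      -- past the end of its own support.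
      ... | no R≢0 with leaves (λ h → R h ≢ + 0) (λ h → ¬? (R h ℤP.≟ + 0)) h∈ R≢0
      ...   | q , q∈ , Rq≢0 , last with unscaled {k} {x q d₁} k≡0 (flow≡0 q d₁) | nx d₁ q ∈? S
      ...     | same | yes n∈ = ⊥-elim (last (n∈ , λ eq → Rq≢0 (trans (sym same) eq)))
      ...     | same | no n∉ = ⊥-elim (Rq≢0 (trans (sym same) (face-off n∉)))
      finish : ∃[ κ ] ∃[ s ] s * k ≡ - + suc κ →
        Potential x
      finish (κ , s , sk) = κ , (λ h → s * R h)
        , (λ {h} h∉ → trans (cong (s *_) (face-off h∉)) (ℤP.*-zeroʳ s))
        , λ h i → rescale {k} {κ} {s} (x h i) (R h) (R (nx i h)) sk (flow≡0 h i)

  Inner : Hex → Hex → Hex → Set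
  Inner p q r = p ∈ S × q ∈ S × r ∈ S

  -- Boundary edges carry no equation in x; each of them pins instead one of
  -- its ends, so that every boundary vertex is pinned.
  heightForm : (Hex → Dir → ℤ) → Hex × Dir → Form
  heightForm x (h , i) with h ∈? S | nx i h ∈? S
  ... | yes _ | yes _ = edgeForm x (h , i)
  ... | yes _ | no _  = evaluate (vertex (even , end even i h))
  ... | no _  | _     = evaluate (vertex (odd , end odd i h))

  abstract
    inner-potential : (x : Hex → Dir → ℤ) →
      (∀ {c p q r i j l} → Triangle c p q r i j l → Inner p q r → x p i + x q j + x r l ≡ + 0) →
      InnerPotential x
    inner-potential x x-div = finish (sign k (scale≢0 U≡0 R≡0))
      where
      open Solution (solution (evaluate (face root)) (heightForm x))
      k : ℤ
      k = u scale
      R : Hex → ℤ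
      R h = u (face h)
      U : Labelling
      U c g = u (vertex (c , g))
      flow : Hex → Dir → ℤ
      flow h i = k * x h i + (R (nx i h) - R h)

      inner-equation : ∀ {h i} → h ∈ S → nx i h ∈ S → flow h i + (U even (end even i h) - U odd (end odd i h)) ≡ + 0
      inner-equation {h} {i} h∈ q∈ with h ∈? S | nx i h ∈? S | equation {h} {i} (inj₁ h∈)
      ... | yes _ | yes _ | eq = eq
      ... | yes _ | no q∉ | _ = ⊥-elim (q∉ q∈)
      ... | no h∉ | _ | _ = ⊥-elim (h∉ h∈)

      pin-even : ∀ {p q r i j l} → Triangle even p q r i j l → p ∈ S → q ∉ S → U even (end even i p) ≡ + 0
      pin-even {p} {i = i} (triangle _ refl _ _) p∈ q∉ with p ∈? S | nx i p ∈? S | equation {p} {i} (inj₁ p∈)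
      ... | yes _ | no _ | eq = eq
      ... | yes _ | yes q∈ | _ = ⊥-elim (q∉ q∈)
      ... | no p∉ | _ | _ = ⊥-elim (p∉ p∈)

      pin-odd : ∀ {p q r i j l} → Triangle odd p q r i j l → p ∉ S → q ∈ S → U odd (end odd i p) ≡ + 0
      pin-odd {p} {i = i} (triangle _ refl _ _) p∉ q∈ with p ∈? S | equation {p} {i} (inj₂ q∈)
      ... | no _ | eq = eq
      ... | yes p∈ | _ = ⊥-elim (p∉ p∈)

      turned : ∀ {c p q r i j l} → Triangle c p q r i j l → U c (end c j q) ≡ + 0 → U c (end c i p) ≡ + 0
      turned {c} τ eq = trans (cong (U c) (sym (end-turn τ))) eq

      turned² : ∀ {c p q r i j l} → Triangle c p q r i j l → U c (end c l r) ≡ + 0 → U c (end c i p) ≡ + 0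
      turned² τ eq = turned τ (turned (turn τ) eq)

      half : ∀ c {h i q} → nx i h ≡ q → h ∈ S → q ∈ S → HalfEdge U c h i (orient c * flow h i)
      half c {h} {i} refl h∈ q∈ = (λ _ → drop-orient c U (flow h i) h i (inner-equation h∈ q∈))
                                , λ ¬b → ⊥-elim (¬b (inj₁ h∈))

      all-inner : ∀ {c p q r i j l} → Triangle c p q r i j l → Inner p q r → Harmonic U c p q r i j l
      all-inner {c} {p} {q} {r} {i} {j} {l} τ inn @ (p∈ , q∈ , r∈) = harmonic
        (trans (cong₃ (λ q r p → orient c * (k * x _ i + (R q - R _))
            + orient c * (k * x _ j + (R r - R _)) + orient c * (k * x _ l + (R p - R _)))
                  (pq τ) (qr τ) (rp τ))
          (circulation (orient c) k (R p) (R q) (R r) (x-div τ inn)))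
        (half c (pq τ) p∈ q∈) (half c (qr τ) q∈ r∈) (half c (rp τ) r∈ p∈)

      -- Around a vertex with faces both inside and outside, the cyclic order contains an arc
      -- leaving the region and one entering it. A leaving arc pins its even end and an entering arc
      -- its odd end, so the vertex is pinned whichever its parity.
      ph : PinnedOrHarmonic U
      ph {c} {p} {q} {r} τ t with p ∈? S | q ∈? S | r ∈? S
      ... | yes p∈ | yes q∈ | yes r∈ = inj₂ (all-inner τ (p∈ , q∈ , r∈))
      ph {even} τ t | yes p∈ | no q∉ | _ = inj₁ (pin-even τ p∈ q∉)
      ph {even} τ t | _ | yes q∈ | no r∉ = inj₁ (turned τ (pin-even (turn τ) q∈ r∉))
      ph {even} τ t | no p∉ | _ | yes r∈ = inj₁ (turned² τ (pin-even (turn (turn τ)) r∈ p∉))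
      ph {odd} τ t | no p∉ | yes q∈ | _ = inj₁ (pin-odd τ p∉ q∈)
      ph {odd} τ t | _ | no q∉ | yes r∈ = inj₁ (turned τ (pin-odd (turn τ) q∉ r∈))
      ph {odd} τ t | yes p∈ | _ | no r∉ = inj₁ (turned² τ (pin-odd (turn (turn τ)) r∉ p∈))
      ph τ (inj₁ p∈) | no p∉ | no _ | no _ = ⊥-elim (p∉ p∈)
      ph τ (inj₂ (inj₁ q∈)) | no _ | no q∉ | no _ = ⊥-elim (q∉ q∈)
      ph τ (inj₂ (inj₂ r∈)) | no _ | no _ | no r∉ = ⊥-elim (r∉ r∈)

      U≡0 : ∀ {c g} → Present S c g → U c g ≡ + 0
      -- The predicate holds everywhere, so the outcome is a hexagon with no neighbour in the system
      -- in direction `d₁`. That side is a boundary edge and supplies the zero from which the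
      -- maximum principle starts.
      U≡0 with leaves (λ _ → root ∈ S) (λ _ → root ∈? S) root∈S root∈S
      ... | q , q∈ , _ , last = zero-labelling {U} ph {even} (q , d₁ , q∈ , refl)
              (pin-even (triangle-at p102 q) q∈ λ n∈ → last (n∈ , root∈S))

      flow≡0 : ∀ {h i} → h ∈ S → nx i h ∈ S → flow h i ≡ + 0
      flow≡0 {h} {i} h∈ q∈ = trans (sym (trans (cong₂ (λ e o → flow h i + (e - o))
        (U≡0 (edge-present even h i (inj₁ h∈))) (U≡0 (edge-present odd h i (inj₁ h∈)))) (ℤP.+-identityʳ (flow h i))))
        (inner-equation h∈ q∈)

      -- Any two of the three faces at a vertex share an edge there. This lets connectedness of the
      -- graph replace connectedness of its dual.
      same-at-vertex : k ≡ + 0 → ∀ c i i′ {h h′} → h ∈ S → h′ ∈ S → end c i′ h′ ≡ end c i h → R h′ ≡ R h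
      same-at-vertex k≡0 c i i′ {h} {h′} h∈ h′∈ eq with perm-at c i
      ... | j , l , π with triangle-at π h
      ...   | τ with at-vertex τ h′ i′ eq
      ...     | at₁ = refl
      ...     | at₂ = unscaled {k} {x h i} k≡0 (flow≡0 h∈ h′∈)
      ...     | at₃ = trans (sym (unscaled {k} {x h′ l} k≡0 (flow≡0 h′∈ (subst (_∈ S) (sym (rp τ)) h∈)))) (cong R (rp τ))

      R≡0 : k ≡ + 0 → ∀ {h} → h ∈ S → R h ≡ + 0
      R≡0 k≡0 {h} h∈ = connected Zero spread {c = even} {c′ = even} (root-present even)
        (λ h j h∈ eq → trans (same-at-vertex k≡0 even d₁ j root∈S h∈ eq) pinned)
        (h , d₀ , h∈ , refl) h d₀ h∈ refl
        where
        -- The property moves along an edge because some hexagon of the system contains that edge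
        -- and hence both its ends.
        Zero : Parity → Hex → Set
        Zero c g = ∀ h j → h ∈ S → end c j h ≡ g → R h ≡ + 0
        spread : ∀ c h i → h ∈ S ⊎ nx i h ∈ S → Zero c (end c i h) → Zero (opposite c) (end (opposite c) i h)
        spread c h i (inj₁ h∈) z h′ j h′∈ eq = trans (same-at-vertex k≡0 (opposite c) i j h∈ h′∈ eq) (z h i h∈ refl)
        spread c h i (inj₂ q∈) z h′ j h′∈ eq with perm-at c i | perm-at (opposite c) i
        ... | a , _ , π | b , _ , π′ = trans (same-at-vertex k≡0 (opposite c) b j q∈ h′∈ (trans eq (sym (end-perm π′ h))))
                (z (nx i h) a q∈ (end-perm π h))

      finish : ∃[ κ ] ∃[ s ] s * k ≡ - + suc κ →
        InnerPotential x
      finish (κ , s , sk) = κ , (λ h → s * R h)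
        , λ {h} {i} h∈ q∈ → rescale {k} {κ} {s} (x h i) (R h) (R (nx i h)) sk (flow≡0 h∈ q∈)

-- Arcs as edges and named corners as vertices of the brick wall

arc : Hex → Dir → Edge
arc h d₀ = hexE₁ h
arc h d₁ = hexE₃ h
arc h d₂ = hexE₅ h

vtx : Parity → Hex → Vert
vtx even h       = corner h
vtx odd  (a , b) = + 2 * a + b + + 1 , b

-- In the order of `hexEdges`, where out-arcs and in-arcs alternate; the two lists then agree entry
-- by entry.
hexArcs : Hex → List (Hex × Dir)
hexArcs h = (h , d₀) ∷ (pv d₂ h , d₂) ∷ (h , d₁) ∷ (pv d₀ h , d₀) ∷ (h , d₂) ∷ (pv d₁ h , d₁) ∷ []

hexCorners : Hex → List (Parity × Hex)
hexCorners h = (even , end even d₀ h) ∷ (odd , end odd d₀ h) ∷ (even , end even d₁ h)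
             ∷ (odd , end odd d₂ h) ∷ (even , end even d₂ h) ∷ (odd , end odd d₁ h) ∷ []

private
  e1 : ∀ a b → + 2 * a + b + + 1 ≡ + 2 * (a + + 1) + (b - + 1)
  e1 = solve-∀
  e2 : ∀ b → b ≡ b - + 1 + + 1
  e2 = solve-∀
  e3 : ∀ a b → + 2 * a + b + + 1 ≡ + 2 * a + (b + + 1)
  e3 = solve-∀
  e4 : ∀ a b → + 2 * a + b ≡ + 2 * (a - + 1) + b + + 2
  e4 = solve-∀
  e5 : ∀ a b → + 2 * a + b + + 2 ≡ + 2 * (a + + 1) + b
  e5 = solve-∀
  e6 : ∀ a b → + 2 * a + b ≡ + 2 * (a - + 1) + (b + + 1) + + 1
  e6 = solve-∀
  e7 : ∀ a b → + 2 * a + b + + 2 ≡ + 2 * a + (b + + 1) + + 1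
  e7 = solve-∀

cong₆ : ∀ {A B : Set} (f : A → A → A → A → A → A → B) {a a′ b b′ c c′ d d′ e e′ g g′} →
        a ≡ a′ → b ≡ b′ → c ≡ c′ → d ≡ d′ → e ≡ e′ → g ≡ g′ → f a b c d e g ≡ f a′ b′ c′ d′ e′ g′
cong₆ f refl refl refl refl refl refl = refl

hexE₂-arc : ∀ h → hexE₂ h ≡ arc (pv d₂ h) d₂
hexE₂-arc (a , b) = cong₂ (λ x y → hor (x , y)) (e1 a b) (e2 b)

hexE₄-arc : ∀ h → hexE₄ h ≡ arc (pv d₀ h) d₀
hexE₄-arc (a , b) = cong (λ x → hor (x , b + + 1)) (e3 a b)

hexE₆-arc : ∀ h → hexE₆ h ≡ arc (pv d₁ h) d₁
hexE₆-arc (a , b) = cong (λ x → ver (x , b)) (e4 a b)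

hexEdges-arcs : ∀ h → hexEdges h ≡ map (uncurry arc) (hexArcs h)
hexEdges-arcs h = cong₃ (λ e₂ e₄ e₆ → hexE₁ h ∷ e₂ ∷ hexE₃ h ∷ e₄ ∷ hexE₅ h ∷ e₆ ∷ [])
  (hexE₂-arc h) (hexE₄-arc h) (hexE₆-arc h)

hexVerts-corners : ∀ h → hexVerts h ≡ map (uncurry vtx) (hexCorners h)
hexVerts-corners (a , b) = cong₆ (λ v₁ v₂ v₃ v₄ v₅ v₆ → v₁ ∷ v₂ ∷ v₃ ∷ v₄ ∷ v₅ ∷ v₆ ∷ [])
  refl refl (cong (_, b) (e5 a b)) (cong (_, b + + 1) (e6 a b)) (cong (_, b + + 1) (e3 a b)) (cong (_, b + + 1) (e7 a b))

first : Dir → Parity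
first d₀ = even
first d₁ = even
first d₂ = odd

end₁-arc : ∀ i p → end₁ (arc p i) ≡ vtx (first i) (end (first i) i p)
end₁-arc d₀ p = refl
end₁-arc d₁ (a , b) = cong (_, b) (e5 a b)
end₁-arc d₂ (a , b) = cong (_, b + + 1) (e6 a b)

end₂-arc : ∀ i p → end₂ (arc p i) ≡ vtx (opposite (first i)) (end (opposite (first i)) i p)
end₂-arc d₀ p = refl
end₂-arc d₁ (a , b) = cong (_, b + + 1) (e7 a b)
end₂-arc d₂ (a , b) = cong (_, b + + 1) (e3 a b)

-- This separates the two classes of vertices: within a row their first coordinates differ by an odd
-- number.
1≢2* : ∀ z → + 1 ≢ + 2 * z
1≢2* z eq = odd≢even ∣ z ∣ (trans (cong ∣_∣ eq) (ℤP.abs-* (+ 2) z))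
  where
  odd≢even : ∀ n → 1 ≢ 2 ℕ.* n
  odd≢even zero ()
  odd≢even (suc n) eq rewrite ℕP.+-suc n (n ℕ.+ 0) with eq
  ... | ()

vtx-injective : ∀ c c′ {g g′} → vtx c g ≡ vtx c′ g′ → c ≡ c′ × g ≡ g′
vtx-injective even even {a , b} {a′ , b′} eq with cong proj₂ eq
... | refl = refl , cong (_, b) (ℤP.*-cancelˡ-≡ (+ 2) a a′ (∙-cancelʳ b _ _ (cong proj₁ eq)))
vtx-injective odd odd {a , b} {a′ , b′} eq with cong proj₂ eq
... | refl = refl , cong (_, b) (ℤP.*-cancelˡ-≡ (+ 2) a a′
               (∙-cancelʳ b _ _ (∙-cancelʳ (+ 1) _ _ (cong proj₁ eq))))
vtx-injective even odd {a , b} {a′ , b′} eq with cong proj₂ eq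
... | refl = ⊥-elim (1≢2* (a - a′) (trans (lemma (+ 2 * a′) b)
           (trans (cong (_- (+ 2 * a′ + b)) (sym (cong proj₁ eq))) (lemma₂ a a′ b))))
  where
  lemma : ∀ x b → + 1 ≡ x + b + + 1 - (x + b)
  lemma = solve-∀
  lemma₂ : ∀ a a′ b → + 2 * a + b - (+ 2 * a′ + b) ≡ + 2 * (a - a′)
  lemma₂ = solve-∀
vtx-injective odd even {g} {g′} eq with vtx-injective even odd {g′} {g} (sym eq)
... | () , _

arc-injective : ∀ i j {p q} → arc p i ≡ arc q j → p ≡ q × i ≡ j
arc-injective i j {p} {q} eq with vtx-injective (first i) (first j)
  (trans (sym (end₁-arc i p)) (trans (cong end₁ eq) (end₁-arc j q)))
arc-injective d₀ d₀ eq | _ , x = end-injective even d₀ x , refl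
arc-injective d₁ d₁ eq | _ , x = end-injective even d₁ x , refl
arc-injective d₂ d₂ eq | _ , x = end-injective odd d₂ x , refl
arc-injective d₀ d₁ () | _
arc-injective d₁ d₀ () | _
arc-injective d₀ d₂ eq | () , _
arc-injective d₂ d₀ eq | () , _
arc-injective d₁ d₂ () | _
arc-injective d₂ d₁ () | _

incident : ∀ c i p → Incident (vtx c (end c i p)) (arc p i)
incident c i p with same-or-opposite c (first i)
  where
  same-or-opposite : ∀ c c′ → c ≡ c′ ⊎ c ≡ opposite c′
  same-or-opposite even even = inj₁ refl
  same-or-opposite even odd = inj₂ refl
  same-or-opposite odd even = inj₂ refl
  same-or-opposite odd odd = inj₁ refl
... | inj₁ refl = inj₁ (sym (end₁-arc i p))
... | inj₂ refl = inj₂ (sym (end₂-arc i p))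

incident-end : ∀ {c g i p} → Incident (vtx c g) (arc p i) → end c i p ≡ g
incident-end {c} {g} {i} {p} (inj₁ eq) with vtx-injective c (first i) (trans eq (end₁-arc i p))
... | refl , g≡ = sym g≡
incident-end {c} {g} {i} {p} (inj₂ eq) with vtx-injective c (opposite (first i)) (trans eq (end₂-arc i p))
... | refl , g≡ = sym g≡

∈-hexArcs : ∀ {p i h} → (p , i) ∈ hexArcs h → p ≡ h ⊎ nx i p ≡ h
∈-hexArcs (here refl) = inj₁ refl
∈-hexArcs {h = h} (there (here refl)) = inj₂ (nx-pv d₂ h)
∈-hexArcs (there (there (here refl))) = inj₁ refl
∈-hexArcs {h = h} (there (there (there (here refl)))) = inj₂ (nx-pv d₀ h)
∈-hexArcs (there (there (there (there (here refl))))) = inj₁ refl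
∈-hexArcs {h = h} (there (there (there (there (there (here refl)))))) = inj₂ (nx-pv d₁ h)

out∈hexArcs : ∀ i h → (h , i) ∈ hexArcs h
out∈hexArcs d₀ h = here refl
out∈hexArcs d₁ h = there (there (here refl))
out∈hexArcs d₂ h = there (there (there (there (here refl))))

in∈hexArcs : ∀ i h → (pv i h , i) ∈ hexArcs h
in∈hexArcs d₀ h = there (there (there (here refl)))
in∈hexArcs d₁ h = there (there (there (there (there (here refl)))))
in∈hexArcs d₂ h = there (here refl)

∈-hexEdges : ∀ {e} h → e ∈ hexEdges h → ∃[ p ] ∃[ i ] (e ≡ arc p i × (p ≡ h ⊎ nx i p ≡ h))
∈-hexEdges {e} h e∈ =
  let (p , i) , pi∈ , eq = ∈-map⁻ (uncurry arc) (subst (e ∈_) (hexEdges-arcs h) e∈)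
  in p , i , eq , ∈-hexArcs pi∈

arc∈hexEdges⁻ : ∀ {p i} h → arc p i ∈ hexEdges h → p ≡ h ⊎ nx i p ≡ h
arc∈hexEdges⁻ {p} {i} h p∈ =
  let q , j , eq , x = ∈-hexEdges h p∈
      p≡q , i≡j = arc-injective i j eq
  in subst₂ (λ p i → p ≡ h ⊎ nx i p ≡ h) (sym p≡q) (sym i≡j) x

out∈hexEdges : ∀ i h → arc h i ∈ hexEdges h
out∈hexEdges i h = subst (arc h i ∈_) (sym (hexEdges-arcs h)) (∈-map⁺ (uncurry arc) (out∈hexArcs i h))

in∈hexEdges : ∀ i h → arc (pv i h) i ∈ hexEdges h
in∈hexEdges i h = subst (arc (pv i h) i ∈_) (sym (hexEdges-arcs h)) (∈-map⁺ (uncurry arc) (in∈hexArcs i h))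

arc∈hexEdges⁺ : ∀ {p i h} → p ≡ h ⊎ nx i p ≡ h → arc p i ∈ hexEdges h
arc∈hexEdges⁺ {p} {i} (inj₁ refl) = out∈hexEdges i p
arc∈hexEdges⁺ {p} {i} (inj₂ refl) = subst (λ q → arc q i ∈ hexEdges (nx i p)) (pv-nx i p) (in∈hexEdges i (nx i p))

∈-hexCorners : ∀ {c g} h → (c , g) ∈ hexCorners h → ∃[ i ] g ≡ end c i h
∈-hexCorners h (here refl) = d₀ , refl
∈-hexCorners h (there (here refl)) = d₀ , refl
∈-hexCorners h (there (there (here refl))) = d₁ , refl
∈-hexCorners h (there (there (there (here refl)))) = d₂ , refl
∈-hexCorners h (there (there (there (there (here refl))))) = d₂ , refl
∈-hexCorners h (there (there (there (there (there (here refl)))))) = d₁ , refl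

∈-hexVerts : ∀ {v} h → v ∈ hexVerts h → ∃[ c ] ∃[ i ] v ≡ vtx c (end c i h)
∈-hexVerts {v} h v∈ =
  let (c , g) , g∈ , eq = ∈-map⁻ (uncurry vtx) (subst (v ∈_) (hexVerts-corners h) v∈)
      i , g≡ = ∈-hexCorners h g∈
  in c , i , trans eq (cong (vtx c) g≡)

corner∈ : ∀ c i h → (c , end c i h) ∈ hexCorners h
corner∈ even d₀ h = here refl
corner∈ odd  d₀ h = there (here refl)
corner∈ even d₁ h = there (there (here refl))
corner∈ odd  d₂ h = there (there (there (here refl)))
corner∈ even d₂ h = there (there (there (there (here refl))))
corner∈ odd  d₁ h = there (there (there (there (there (here refl)))))

vtx∈hexVerts : ∀ c i h → vtx c (end c i h) ∈ hexVerts h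
vtx∈hexVerts c i h = subst (vtx c (end c i h) ∈_) (sym (hexVerts-corners h)) (∈-map⁺ (uncurry vtx) (corner∈ c i h))

arc∈E⁺ : ∀ {S p i} → p ∈ S ⊎ nx i p ∈ S → E (graphOf S) (arc p i)
arc∈E⁺ (inj₁ p∈) = lose p∈ (arc∈hexEdges⁺ (inj₁ refl))
arc∈E⁺ (inj₂ q∈) = lose q∈ (arc∈hexEdges⁺ (inj₂ refl))

arc∈E⁻ : ∀ {S p i} → E (graphOf S) (arc p i) → p ∈ S ⊎ nx i p ∈ S
arc∈E⁻ {S} {p} {i} e =
  let h , h∈ , e∈ = find e
  in Sum.map (λ eq → subst (_∈ S) (sym eq) h∈) (λ eq → subst (_∈ S) (sym eq) h∈) (arc∈hexEdges⁻ h e∈)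

E-arc : ∀ {S e} → E (graphOf S) e → ∃[ p ] ∃[ i ] e ≡ arc p i
E-arc e = let h , h∈ , e∈ = find e
              p , i , eq , _ = ∈-hexEdges h e∈
          in p , i , eq

at-vertex-face : ∀ {p q r i j l h k} → AtVertex p q r i j l h k → Touches (_≡ h) p q r
at-vertex-face at₁ = inj₁ refl
at-vertex-face at₂ = inj₂ (inj₁ refl)
at-vertex-face at₃ = inj₂ (inj₂ refl)

vtx-face : ∀ {c p q r i j l} h → Triangle c p q r i j l → vtx c (end c i p) ∈ hexVerts h →
           Touches (_≡ h) p q r
vtx-face {c} {p} {i = i} h τ v∈ =
  let c′ , k , eq = ∈-hexVerts h v∈
      c≡ , eq′ = vtx-injective c c′ eq
  in at-vertex-face (at-vertex τ h k (sym (trans eq′ (cong (λ c → end c k h) (sym c≡)))))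

map-touches : ∀ {P Q : Hex → Set} {p q r} → (∀ {h} → P h → Q h) → Touches P p q r → Touches Q p q r
map-touches f (inj₁ x) = inj₁ (f x)
map-touches f (inj₂ (inj₁ x)) = inj₂ (inj₁ (f x))
map-touches f (inj₂ (inj₂ x)) = inj₂ (inj₂ (f x))

-- V (graphOf S) and InHexes S coincide
vertex-touches : ∀ {S c p q r i j l} → Triangle c p q r i j l → InHexes S (vtx c (end c i p)) →
                 Touches (_∈ S) p q r
vertex-touches {S} τ v =
  let h , h∈ , v∈ = find v
  in map-touches {_≡ h} {_∈ S} (λ eq → subst (_∈ S) (sym eq) h∈) (vtx-face h τ v∈)

touches-vertex : ∀ {S c p q r i j l} → Triangle c p q r i j l → Touches (_∈ S) p q r →
                 InHexes S (vtx c (end c i p))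
touches-vertex {S} {c} {p} {q} {r} {i} {j} {l} τ (inj₁ p∈) = lose p∈ (vtx∈hexVerts c i p)
touches-vertex {S} {c} {p} {q} {r} {i} {j} {l} τ (inj₂ (inj₁ q∈)) =
  lose q∈ (subst (λ g → vtx c g ∈ hexVerts q) (end-turn τ) (vtx∈hexVerts c j q))
touches-vertex {S} {c} {p} {q} {r} {i} {j} {l} τ (inj₂ (inj₂ r∈)) =
  lose r∈ (subst (λ g → vtx c g ∈ hexVerts r) (trans (end-turn (turn τ)) (end-turn τ)) (vtx∈hexVerts c l r))

vertex-corner : ∀ {S v} → InHexes S v → ∃[ h ] ∃[ c ] ∃[ i ] (h ∈ S × v ≡ vtx c (end c i h))
vertex-corner v =
  let h , h∈ , v∈ = find v
      c , i , eq = ∈-hexVerts h v∈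
  in h , c , i , h∈ , eq

-- Counting by representatives

choices : ∀ {A B : Set} {P : A → B → Set} (xs : List A) → (∀ {x} → x ∈ xs → ∃ (P x)) →
          ∃[ ys ] (length ys ≡ length xs × (∀ {x} → x ∈ xs → ∃[ y ] (y ∈ ys × P x y))
                                         × (∀ {y} → y ∈ ys → ∃[ x ] (x ∈ xs × P x y)))
choices [] f = [] , refl , (λ ()) , λ ()
choices (x ∷ xs) f with f (here refl) | choices xs (λ x∈ → f (there x∈))
... | y , p | ys , len , to , from = y ∷ ys , cong suc len
  , (λ { (here refl) → y , here refl , p
       ; (there x∈) → proj₁ (to x∈) , there (proj₁ (proj₂ (to x∈))) , proj₂ (proj₂ (to x∈)) })
  , λ { (here refl) → x , here refl , p
      ; (there y∈) → proj₁ (from y∈) , there (proj₁ (proj₂ (from y∈))) , proj₂ (proj₂ (from y∈)) }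

-- Pigeonhole for a relation. The representative of the first element can represent no other one, so
-- cutting it out of `ys` leaves representatives for all the rest.
representatives : ∀ {A B : Set} {P : A → B → Set} {xs : List A} {ys : List B} → Unique xs →
  (∀ {x} → x ∈ xs → ∃[ y ] (y ∈ ys × P x y)) → (∀ {x x′ y} → P x y → P x′ y → x ≡ x′) →
  length xs ℕ.≤ length ys
representatives {xs = []} _ _ _ = ℕ.z≤n
representatives {P = P} {x ∷ xs} {ys} (x∉ ∷ xs!) rep inj with rep (here refl)
... | y , y∈ , p with ∈-∃++ y∈
...   | us , vs , refl = subst (suc (length xs) ℕ.≤_) (sym count) (ℕ.s≤s (representatives xs! rep′ inj))
  where
  count : length (us ++ y ∷ vs) ≡ suc (length (us ++ vs))
  count = trans (length-++ us) (trans (ℕP.+-suc (length us) (length vs)) (cong suc (sym (length-++ us))))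
  rep′ : ∀ {z} → z ∈ xs → ∃[ w ] (w ∈ us ++ vs × P z w)
  rep′ z∈ with rep (there z∈)
  ... | w , w∈ , q with ∈-++⁻ us w∈
  ...   | inj₁ m = w , ∈-++⁺ˡ m , q
  ...   | inj₂ (here refl) = ⊥-elim (All.lookup x∉ z∈ (inj p q))
  ...   | inj₂ (there m) = w , ∈-++⁺ʳ us m , q

unique-length : ∀ {A : Set} {xs ys : List A} → Unique xs → (∀ {x} → x ∈ xs → x ∈ ys) → length xs ℕ.≤ length ys
unique-length xs! sub = representatives {P = _≡_} xs! (λ x∈ → _ , sub x∈ , refl) λ { refl refl → refl }

-- This carries Euler's count from lattice edges and vertices to arcs and named corners.
length-deduplicate-map : ∀ {A B : Set} (_≟A_ : DecidableEquality A) (_≟B_ : DecidableEquality B) (f : A → B) →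
  (∀ {x y} → f x ≡ f y → x ≡ y) → ∀ xs →
  length (deduplicate _≟B_ (map f xs)) ≡ length (deduplicate _≟A_ xs)
length-deduplicate-map _≟A_ _≟B_ f inj xs = trans
  (ℕP.≤-antisym (unique-length (DecUniqueP.deduplicate-! _≟B_ (map f xs)) to)
                (unique-length (UniqueP.map⁺ inj (DecUniqueP.deduplicate-! _≟A_ xs)) from))
  (length-map f (deduplicate _≟A_ xs))
  where
  to : ∀ {y} → y ∈ deduplicate _≟B_ (map f xs) → y ∈ map f (deduplicate _≟A_ xs)
  to y∈ with ∈-map⁻ f (∈-deduplicate⁻ _≟B_ (map f xs) y∈)
  ... | x , x∈ , refl = ∈-map⁺ f (∈-deduplicate⁺ _≟A_ x∈)
  from : ∀ {y} → y ∈ map f (deduplicate _≟A_ xs) → y ∈ deduplicate _≟B_ (map f xs)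
  from y∈ with ∈-map⁻ f y∈
  ... | x , x∈ , refl = ∈-deduplicate⁺ _≟B_ (∈-map⁺ f (∈-deduplicate⁻ _≟A_ xs x∈))

_≟A_ : DecidableEquality (Hex × Dir)
_≟A_ = ≡-dec _≟F_ _≟D_

_≟C_ : DecidableEquality (Parity × Hex)
_≟C_ = ≡-dec _≟P_ _≟F_

arcsOf : List Hex → List (Hex × Dir)
arcsOf S = deduplicate _≟A_ (concatMap hexArcs S)

cornersOf : List Hex → List (Parity × Hex)
cornersOf S = deduplicate _≟C_ (concatMap hexCorners S)

numEdges-arcs : ∀ S → numEdges S ≡ length (arcsOf S)
numEdges-arcs S = trans
  (cong (λ es → length (deduplicate _≟E_ es))
    (trans (concatMap-cong hexEdges-arcs S) (sym (map-concatMap (uncurry arc) hexArcs S))))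
  (length-deduplicate-map _≟A_ _≟E_ (uncurry arc) inj (concatMap hexArcs S))
  where
  inj : ∀ {x y} → uncurry arc x ≡ uncurry arc y → x ≡ y
  inj {p , i} {q , j} eq with arc-injective i j eq
  ... | refl , refl = refl

numVerts-corners : ∀ S → numVerts S ≡ length (cornersOf S)
numVerts-corners S = trans
  (cong (λ vs → length (deduplicate _≟V_ vs))
    (trans (concatMap-cong hexVerts-corners S) (sym (map-concatMap (uncurry vtx) hexCorners S))))
  (length-deduplicate-map _≟C_ _≟V_ (uncurry vtx) inj (concatMap hexCorners S))
  where
  inj : ∀ {x y} → uncurry vtx x ≡ uncurry vtx y → x ≡ y
  inj {c , g} {c′ , g′} eq with vtx-injective c c′ eq
  ... | refl , refl = refl

arc∈arcsOf : ∀ {S h i} → h ∈ S ⊎ nx i h ∈ S → (h , i) ∈ arcsOf S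
arc∈arcsOf {S} {h} {i} b = ∈-deduplicate⁺ _≟A_ (go b)
  where
  go : h ∈ S ⊎ nx i h ∈ S → (h , i) ∈ concatMap hexArcs S
  go (inj₁ h∈) = ∈-concatMap⁺ hexArcs (lose h∈ (out∈hexArcs i h))
  go (inj₂ q∈) = ∈-concatMap⁺ hexArcs (lose q∈
    (subst (λ p → (p , i) ∈ hexArcs (nx i h)) (pv-nx i h) (in∈hexArcs i (nx i h))))

-- The cell structure of a hexagonal system

module FromSystem {S : List Hex} (HS : IsHexagonalSystem S) where
  open IsHexagonalSystem HS

  private
    a-vertex : ∃[ v ] InHexes S v
    a-vertex with proj₁ twoConnected
    ... | a , b , c , va , _ = a , va

  -- `P` speaks of names of vertices while a walk visits the vertices themselves; carrying `P` for
  -- every name of the current vertex makes the induction go through.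
  spread-walk : (P : Parity → Hex → Set) →
    (∀ c h i → h ∈ S ⊎ nx i h ∈ S → P c (end c i h) → P (opposite c) (end (opposite c) i h)) →
    ∀ {u v} → Walk (graphOf S) u v → (∀ c g → u ≡ vtx c g → P c g) → ∀ c g → v ≡ vtx c g → P c g
  spread-walk P spread here Pu = Pu
  spread-walk P spread {u} (step {v = v} e e∈ joins w) Pu = spread-walk P spread w (across (E-arc e∈) joins)
    where
    opposite² : ∀ c → opposite (opposite c) ≡ c
    opposite² even = refl
    opposite² odd = refl
    across : ∃[ p ] ∃[ i ] e ≡ arc p i → Joins e u v → ∀ c g → v ≡ vtx c g → P c g
    across (p , i , refl) (inj₁ (e₁ , e₂)) c g eq
      with vtx-injective (opposite (first i)) c (trans (sym (end₂-arc i p)) (trans e₂ eq))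
    ... | refl , refl = spread (first i) p i (arc∈E⁻ e∈) (Pu (first i) _ (trans (sym e₁) (end₁-arc i p)))
    across (p , i , refl) (inj₂ (e₁ , e₂)) c g eq
      with vtx-injective (first i) c (trans (sym (end₁-arc i p)) (trans e₁ eq))
    ... | refl , refl = subst (λ c → P c (end c i p)) (opposite² (first i))
            (spread (opposite (first i)) p i (arc∈E⁻ e∈) (Pu _ _ (trans (sym e₂) (end₂-arc i p))))

  present-vertex : ∀ {c g} → Present S c g → InHexes S (vtx c g)
  present-vertex {c} (h , i , h∈ , refl) = lose h∈ (vtx∈hexVerts c i h)

  cells : Cells S
  cells = record
    { edges = arcsOf S
    ; vertices = cornersOf S
    ; S! = distinct
    ; vertices! = DecUniqueP.deduplicate-! _≟C_ _
    ; edge∈ = arc∈arcsOf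
    ; vertex∈ = λ { {c} (h , i , h∈ , refl) → ∈-deduplicate⁺ _≟C_ (∈-concatMap⁺ hexCorners (lose h∈ (corner∈ c i h))) }
    ; ∈vertex = present
    ; euler = trans (cong (length S ℕ.+_) (sym (numVerts-corners S)))
                (trans facesAreHex (cong (ℕ._+ 1) (numEdges-arcs S)))
    ; root = proj₁ (vertex-corner (proj₂ a-vertex))
    ; root∈S = proj₁ (proj₂ (proj₂ (proj₂ (vertex-corner (proj₂ a-vertex)))))
    ; connected = λ P spread {c} {g} {c′} {g′} pr Pcg pr′ →
        spread-walk P spread (proj₁ (proj₂ twoConnected) _ _ (present-vertex {c} pr) (present-vertex {c′} pr′))
          (λ c₁ g₁ eq → transfer P eq Pcg) c′ g′ refl
    }
    where
    present : ∀ {c g} → (c , g) ∈ cornersOf S → Present S c g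
    present v∈ with find (∈-concatMap⁻ hexCorners {xs = S} (∈-deduplicate⁻ _≟C_ (concatMap hexCorners S) v∈))
    ... | h , h∈ , x with ∈-hexCorners h x
    ...   | i , eq = h , i , h∈ , sym eq
    transfer : ∀ (P : Parity → Hex → Set) {c g c₁ g₁} → vtx c g ≡ vtx c₁ g₁ → P c g → P c₁ g₁
    transfer P {c} {g} {c₁} eq x with vtx-injective c c₁ eq
    ... | refl , refl = x

open DecMem _≟E_ using () renaming (_∈?_ to _∈E?_)

-- Perfect matchings as sets of arcs

indicator : List Edge → ArcSet
indicator M h i = ⌊ arc h i ∈E? M ⌋

indicator-true : ∀ {M h i} → arc h i ∈ M → indicator M h i ≡ true
indicator-true {M} {h} {i} e∈ with arc h i ∈E? M
... | yes _ = refl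
... | no e∉ = ⊥-elim (e∉ e∈)

indicator-false : ∀ {M h i} → arc h i ∉ M → indicator M h i ≡ false
indicator-false {M} {h} {i} e∉ with arc h i ∈E? M
... | yes e∈ = ⊥-elim (e∉ e∈)
... | no _ = refl

true-indicator : ∀ {M h i} → indicator M h i ≡ true → arc h i ∈ M
true-indicator {M} {h} {i} eq with arc h i ∈E? M
true-indicator _ | yes e∈ = e∈
true-indicator () | no _

false-indicator : ∀ {M h i} → indicator M h i ≡ false → arc h i ∉ M
false-indicator {M} {h} {i} eq e∈ = true≢false (indicator-true e∈) eq

arcListOf : List Hex → ArcSet → List (Hex × Dir)
arcListOf S m = filter (λ a → uncurry m a BoolP.≟ true) (arcsOf S)

edgeList : List Hex → ArcSet → List Edge
edgeList S m = map (uncurry arc) (arcListOf S m)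

edgeList⁻ : ∀ {S m e} → e ∈ edgeList S m → ∃[ h ] ∃[ i ] (e ≡ arc h i × m h i ≡ true)
edgeList⁻ {S} {m} e∈ with ∈-map⁻ (uncurry arc) e∈
... | (h , i) , a∈ , eq = h , i , eq , proj₂ (∈-filter⁻ (λ a → uncurry m a BoolP.≟ true) {xs = arcsOf S} a∈)

edgeList⁺ : ∀ {S m h i} → h ∈ S ⊎ nx i h ∈ S → m h i ≡ true → arc h i ∈ edgeList S m
edgeList⁺ {S} {m} b eq = ∈-map⁺ (uncurry arc) (∈-filter⁺ (λ a → uncurry m a BoolP.≟ true) (arc∈arcsOf b) eq)

end-at : ∀ {i p v} → Incident v (arc p i) → ∃[ c ] v ≡ vtx c (end c i p)
end-at {i} {p} (inj₁ eq) = first i , trans eq (end₁-arc i p)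
end-at {i} {p} (inj₂ eq) = opposite (first i) , trans eq (end₂-arc i p)

module _ {G : Graph} {M : List Edge} (PM : IsPerfectMatching G M)
         (arcs : ∀ {e} → E G e → ∃[ p ] ∃[ i ] e ≡ arc p i) where
  open IsPerfectMatching PM

  private
    m = indicator M

    at-first : ∀ {c p q r i j l} → Triangle c p q r i j l → arc p i ∈ M → One (m p i) (m q j) (m r l)
    at-first {c} {p} {q} {r} {i} {j} {l} τ e∈ = one₁ (indicator-true e∈)
      (indicator-false λ e′∈ → first≢second (perm τ) (proj₂ (arc-injective i j (once e∈ e′∈ inc₁ inc₂))))
      (indicator-false λ e′∈ → first≢third (perm τ) (proj₂ (arc-injective i l (once e∈ e′∈ inc₁ inc₃))))
      where
      inc₁ : Incident (vtx c (end c i p)) (arc p i)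
      inc₁ = incident c i p
      inc₂ : Incident (vtx c (end c i p)) (arc q j)
      inc₂ = subst (λ g → Incident (vtx c g) (arc q j)) (end-turn τ) (incident c j q)
      inc₃ : Incident (vtx c (end c i p)) (arc r l)
      inc₃ = subst (λ g → Incident (vtx c g) (arc r l)) (trans (end-turn (turn τ)) (end-turn τ)) (incident c l r)

  one-at : ∀ {c p q r i j l} → Triangle c p q r i j l → V G (vtx c (end c i p)) →
           One (m p i) (m q j) (m r l)
  one-at τ v∈ with covers v∈
  ... | e , e∈ , inc with arcs (inE e∈)
  ...   | p′ , i′ , refl with at-vertex τ p′ i′ (incident-end inc)
  ...     | at₁ = at-first τ e∈
  ...     | at₂ = rotate-one (rotate-one (at-first (turn τ) e∈))
  ...     | at₃ = rotate-one (at-first (turn (turn τ)) e∈)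

-- The last hypothesis ranges over all lattice vertices, because the field `once` is not restricted
-- to vertices of the graph. The graph is left general so as to cover both the system and the system
-- without a triphenylene.
perfect-matching : ∀ {S} {m : ArcSet} {G : Graph} →
  (∀ {h i} → m h i ≡ true → h ∈ S ⊎ nx i h ∈ S) →
  (∀ {h i} → m h i ≡ true → E G (arc h i)) →
  (∀ {v} → V G v → InHexes S v) →
  (∀ {c p q r i j l} → Triangle c p q r i j l → V G (vtx c (end c i p)) → One (m p i) (m q j) (m r l)) →
  (∀ {c p q r i j l} → Triangle c p q r i j l →
     One (m p i) (m q j) (m r l) ⊎ None (m p i) (m q j) (m r l)) →
  IsPerfectMatching G (edgeList S m)
perfect-matching {S} {m} {G} within inG corners law atMost = record
  { inE = inE′ ; covers = covers′ ; once = once′ }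
  where
  inE′ : ∀ {e} → e ∈ edgeList S m → E G e
  inE′ e∈ with edgeList⁻ {S} {m} e∈
  ... | h , i , refl , eq = inG eq
  member : ∀ {c p i} h k → end c k h ≡ end c i p → m h k ≡ true →
           ∃[ e ] (e ∈ edgeList S m × Incident (vtx c (end c i p)) e)
  member {c} h k same eq = arc h k , edgeList⁺ {S} {m} (within eq) eq ,
    subst (λ g → Incident (vtx c g) (arc h k)) same (incident c k h)
  pick : ∀ {c p q r i j l} → Triangle c p q r i j l → One (m p i) (m q j) (m r l) →
         ∃[ e ] (e ∈ edgeList S m × Incident (vtx c (end c i p)) e)
  pick {c} {p} {i = i} τ (one₁ x _ _) = member {c} {p} {i} _ _ refl x
  pick {c} {p} {i = i} τ (one₂ _ y _) = member {c} {p} {i} _ _ (end-turn τ) y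
  pick {c} {p} {i = i} τ (one₃ _ _ z) = member {c} {p} {i} _ _ (trans (end-turn (turn τ)) (end-turn τ)) z
  covers′ : ∀ {v} → V G v → ∃[ e ] (e ∈ edgeList S m × Incident v e)
  covers′ v∈ =
    let h , c , i , _ , v≡ = vertex-corner (corners v∈)
        j , l , π = perm-at c i
        τ = triangle-at π h
        e , e∈ , inc = pick τ (law τ (subst (V G) v≡ v∈))
    in e , e∈ , subst (λ v → Incident v e) (sym v≡) inc
  same : ∀ {c p q r i j l h k} → Triangle c p q r i j l → AtVertex p q r i j l h k →
         m p i ≡ true → m h k ≡ true → arc p i ≡ arc h k
  same τ at₁ _ _ = refl
  same τ at₂ x y with atMost τ
  ... | inj₁ (one₁ _ y′ _) = ⊥-elim (true≢false y y′)
  ... | inj₁ (one₂ x′ _ _) = ⊥-elim (true≢false x x′)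
  ... | inj₁ (one₃ x′ _ _) = ⊥-elim (true≢false x x′)
  ... | inj₂ (none x′ _ _) = ⊥-elim (true≢false x x′)
  same τ at₃ x z with atMost τ
  ... | inj₁ (one₁ _ _ z′) = ⊥-elim (true≢false z z′)
  ... | inj₁ (one₂ x′ _ _) = ⊥-elim (true≢false x x′)
  ... | inj₁ (one₃ x′ _ _) = ⊥-elim (true≢false x x′)
  ... | inj₂ (none x′ _ _) = ⊥-elim (true≢false x x′)
  once′ : ∀ {v e e′} → e ∈ edgeList S m → e′ ∈ edgeList S m → Incident v e → Incident v e′ → e ≡ e′
  once′ e∈ e′∈ inc inc′ with edgeList⁻ {S} {m} e∈ | edgeList⁻ {S} {m} e′∈
  ... | h , i , refl , eq | h′ , i′ , refl , eq′ with end-at inc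
  ...   | c , refl with perm-at c i
  ...     | j , l , π with triangle-at π h
  ...       | τ = same τ (at-vertex τ h′ i′ (incident-end inc′)) eq eq′

module Convert (S : List Hex) where
  open Region S

  S-touches? : ∀ p q r → Dec (Touches (_∈ S) p q r)
  S-touches? p q r = (p ∈? S) ⊎-dec ((q ∈? S) ⊎-dec (r ∈? S))

  nothing-away : ∀ {m : ArcSet} → (∀ {h i} → m h i ≡ true → h ∈ S ⊎ nx i h ∈ S) →
    ∀ {c p q r i j l} → Triangle c p q r i j l → ¬ Touches (_∈ S) p q r → None (m p i) (m q j) (m r l)
  nothing-away {m} within {p = p} {q} {r} τ ¬t = none
    (absent (pq τ) (λ x → ¬t (inj₁ x)) (λ x → ¬t (inj₂ (inj₁ x))))
    (absent (qr τ) (λ x → ¬t (inj₂ (inj₁ x))) (λ x → ¬t (inj₂ (inj₂ x))))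
    (absent (rp τ) (λ x → ¬t (inj₂ (inj₂ x))) (λ x → ¬t (inj₁ x)))
    where
    absent : ∀ {h i q} → nx i h ≡ q → h ∉ S → q ∉ S → m h i ≡ false
    absent {h} {i} refl h∉ q∉ with m h i in eq
    ... | false = refl
    ... | true with within eq
    ...   | inj₁ h∈ = ⊥-elim (h∉ h∈)
    ...   | inj₂ q∈ = ⊥-elim (q∉ q∈)

  matching-of : ∀ {M} → IsPerfectMatching (graphOf S) M → Matching (indicator M)
  matching-of PM = record
    { within = λ eq → arc∈E⁻ (IsPerfectMatching.inE PM (true-indicator eq))
    ; law = λ τ t → one-at PM E-arc τ (touches-vertex τ t) }

  list-of : ∀ {m : ArcSet} → Matching m → IsPerfectMatching (graphOf S) (edgeList S m)
  list-of {m} Mm = perfect-matching within (λ eq → arc∈E⁺ (within eq)) (λ v → v)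
    (λ τ v → law τ (vertex-touches τ v)) atMost
    where
    open Matching Mm
    atMost : ∀ {c p q r i j l} → Triangle c p q r i j l →
             One (m p i) (m q j) (m r l) ⊎ None (m p i) (m q j) (m r l)
    atMost {p = p} {q} {r} τ with S-touches? p q r
    ... | yes t = inj₁ (law τ t)
    ... | no ¬t = inj₂ (nothing-away within τ ¬t)

  module _ {T : Hex → Set} {hs : List Hex} (T⇒hs : ∀ {h} → T h → h ∈ hs) (hs⇒T : ∀ {h} → h ∈ hs → T h) where

    matching-off-of : ∀ {M} → IsPerfectMatching (graphOf S ∖V InHexes hs) M → MatchingOff T (indicator M)
    matching-off-of {M} PM = record
      { within = λ eq → arc∈E⁻ (proj₁ (IsPerfectMatching.inE PM (true-indicator eq)))
      ; law = λ τ t ¬T → one-at PM (λ e → E-arc (proj₁ e)) τ (touches-vertex τ t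
          , λ v → ¬T (map-touches {_∈ hs} {T} hs⇒T (vertex-touches τ v)))
      ; off = λ {c} τ t → let v = touches-vertex τ (map-touches {T} {_∈ hs} T⇒hs t) in none
          (absent c v)
          (absent c (subst (λ g → InHexes hs (vtx c g)) (sym (end-turn τ)) v))
          (absent c (subst (λ g → InHexes hs (vtx c g)) (sym (trans (end-turn (turn τ)) (end-turn τ))) v)) }
      where
      absent : ∀ c {h i} → InHexes hs (vtx c (end c i h)) → indicator M h i ≡ false
      absent c {h} {i} v = indicator-false λ e∈ → go (incident c i h) (IsPerfectMatching.inE PM e∈)
        where
        go : Incident (vtx c (end c i h)) (arc h i) → E (graphOf S ∖V InHexes hs) (arc h i) → ⊥
        go (inj₁ eq) (_ , ¬1 , _) = ¬1 (subst (InHexes hs) eq v)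
        go (inj₂ eq) (_ , _ , ¬2) = ¬2 (subst (InHexes hs) eq v)

    list-off-of : (∀ h → Dec (T h)) → ∀ {m} → MatchingOff T m →
                  IsPerfectMatching (graphOf S ∖V InHexes hs) (edgeList S m)
    list-off-of T? {m} Mm = perfect-matching within inG proj₁
      (λ τ (v , ¬v) → law τ (vertex-touches τ v) λ t → ¬v (touches-vertex τ (map-touches {T} {_∈ hs} T⇒hs t)))
      atMost
      where
      open MatchingOff Mm
      free : ∀ {h i} → m h i ≡ true → ∀ c → ¬ InHexes hs (vtx c (end c i h))
      free {h} {i} eq c v =
        let j , l , π = perm-at c i
            τ = triangle-at π h
        in true≢false eq (none₁ (off τ (map-touches {_∈ hs} {T} hs⇒T (vertex-touches τ v))))
      inG : ∀ {h i} → m h i ≡ true → E (graphOf S ∖V InHexes hs) (arc h i)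
      inG {h} {i} eq = arc∈E⁺ (within eq)
        , (λ v → free eq (first i) (subst (InHexes hs) (end₁-arc i h) v))
        , (λ v → free eq (opposite (first i)) (subst (InHexes hs) (end₂-arc i h) v))
      atMost : ∀ {c p q r i j l} → Triangle c p q r i j l →
               One (m p i) (m q j) (m r l) ⊎ None (m p i) (m q j) (m r l)
      atMost {p = p} {q} {r} τ with T? p ⊎-dec (T? q ⊎-dec T? r) | S-touches? p q r
      ... | yes t | _ = inj₂ (off τ t)
      ... | no _ | no ¬s = inj₂ (nothing-away within τ ¬s)
      ... | no ¬t | yes s = inj₁ (law τ s ¬t)

-- The lower bound, and obstructions to equality

nothing∉ : ∀ {A : Set} {xs : List A} → nothing ∉ map just xs
nothing∉ x∈ with ∈-map⁻ just x∈
... | _ , _ , ()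

private
  module Rev = Oriented (reverse hexLattice)

module _ {S : List Hex} where
  open Region S
  open Convert S
  open Reversal hexLattice S
  private
    module RevS = Rev.Region S

  alternating-sink-or-source : ∀ {M} h → Alternating M h → Sink (indicator M) h ⊎ Source (indicator M) h
  alternating-sink-or-source {M} h = Sum.map
    (λ (x₁ , _ , x₃ , _ , x₅ , _) → λ { d₀ → out d₀ x₁ ; d₁ → out d₁ x₃ ; d₂ → out d₂ x₅ })
    (λ (_ , x₂ , _ , x₄ , _ , x₆) → λ
      { d₀ → inn d₀ (hexE₄-arc h) x₄ ; d₁ → inn d₁ (hexE₆-arc h) x₆ ; d₂ → inn d₂ (hexE₂-arc h) x₂ })
    where
    out : ∀ i → arc h i ∈ M → indicator M h i ≡ true
    out i = indicator-true {M} {h} {i}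
    inn : ∀ i {e} → e ≡ arc (pv i h) i → e ∈ M → indicator M (pv i h) i ≡ true
    inn i eq e∈ = indicator-true {M} {pv i h} {i} (subst (_∈ M) eq e∈)

  sink-alternating : ∀ {M h} → Matching (indicator M) → h ∈ S → Sink (indicator M) h → Alternating M h
  sink-alternating {M} {h} Mm h∈ sink = inj₁
    ( present d₀ , absent d₂ (hexE₂-arc h) , present d₁
    , absent d₀ (hexE₄-arc h) , present d₂ , absent d₁ (hexE₆-arc h))
    where
    present : ∀ i → arc h i ∈ M
    present i = true-indicator {M} {h} {i} (sink i)
    absent : ∀ i {e} → e ≡ arc (pv i h) i → e ∉ M
    absent i eq e∈ = false-indicator {M} {pv i h} {i} (sink-in Mm h∈ sink i) (subst (_∈ M) eq e∈)

  source-alternating : ∀ {M h} → Matching (indicator M) → h ∈ S → Source (indicator M) h → Alternating M h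
  source-alternating {M} {h} Mm h∈ source = inj₂
    ( absent d₀ , present d₂ (hexE₂-arc h) , absent d₁
    , present d₀ (hexE₄-arc h) , absent d₂ , present d₁ (hexE₆-arc h))
    where
    absent : ∀ i → arc h i ∉ M
    absent i = false-indicator {M} {h} {i} (source-out Mm h∈ source i)
    present : ∀ i {e} → e ≡ arc (pv i h) i → e ∈ M
    present i eq = subst (_∈ M) (sym eq) (true-indicator {M} {pv i h} {i} (source i))

  same-arc : ∀ {m h h′ p i} → Matching m → h ∈ S → h′ ∈ S →
             (Sink m h × nx i p ≡ h) ⊎ (Source m h × p ≡ h) →
             (Sink m h′ × nx i p ≡ h′) ⊎ (Source m h′ × p ≡ h′) → h ≡ h′
  same-arc _ _ _ (inj₁ (_ , refl)) (inj₁ (_ , refl)) = refl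
  same-arc _ _ _ (inj₂ (_ , refl)) (inj₂ (_ , refl)) = refl
  same-arc Mm _ h′∈ (inj₁ (sink , refl)) (inj₂ (source , refl)) = ⊥-elim (open-arc-unique Mm source sink h′∈)
  same-arc Mm h∈ _ (inj₂ (source , refl)) (inj₁ (sink , refl)) = ⊥-elim (open-arc-unique Mm source sink h∈)

  search : ∀ A {X : Hex → Dir → Set} → (∀ h i → Dec (X h i)) →
           (∃[ h ] ∃[ i ] (arc h i ∈ A × X h i))
           ⊎ (∀ h i → h ∈ S ⊎ nx i h ∈ S → arc h i ∈ A → ¬ X h i)
  search A X? with Any.any? (λ a → (uncurry arc a ∈E? A) ×-dec uncurry X? a) (arcsOf S)
  ... | no nowhere = inj₂ λ h i b a∈ x → nowhere (lose (arc∈arcsOf b) (a∈ , x))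
  ... | yes some with find some
  ...   | (h , i) , _ , x = inj₁ (h , i , x)

  module LowerBound {M A : List Edge} (Mm : Matching (indicator M)) (AF : IsAntiForcingSet S M A) where
    private
      m = indicator M

    -- If `A` missed `X`, the other matching would survive the deletion of `A`: its edges shared
    -- with `M` are not in `A`, and the remaining ones lie in `X`. Uniqueness would make it equal to
    -- `M`, against its new edge.
    hits : ∀ {m′ : ArcSet} {X : Hex → Dir → Set} → Matching m′ → (∀ h i → Dec (X h i)) →
           (∀ {h i} → m′ h i ≡ true → m h i ≡ true ⊎ X h i) →
           (∃[ h ] ∃[ i ] (m′ h i ≡ true × m h i ≡ false)) →
           ∃[ h ] ∃[ i ] (arc h i ∈ A × X h i)
    hits {m′} {X} Mm′ X? sub (h , i , new , old) = [ (λ x → x) , (λ nowhere → ⊥-elim (contra nowhere)) ]′ (search A X?)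
      where
      PM′ = list-of Mm′
      module _ (nowhere : ∀ h i → h ∈ S ⊎ nx i h ∈ S → arc h i ∈ A → ¬ X h i) where
        avoids : ∀ {e} → e ∈ edgeList S m′ → e ∉ A
        avoids {e} e∈ e∈A =
          let p , k , e≡ , eq = edgeList⁻ {S} {m′} e∈
              a∈ = subst (_∈ A) e≡ e∈A
          in [ (λ old → proj₂ (proj₁ AF a∈) (true-indicator old)) , nowhere p k (Matching.within Mm′ eq) a∈ ]′ (sub eq)
        avoiding : IsPerfectMatching (graphOf S ∖E A) (edgeList S m′)
        avoiding = record
          { inE = λ e∈ → IsPerfectMatching.inE PM′ e∈ , avoids e∈
          ; covers = IsPerfectMatching.covers PM′ ; once = IsPerfectMatching.once PM′ }
        contra : ⊥
        contra = false-indicator old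
          (proj₁ (proj₂ (proj₂ AF) (edgeList S m′) avoiding (arc h i)) (edgeList⁺ (Matching.within Mm′ new) new))

    -- The edges of an alternating hexagon outside the matching are the in-arcs of a sink and the
    -- out-arcs of a source.
    OnHexagon : Hex → Edge → Set
    OnHexagon h a = ∃[ p ] ∃[ i ] (a ≡ arc p i × h ∈ S × ((Sink m h × nx i p ≡ h) ⊎ (Source m h × p ≡ h)))

    on-sink : ∀ {h} → h ∈ S → Sink m h → ∃[ a ] (a ∈ A × OnHexagon h a)
    on-sink {h} h∈ sink =
      let p , i , a∈ , x = hits flip-matching (λ p i → nx i p ≟F h) flipped⊆
                             (pv d₀ h , d₀ , flipped-in d₀ , sink-in Mm h∈ sink d₀)
      in arc p i , a∈ , p , i , refl , h∈ , inj₁ (sink , x)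
      where open Sinks.FlipSink hexLattice S Mm h∈ sink

    on-source : ∀ {h} → h ∈ S → Source m h → ∃[ a ] (a ∈ A × OnHexagon h a)
    on-source {h} h∈ source =
      let p , i , a∈ , x = hits (restore-matching flip-matching) (λ p i → p ≟F h) sub
                             (h , d₀ , flipped-in d₀ , source-out Mm h∈ source d₀)
      in arc p i , a∈ , p , i , refl , h∈ , inj₂ (source , x)
      where
      open Sinks.FlipSink (reverse hexLattice) S (reverse-matching Mm) h∈ source
      sub : ∀ {p i} → flipped (nx i p) i ≡ true → m p i ≡ true ⊎ p ≡ h
      sub {p} {i} eq = Sum.map (subst (λ q → m q i ≡ true) (pv-nx i p)) (trans (sym (pv-nx i p)))
                         (flipped⊆ {nx i p} {i} eq)

    on-hexagon : ∀ {h} → h ∈ S → Alternating M h → ∃[ a ] (a ∈ A × OnHexagon h a)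
    on-hexagon {h} h∈ alt = [ on-sink h∈ , on-source h∈ ]′ (alternating-sink-or-source h alt)

    on-hexagon-unique : ∀ {h h′ a} → OnHexagon h a → OnHexagon h′ a → h ≡ h′
    on-hexagon-unique {h} {h′} (p , i , a≡ , h∈ , x) (p′ , i′ , a≡′ , h′∈ , y) =
      let p≡ , i≡ = arc-injective i i′ (trans (sym a≡) a≡′)
      in same-arc Mm h∈ h′∈ x (subst₂ (λ p i → (Sink m h′ × nx i p ≡ h′) ⊎ (Source m h′ × p ≡ h′)) (sym p≡) (sym i≡) y)

    alternating-hexagons : List Hex
    alternating-hexagons = filter (alternating? M) S

    module _ (S! : Unique S) where

      hits-all : ∀ {h} → h ∈ alternating-hexagons → ∃[ a ] (a ∈ A × OnHexagon h a)
      hits-all h∈ = uncurry on-hexagon (∈-filter⁻ (alternating? M) {xs = S} h∈)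

      fr≤ : fr S M ℕ.≤ length A
      fr≤ = representatives (UniqueP.filter⁺ (alternating? M) S!) hits-all on-hexagon-unique

      -- `nothing` is one further object to be represented, by `a` itself, beside the alternating
      -- hexagons.
      fr< : ∀ {a} → a ∈ A → (∀ {h} → ¬ OnHexagon h a) → fr S M ℕ.< length A
      fr< {a} a∈ free = subst (ℕ._≤ length A) (cong suc (length-map just alternating-hexagons))
        (representatives {P = Rep} {nothing ∷ map just alternating-hexagons}
          (All.tabulate (λ x∈ eq → nothing∉ (subst (_∈ _) (sym eq) x∈)) ∷
            UniqueP.map⁺ (λ { refl → refl }) (UniqueP.filter⁺ (alternating? M) S!))
          rep unique)
        where
        Rep : Maybe Hex → Edge → Set
        Rep (just h) b = OnHexagon h b
        Rep nothing b = b ≡ a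
        rep : ∀ {x} → x ∈ nothing ∷ map just alternating-hexagons → ∃[ b ] (b ∈ A × Rep x b)
        rep (here refl) = a , a∈ , refl
        rep (there x∈) =
          let h , h∈ , x≡ = ∈-map⁻ just x∈
              b , b∈ , on = hits-all h∈
          in b , b∈ , subst (λ x → Rep x b) (sym x≡) on
        unique : ∀ {x y b} → Rep x b → Rep y b → x ≡ y
        unique {just h} {just h′} p q = cong just (on-hexagon-unique p q)
        unique {just h} {nothing} p refl = ⊥-elim (free p)
        unique {nothing} {just h} refl q = ⊥-elim (free q)
        unique {nothing} {nothing} _ _ = refl

  -- `X` contains the edges in which `m′` is new. An edge outside `m` lies on an alternating hexagon
  -- only if its arc leaves a source or enters a sink; the last two fields exclude this, so an
  -- anti-forcing set needs an edge beyond those spent on hexagons.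
  record Obstruction : Set₁ where
    field
      m m′ : ArcSet
      X    : Hex → Dir → Set
      X?   : ∀ h i → Dec (X h i)
      Mm   : Matching m
      Mm′  : Matching m′
      sub  : ∀ {h i} → m′ h i ≡ true → m h i ≡ true ⊎ X h i
      new  : ∃[ h ] ∃[ i ] (m′ h i ≡ true × m h i ≡ false)
      not-source : ∀ {h i} → X h i → ¬ Source m h
      not-sink   : ∀ {h i} → X h i → ¬ Sink m (nx i h)

  obstruct : Unique S → Obstruction →
             ∃[ M ] (IsPerfectMatching (graphOf S) M × ¬ AfIs S M (fr S M))
  obstruct S! ob = M , PM , contra
    where
    open Obstruction ob
    M = edgeList S m
    PM = list-of Mm
    same-true : ∀ {h i} → m h i ≡ true → indicator M h i ≡ true
    same-true eq = indicator-true (edgeList⁺ (Matching.within Mm eq) eq)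
    true-same : ∀ {h i} → indicator M h i ≡ true → m h i ≡ true
    true-same {h} {i} eq =
      let p , k , e , eq′ = edgeList⁻ {S} {m} (true-indicator eq)
          h≡ , i≡ = arc-injective i k e
      in subst₂ (λ h i → m h i ≡ true) (sym h≡) (sym i≡) eq′
    sub′ : ∀ {h i} → m′ h i ≡ true → indicator M h i ≡ true ⊎ X h i
    sub′ eq = Sum.map same-true (λ x → x) (sub eq)
    new′ : ∃[ h ] ∃[ i ] (m′ h i ≡ true × indicator M h i ≡ false)
    new′ = let h , i , a , b = new
           in h , i , a , indicator-false λ e∈ → true≢false (true-same (indicator-true e∈)) b
    contra : ¬ AfIs S M (fr S M)
    contra ((A , AF , A! , len) , _) =
      let p , i , a∈ , x = hits Mm′ X? sub′ new′
      in ℕP.<-irrefl (sym len) (fr< S! a∈ (free x))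
      where
      open LowerBound (matching-of PM) AF
      free : ∀ {p i} → X p i → ∀ {h} → ¬ OnHexagon h (arc p i)
      free {p} {i} x {h} (p′ , i′ , eq , _ , y) =
        let p≡ , i≡ = arc-injective i i′ eq
        in [ (λ (sink , q≡) → not-sink x λ k → true-same (subst (λ h → indicator M h k ≡ true)
               (sym (trans (cong₂ nx i≡ p≡) q≡)) (sink k)))
           , (λ (source , q≡) → not-source x λ k → true-same (subst (λ h → indicator M (pv k h) k ≡ true)
               (sym (trans p≡ q≡)) (source k))) ]′ y

  block-obstruction : ∀ {t m₀} → (∀ {h} → Block t h → h ∈ S) → MatchingOff (Block t) m₀ → Obstruction
  block-obstruction {t} block⊆S M₀ = record
    { m = Tr.m ; m′ = Tr.m′ ; X = Inward t ; X? = inward? t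
    ; Mm = Tr.m-matching ; Mm′ = Tr.m′-matching ; sub = Tr.m′⊆
    ; new = pv d₀ (pv d₀ t) , d₀ , Tr.inward-in-m′ inner , inward-open Tr.m-matching block⊆S Tr.m-tight inner
    ; not-source = inward-not-source Tr.m-matching block⊆S Tr.m-tight
    ; not-sink = λ { (inward a eq) sink → outer-not-sink Tr.m-matching block⊆S Tr.m-tight a (subst (Sink Tr.m) eq sink) } }
    where
    module Tr = Triphenylene M₀ block⊆S
    inner : Inward t (pv d₀ (pv d₀ t)) d₀
    inner = inward d₀ (nx-pv d₀ (pv d₀ t))

  reverse-block-obstruction : ∀ {t m₀} → (∀ {h} → RevS.Block t h → h ∈ S) → RevS.MatchingOff (RevS.Block t) m₀ → Obstruction
  reverse-block-obstruction {t} block⊆S M₀ = record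
    { m = restored Tr.m ; m′ = restored Tr.m′ ; X = λ h i → RevS.Inward t (nx i h) i ; X? = λ h i → RevS.inward? t (nx i h) i
    ; Mm = restore-matching Tr.m-matching ; Mm′ = restore-matching Tr.m′-matching ; sub = Tr.m′⊆
    ; new = nx d₀ t , d₀ , Tr.inward-in-m′ inner , RevS.inward-open Tr.m-matching block⊆S Tr.m-tight inner
    ; not-source = λ { {h} {i} (RevS.inward a eq) source →
        RevS.outer-not-sink Tr.m-matching block⊆S Tr.m-tight a (λ k →
          subst (λ q → Tr.m q k ≡ true) (trans (nx-pv k h) (trans (sym (pv-nx i h)) eq)) (source k)) }
    ; not-sink = RevS.inward-not-source Tr.m-matching block⊆S Tr.m-tight }
    where
    module Tr = RevS.Triphenylene M₀ block⊆S
    inner : RevS.Inward t (nx d₀ (nx d₀ t)) d₀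
    inner = RevS.inward d₀ (pv-nx d₀ (nx d₀ t))

-- Triphenylenes as blocks, in both orientations

module _ {S : List Hex} where
  open Region S
  open Convert S
  open Reversal hexLattice S
  private
    module RevS = Rev.Region S

  out-not-in : ∀ {h i k} → NonAdjacent (arc h i) (arc (pv k h) k) → i ≡ k
  out-not-in {h} {i} {k} na with i ≟D k
  ... | yes eq = eq
  ... | no i≢k with perm-from i≢k
  ...   | c , j , π = ⊥-elim (na (vtx c (end c i h)) (incident c i h)
            (subst (λ g → Incident (vtx c g) (arc (pv k h) k)) (trans (end-turn (turn τ)) (end-turn τ)) (incident c k (pv k h))))
    where τ = triangle-at π h

  data Neighbour (h : Hex) (e : Edge) (q : Hex) : Set where
    before : ∀ i → e ≡ arc (pv i h) i → q ≡ pv i h → Neighbour h e q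
    after  : ∀ i → e ≡ arc h i → q ≡ nx i h → Neighbour h e q

  neighbour-arc : ∀ h q {p i} → p ≡ h ⊎ nx i p ≡ h → p ≡ q ⊎ nx i p ≡ q → h ≢ q → Neighbour h (arc p i) q
  neighbour-arc h q (inj₁ refl) (inj₁ eq) h≢q = ⊥-elim (h≢q eq)
  neighbour-arc h q (inj₁ refl) (inj₂ eq) h≢q = after _ refl (sym eq)
  neighbour-arc h q {p} {i} (inj₂ refl) (inj₁ eq) h≢q =
    before i (cong (λ p → arc p i) (sym (pv-nx i p))) (trans (sym eq) (sym (pv-nx i p)))
  neighbour-arc h q (inj₂ refl) (inj₂ eq) h≢q = ⊥-elim (h≢q eq)

  neighbour : ∀ h q {e} → e ∈ hexEdges h → e ∈ hexEdges q → h ≢ q → Neighbour h e q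
  neighbour h q e∈h e∈q h≢q =
    let p , i , e≡ , x = ∈-hexEdges h e∈h
        y = arc∈hexEdges⁻ q (subst (_∈ hexEdges q) e≡ e∈q)
    in subst (λ e → Neighbour h e q) (sym e≡) (neighbour-arc h q x y h≢q)

  three-cover : ∀ {i j k : Dir} → i ≢ j → i ≢ k → j ≢ k → ∀ a → a ≡ i ⊎ a ≡ j ⊎ a ≡ k
  three-cover {i} {j} {k} i≢j i≢k j≢k a with perm-from i≢j
  ... | c , l , π with perm-covers π k | perm-covers π a
  ...   | inj₁ k≡i | _ = ⊥-elim (i≢k (sym k≡i))
  ...   | inj₂ (inj₂ k≡j) | _ = ⊥-elim (j≢k (sym k≡j))
  ...   | inj₂ (inj₁ refl) | inj₁ x = inj₁ x
  ...   | inj₂ (inj₁ refl) | inj₂ (inj₁ x) = inj₂ (inj₂ x)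
  ...   | inj₂ (inj₁ refl) | inj₂ (inj₂ x) = inj₂ (inj₁ x)

  distinct-dirs : ∀ (P : Dir → Hex) {i j h h′} → h ≡ P i → h′ ≡ P j → h ≢ h′ → i ≢ j
  distinct-dirs P refl refl h≢h′ refl = h≢h′ refl

  opposite-dirs : ∀ {h i k e e′} → e ≡ arc h i → e′ ≡ arc (pv k h) k → NonAdjacent e e′ → i ≡ k
  opposite-dirs {h} {i} {k} refl refl na = out-not-in {h} {i} {k} na

  NonAdjacent-sym : ∀ {e e′} → NonAdjacent e e′ → NonAdjacent e′ e
  NonAdjacent-sym na v x y = na v y x

  outer-listed : ∀ (P : Dir → Hex) {h₁ h₂ h₃ i₁ i₂ i₃} → h₁ ≡ P i₁ → h₂ ≡ P i₂ → h₃ ≡ P i₃ →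
                 h₁ ≢ h₂ → h₁ ≢ h₃ → h₂ ≢ h₃ → ∀ a → P a ∈ h₁ ∷ h₂ ∷ h₃ ∷ []
  outer-listed P x₁ x₂ x₃ h₁≢h₂ h₁≢h₃ h₂≢h₃ a
    with three-cover (distinct-dirs P x₁ x₂ h₁≢h₂) (distinct-dirs P x₁ x₃ h₁≢h₃) (distinct-dirs P x₂ x₃ h₂≢h₃) a
  ... | inj₁ refl = here (sym x₁)
  ... | inj₂ (inj₁ refl) = there (here (sym x₂))
  ... | inj₂ (inj₂ refl) = there (there (here (sym x₃)))

  four-in : ∀ {h₀ h₁ h₂ h₃ : Hex} {Q : Hex → Set} → Q h₀ → Q h₁ → Q h₂ → Q h₃ →
            ∀ {h} → h ∈ h₀ ∷ h₁ ∷ h₂ ∷ h₃ ∷ [] → Q h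
  four-in a b c d (here refl) = a
  four-in a b c d (there (here refl)) = b
  four-in a b c d (there (there (here refl))) = c
  four-in a b c d (there (there (there (here refl)))) = d

  module _ {h₀ h₁ h₂ h₃ : Hex} (h₀∈ : h₀ ∈ S) (h₁∈ : h₁ ∈ S) (h₂∈ : h₂ ∈ S) (h₃∈ : h₃ ∈ S)
           (h₁≢h₂ : h₁ ≢ h₂) (h₁≢h₃ : h₁ ≢ h₃) (h₂≢h₃ : h₂ ≢ h₃) {M₀ : List Edge}
           (PM₀ : IsPerfectMatching (graphOf S ∖V InHexes (h₀ ∷ h₁ ∷ h₂ ∷ h₃ ∷ [])) M₀) where

    before-obstruction : ∀ {i₁ i₂ i₃} → h₁ ≡ pv i₁ h₀ → h₂ ≡ pv i₂ h₀ → h₃ ≡ pv i₃ h₀ → Obstruction {S}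
    before-obstruction x₁ x₂ x₃ =
      block-obstruction (λ b → four-in {Q = _∈ S} h₀∈ h₁∈ h₂∈ h₃∈ (to b)) (matching-off-of {T = Block h₀} to from PM₀)
      where
      to : ∀ {h} → Block h₀ h → h ∈ h₀ ∷ h₁ ∷ h₂ ∷ h₃ ∷ []
      to centre = here refl
      to (outer a) = there (outer-listed (λ i → pv i h₀) x₁ x₂ x₃ h₁≢h₂ h₁≢h₃ h₂≢h₃ a)
      from : ∀ {h} → h ∈ h₀ ∷ h₁ ∷ h₂ ∷ h₃ ∷ [] → Block h₀ h
      from = four-in centre (subst (Block h₀) (sym x₁) (outer _)) (subst (Block h₀) (sym x₂) (outer _))
                            (subst (Block h₀) (sym x₃) (outer _))

    after-obstruction : ∀ {i₁ i₂ i₃} → h₁ ≡ nx i₁ h₀ → h₂ ≡ nx i₂ h₀ → h₃ ≡ nx i₃ h₀ → Obstruction {S}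
    after-obstruction x₁ x₂ x₃ =
      reverse-block-obstruction (λ b → four-in {Q = _∈ S} h₀∈ h₁∈ h₂∈ h₃∈ (to b))
        (reverse-off (matching-off-of {T = RevS.Block h₀} to from PM₀))
      where
      to : ∀ {h} → RevS.Block h₀ h → h ∈ h₀ ∷ h₁ ∷ h₂ ∷ h₃ ∷ []
      to RevS.centre = here refl
      to (RevS.outer a) = there (outer-listed (λ i → nx i h₀) x₁ x₂ x₃ h₁≢h₂ h₁≢h₃ h₂≢h₃ a)
      from : ∀ {h} → h ∈ h₀ ∷ h₁ ∷ h₂ ∷ h₃ ∷ [] → RevS.Block h₀ h
      from = four-in RevS.centre (subst (RevS.Block h₀) (sym x₁) (RevS.outer _))
               (subst (RevS.Block h₀) (sym x₂) (RevS.outer _)) (subst (RevS.Block h₀) (sym x₃) (RevS.outer _))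

    -- An out-arc and an in-arc of `h₀` without a common vertex are opposite edges, hence of one
    -- direction. In a mixed case two neighbours of the same kind would both lie opposite the third
    -- and so coincide. The shared edges are therefore all in-arcs or all out-arcs.
    neighbours-obstruction : ∀ {e₁ e₂ e₃} → NonAdjacent e₁ e₂ → NonAdjacent e₁ e₃ → NonAdjacent e₂ e₃ →
      Neighbour h₀ e₁ h₁ → Neighbour h₀ e₂ h₂ → Neighbour h₀ e₃ h₃ → Obstruction {S}
    neighbours-obstruction na₁₂ na₁₃ na₂₃ (before i₁ y₁ x₁) (before i₂ y₂ x₂) (before i₃ y₃ x₃) =
      before-obstruction x₁ x₂ x₃
    neighbours-obstruction na₁₂ na₁₃ na₂₃ (after i₁ y₁ x₁) (after i₂ y₂ x₂) (after i₃ y₃ x₃) =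
      after-obstruction x₁ x₂ x₃
    neighbours-obstruction na₁₂ na₁₃ na₂₃ (before i₁ y₁ x₁) (before i₂ y₂ x₂) (after i₃ y₃ x₃) =
      ⊥-elim (distinct-dirs (λ i → pv i h₀) x₁ x₂ h₁≢h₂
        (trans (sym (opposite-dirs y₃ y₁ (NonAdjacent-sym na₁₃))) (opposite-dirs y₃ y₂ (NonAdjacent-sym na₂₃))))
    neighbours-obstruction na₁₂ na₁₃ na₂₃ (before i₁ y₁ x₁) (after i₂ y₂ x₂) (before i₃ y₃ x₃) =
      ⊥-elim (distinct-dirs (λ i → pv i h₀) x₁ x₃ h₁≢h₃
        (trans (sym (opposite-dirs y₂ y₁ (NonAdjacent-sym na₁₂))) (opposite-dirs y₂ y₃ na₂₃)))
    neighbours-obstruction na₁₂ na₁₃ na₂₃ (after i₁ y₁ x₁) (before i₂ y₂ x₂) (before i₃ y₃ x₃) =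
      ⊥-elim (distinct-dirs (λ i → pv i h₀) x₂ x₃ h₂≢h₃
        (trans (sym (opposite-dirs y₁ y₂ na₁₂)) (opposite-dirs y₁ y₃ na₁₃)))
    neighbours-obstruction na₁₂ na₁₃ na₂₃ (after i₁ y₁ x₁) (after i₂ y₂ x₂) (before i₃ y₃ x₃) =
      ⊥-elim (distinct-dirs (λ i → nx i h₀) x₁ x₂ h₁≢h₂
        (trans (opposite-dirs y₁ y₃ na₁₃) (sym (opposite-dirs y₂ y₃ na₂₃))))
    neighbours-obstruction na₁₂ na₁₃ na₂₃ (after i₁ y₁ x₁) (before i₂ y₂ x₂) (after i₃ y₃ x₃) =
      ⊥-elim (distinct-dirs (λ i → nx i h₀) x₁ x₃ h₁≢h₃
        (trans (opposite-dirs y₁ y₂ na₁₂) (sym (opposite-dirs y₃ y₂ (NonAdjacent-sym na₂₃)))))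
    neighbours-obstruction na₁₂ na₁₃ na₂₃ (before i₁ y₁ x₁) (after i₂ y₂ x₂) (after i₃ y₃ x₃) =
      ⊥-elim (distinct-dirs (λ i → nx i h₀) x₂ x₃ h₂≢h₃
        (trans (opposite-dirs y₂ y₁ (NonAdjacent-sym na₁₂)) (sym (opposite-dirs y₃ y₁ (NonAdjacent-sym na₁₃)))))

  triphenylene-obstruction : HasNiceTriphenylene S → Obstruction {S}
  triphenylene-obstruction
    (h₀ , h₁ , h₂ , h₃ , h₀∈ , h₁∈ , h₂∈ , h₃∈ , h₀≢h₁ , h₀≢h₂ , h₀≢h₃ , h₁≢h₂ , h₁≢h₃ , h₂≢h₃
    , (e₁ , e₂ , e₃ , e₁∈h₀ , e₁∈h₁ , e₂∈h₀ , e₂∈h₂ , e₃∈h₀ , e₃∈h₃ , na₁₂ , na₁₃ , na₂₃) , M₀ , PM₀) =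
    neighbours-obstruction h₀∈ h₁∈ h₂∈ h₃∈ h₁≢h₂ h₁≢h₃ h₂≢h₃ PM₀ na₁₂ na₁₃ na₂₃
      (neighbour h₀ h₁ e₁∈h₀ e₁∈h₁ h₀≢h₁) (neighbour h₀ h₂ e₂∈h₀ e₂∈h₂ h₀≢h₂) (neighbour h₀ h₃ e₃∈h₀ e₃∈h₃ h₀≢h₃)

  separate : ∀ {a b p q} → a ≢ b → (∀ c → end c b q ≡ end c a p → ⊥) → NonAdjacent (arc p a) (arc q b)
  separate {a} {b} {p} {q} a≢b away v inc inc′ =
    let c , v≡ = end-at inc in away c (incident-end (subst (λ v → Incident v (arc q b)) v≡ inc′))

  in-arcs-separate : ∀ a b t → a ≢ b → NonAdjacent (arc (pv a t) a) (arc (pv b t) b)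
  in-arcs-separate a b t a≢b = separate a≢b away
    where
    away : ∀ c → end c b (pv b t) ≡ end c a (pv a t) → ⊥
    away c eq with perm-at c a
    ... | j , l , π = go refl refl (at-vertex (triangle-at π (pv a t)) (pv b t) b eq)
      where
      go : ∀ {h k} → h ≡ pv b t → k ≡ b → AtVertex (pv a t) (nx a (pv a t)) (pv l (pv a t)) a j l h k → ⊥
      go _ k≡b at₁ = a≢b k≡b
      go h≡ _ at₂ = nx≢ b t (trans (cong (nx b) (trans (sym (nx-pv a t)) h≡)) (nx-pv b t))
      go h≡ refl at₃ = nx≢ a t (trans (cong (nx a) (sym (pv-injective b h≡))) (nx-pv a t))

  out-arcs-separate : ∀ a b t → a ≢ b → NonAdjacent (arc t a) (arc t b)
  out-arcs-separate a b t a≢b = separate a≢b away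
    where
    away : ∀ c → end c b t ≡ end c a t → ⊥
    away c eq with perm-at c a
    ... | j , l , π = go refl refl (at-vertex (triangle-at π t) t b eq)
      where
      go : ∀ {h k} → h ≡ t → k ≡ b → AtVertex t (nx a t) (pv l t) a j l h k → ⊥
      go _ k≡b at₁ = a≢b k≡b
      go h≡ _ at₂ = nx≢ a t h≡
      go h≡ _ at₃ = nx≢ l t (trans (cong (nx l) (sym h≡)) (nx-pv l t))

  pv≢ : ∀ i p → pv i p ≢ p
  pv≢ i p eq = nx≢ i p (trans (cong (nx i) (sym eq)) (nx-pv i p))

  block-triphenylene : ∀ {t} → Sinks.BlockMatching hexLattice S t → HasNiceTriphenylene S
  block-triphenylene {t} (block⊆S , m₀ , M₀) =
    t , pv d₀ t , pv d₁ t , pv d₂ t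
    , block⊆S centre , block⊆S (outer d₀) , block⊆S (outer d₁) , block⊆S (outer d₂)
    , ≢-sym (pv≢ d₀ t) , ≢-sym (pv≢ d₁ t) , ≢-sym (pv≢ d₂ t)
    , distinct d₀ d₁ (λ ()) , distinct d₀ d₂ (λ ()) , distinct d₁ d₂ (λ ())
    , (arc (pv d₀ t) d₀ , arc (pv d₁ t) d₁ , arc (pv d₂ t) d₂
      , in∈hexEdges d₀ t , out∈hexEdges d₀ (pv d₀ t)
      , in∈hexEdges d₁ t , out∈hexEdges d₁ (pv d₁ t)
      , in∈hexEdges d₂ t , out∈hexEdges d₂ (pv d₂ t)
      , in-arcs-separate d₀ d₁ t (λ ()) , in-arcs-separate d₀ d₂ t (λ ()) , in-arcs-separate d₁ d₂ t (λ ()))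
    , _ , list-off-of to from (block? t) M₀
    where
    distinct : ∀ a b → a ≢ b → pv a t ≢ pv b t
    distinct a b a≢b eq = a≢b (pv-dir t eq)
    to : ∀ {h} → Block t h → h ∈ t ∷ pv d₀ t ∷ pv d₁ t ∷ pv d₂ t ∷ []
    to centre = here refl
    to (outer d₀) = there (here refl)
    to (outer d₁) = there (there (here refl))
    to (outer d₂) = there (there (there (here refl)))
    from : ∀ {h} → h ∈ t ∷ pv d₀ t ∷ pv d₁ t ∷ pv d₂ t ∷ [] → Block t h
    from (here refl) = centre
    from (there (here refl)) = outer d₀
    from (there (there (here refl))) = outer d₁
    from (there (there (there (here refl)))) = outer d₂

  reverse-block-triphenylene : ∀ {t} → Sinks.BlockMatching (reverse hexLattice) S t → HasNiceTriphenylene S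
  reverse-block-triphenylene {t} (block⊆S , m₀ , M₀) =
    t , nx d₀ t , nx d₁ t , nx d₂ t
    , block⊆S RevS.centre , block⊆S (RevS.outer d₀) , block⊆S (RevS.outer d₁) , block⊆S (RevS.outer d₂)
    , ≢-sym (nx≢ d₀ t) , ≢-sym (nx≢ d₁ t) , ≢-sym (nx≢ d₂ t)
    , distinct d₀ d₁ (λ ()) , distinct d₀ d₂ (λ ()) , distinct d₁ d₂ (λ ())
    , (arc t d₀ , arc t d₁ , arc t d₂
      , out∈hexEdges d₀ t , arc∈hexEdges⁺ {t} {d₀} {nx d₀ t} (inj₂ refl)
      , out∈hexEdges d₁ t , arc∈hexEdges⁺ {t} {d₁} {nx d₁ t} (inj₂ refl)
      , out∈hexEdges d₂ t , arc∈hexEdges⁺ {t} {d₂} {nx d₂ t} (inj₂ refl)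
      , out-arcs-separate d₀ d₁ t (λ ()) , out-arcs-separate d₀ d₂ t (λ ()) , out-arcs-separate d₁ d₂ t (λ ()))
    , _ , list-off-of to from (RevS.block? t) (restore-off M₀)
    where
    distinct : ∀ a b → a ≢ b → nx a t ≢ nx b t
    distinct a b a≢b eq = a≢b (nx-dir t eq)
    to : ∀ {h} → RevS.Block t h → h ∈ t ∷ nx d₀ t ∷ nx d₁ t ∷ nx d₂ t ∷ []
    to RevS.centre = here refl
    to (RevS.outer d₀) = there (here refl)
    to (RevS.outer d₁) = there (there (here refl))
    to (RevS.outer d₂) = there (there (there (here refl)))
    from : ∀ {h} → h ∈ t ∷ nx d₀ t ∷ nx d₁ t ∷ nx d₂ t ∷ [] → RevS.Block t h
    from (here refl) = RevS.centre
    from (there (here refl)) = RevS.outer d₀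
    from (there (there (here refl))) = RevS.outer d₁
    from (there (there (there (here refl)))) = RevS.outer d₂

-- The upper bound

value : Bool → ℤ
value true  = + 1
value false = + 0

value-injective : ∀ {a b} → value a ≡ value b → a ≡ b
value-injective {true} {true} _ = refl
value-injective {false} {false} _ = refl

value-sum : ∀ {a b c} → One a b c → value a + value b + value c ≡ + 1
value-sum (one₁ refl refl refl) = refl
value-sum (one₂ refl refl refl) = refl
value-sum (one₃ refl refl refl) = refl

not-true : ∀ {b} → ¬ (b ≡ true) → b ≡ false
not-true {true} ¬t = ⊥-elim (¬t refl)
not-true {false} _ = refl

-- `value false` is the value of the given matching on an unmatched arc, so that this becomes the
-- monotonicity of `f` along arcs.
grow : ∀ κ a b → a ℤ.≤ a + + suc κ * (value b - value false)
grow κ a true = subst (λ z → a ℤ.≤ a + z) (sym (ℤP.*-identityʳ (+ suc κ))) (ℤP.i≤i+j a (+ suc κ))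
grow κ a false = ℤP.≤-reflexive (sym (trans (cong (λ z → a + z) (ℤP.*-zeroʳ (+ suc κ))) (ℤP.+-identityʳ a)))

module UpperBound {S : List Hex} (HS : IsHexagonalSystem S) (no-triphenylene : ¬ HasNiceTriphenylene S)
                  {M : List Edge} (PM : IsPerfectMatching (graphOf S) M) where
  open Region S
  open Convert S
  open Reversal hexLattice S
  open Potentials (FromSystem.cells HS)

  private
    module SinksF = Sinks hexLattice S
    module SinksR = Sinks (reverse hexLattice) S

    m : ArcSet
    m = indicator M

    Mm : Matching m
    Mm = matching-of PM

    S! : Unique S
    S! = IsHexagonalSystem.distinct HS

  data Chosen (h : Hex) : Edge → Set where
    at-sink   : ∀ i → Sink m h → SinksF.Exit m h i → Chosen h (arc (pv i h) i)
    at-source : ∀ i → Source m h → SinksR.Exit (reversed m) h i → Chosen h (arc h i)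

  choose : ∀ {h} → h ∈ filter (alternating? M) S → ∃ (Chosen h)
  choose {h} h∈ =
    let h∈S , alt = ∈-filter⁻ (alternating? M) {xs = S} h∈
    in [ choose-sink h∈S , choose-source h∈S ]′ (alternating-sink-or-source {S} {M} h alt)
    where
    choose-sink : h ∈ S → Sink m h → ∃ (Chosen h)
    choose-sink h∈S sink =
      [ (λ (i , exit) → _ , at-sink i sink exit)
      , (λ block → ⊥-elim (no-triphenylene (block-triphenylene block))) ]′ (SinksF.exit-or-block Mm h∈S sink)
    choose-source : h ∈ S → Source m h → ∃ (Chosen h)
    choose-source h∈S source =
      [ (λ (i , exit) → _ , at-source i source exit)
      , (λ block → ⊥-elim (no-triphenylene (reverse-block-triphenylene block))) ]′
      (SinksR.exit-or-block (reverse-matching Mm) h∈S source)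

  private
    chosen = choices (filter (alternating? M) S) choose
    A₀ = proj₁ chosen

  -- Duplicates are removed because anti-forcing sets are measured by lists without repetition. The
  -- lower bound shows afterwards that the length has not dropped below the number of alternating
  -- hexagons.
  A : List Edge
  A = deduplicate _≟E_ A₀

  chosen-sound : ∀ {h e} → h ∈ S → Chosen h e → E (graphOf S) e × e ∉ M
  chosen-sound h∈S (at-sink i sink _) =
    arc∈E⁺ (inj₂ (subst (_∈ S) (sym (nx-pv i _)) h∈S)) , false-indicator (sink-in Mm h∈S sink i)
  chosen-sound h∈S (at-source i source _) = arc∈E⁺ (inj₁ h∈S) , false-indicator (source-out Mm h∈S source i)

  A-sound : ∀ {e} → e ∈ A → E (graphOf S) e × e ∉ M
  A-sound e∈ =
    let h , h∈ , c = proj₂ (proj₂ (proj₂ chosen)) (∈-deduplicate⁻ _≟E_ A₀ e∈)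
    in chosen-sound (proj₁ (∈-filter⁻ (alternating? M) {xs = S} h∈)) c

  A-chosen : ∀ {h} → h ∈ S → Alternating M h → ∃[ e ] (e ∈ A × Chosen h e)
  A-chosen h∈ alt =
    let e , e∈ , c = proj₁ (proj₂ (proj₂ chosen)) (∈-filter⁺ (alternating? M) h∈ alt)
    in e , ∈-deduplicate⁺ _≟E_ e∈ , c

  avoiding : IsPerfectMatching (graphOf S ∖E A) M
  avoiding = record
    { inE = λ e∈ → IsPerfectMatching.inE PM e∈ , λ e∈A → proj₂ (A-sound e∈A) e∈
    ; covers = IsPerfectMatching.covers PM ; once = IsPerfectMatching.once PM }

  module _ {M′ : List Edge} (PM′A : IsPerfectMatching (graphOf S ∖E A) M′) where
    private
      PM′ : IsPerfectMatching (graphOf S) M′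
      PM′ = record { inE = λ e∈ → proj₁ (IsPerfectMatching.inE PM′A e∈)
                   ; covers = IsPerfectMatching.covers PM′A ; once = IsPerfectMatching.once PM′A }
      m′ : ArcSet
      m′ = indicator M′

      Mm′ : Matching m′
      Mm′ = matching-of PM′

      x y : Hex → Dir → ℤ
      x h i = value (m′ h i) - value (m h i)
      y h i = + 1 - + 3 * value (m h i)

      x-off : ∀ {h i} → ¬ (h ∈ S ⊎ nx i h ∈ S) → x h i ≡ + 0
      x-off {h} {i} ¬b = cong₂ (λ a b → value a - value b) (absent Mm′) (absent Mm)
        where
        absent : ∀ {m} → Matching m → m h i ≡ false
        absent N = not-true λ eq → ¬b (Matching.within N eq)

      x-div : ∀ {c p q r i j l} → Triangle c p q r i j l → Touches (_∈ S) p q r → x p i + x q j + x r l ≡ + 0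
      x-div {p = p} {q} {r} {i} {j} {l} τ t = trans
        (lemma (value (m′ p i)) (value (m′ q j)) (value (m′ r l)) (value (m p i)) (value (m q j)) (value (m r l)))
        (cong₂ _-_ (value-sum (Matching.law Mm′ τ t)) (value-sum (Matching.law Mm τ t)))
        where
        lemma : ∀ a b c a′ b′ c′ → a - a′ + (b - b′) + (c - c′) ≡ a + b + c - (a′ + b′ + c′)
        lemma = solve-∀

      y-div : ∀ {c p q r i j l} → Triangle c p q r i j l → Inner p q r → y p i + y q j + y r l ≡ + 0
      y-div {p = p} {q} {r} {i} {j} {l} τ (p∈ , _) = trans
        (lemma (value (m p i)) (value (m q j)) (value (m r l)))
        (cong (λ z → + 3 - + 3 * z) (value-sum (Matching.law Mm τ (inj₁ p∈))))
        where
        lemma : ∀ a b c → + 1 - + 3 * a + (+ 1 - + 3 * b) + (+ 1 - + 3 * c) ≡ + 3 - + 3 * (a + b + c)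
        lemma = solve-∀

      potential = circulation-potential x x-off x-div
      height    = inner-potential y y-div

      κ μ : ℕ
      κ = proj₁ potential
      μ = proj₁ height

      f ht : Hex → ℤ
      f  = proj₁ (proj₂ potential)
      ht = proj₁ (proj₂ height)

      f-off : ∀ {h} → h ∉ S → f h ≡ + 0
      f-off = proj₁ (proj₂ (proj₂ potential))

      f-step : ∀ h i → f (nx i h) ≡ f h + + suc κ * x h i
      f-step = proj₂ (proj₂ (proj₂ potential))

      f-mono : ∀ {h i} → m h i ≡ false → f h ℤ.≤ f (nx i h)
      f-mono {h} {i} o = subst (f h ℤ.≤_) (sym (f-step h i))
        (subst (λ b → f h ℤ.≤ f h + + suc κ * (value (m′ h i) - value b)) (sym o) (grow κ (f h) (m′ h i)))

      f-flat : ∀ {h i} → arc h i ∈ A → f (nx i h) ≡ f h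
      f-flat {h} {i} e∈ = trans (f-step h i) (trans (cong (λ z → f h + + suc κ * z) flat)
        (trans (cong (λ z → f h + z) (ℤP.*-zeroʳ (+ suc κ))) (ℤP.+-identityʳ (f h))))
        where
        flat : x h i ≡ + 0
        flat = cong₂ (λ a b → value a - value b)
          (indicator-false λ e∈M′ → proj₂ (IsPerfectMatching.inE PM′A e∈M′) e∈)
          (indicator-false (proj₂ (A-sound e∈)))

      ht-up : ∀ {h i} → h ∈ S → nx i h ∈ S → m h i ≡ false → ht (nx i h) ≡ ht h + + suc μ
      ht-up {h} {i} h∈ q∈ o = trans (proj₂ (proj₂ height) h∈ q∈)
        (cong (λ z → ht h + z) (trans (cong (λ b → + suc μ * (+ 1 - + 3 * value b)) o) (ℤP.*-identityʳ (+ suc μ))))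

      escape : ∀ {h} → h ∈ S → Sink m h → Descent.Escape hexLattice S m f h
      escape {h} h∈ sink = let e , e∈ , c = A-chosen h∈ (sink-alternating Mm h∈ sink) in go e∈ c
        where
        go : ∀ {e} → e ∈ A → Chosen h e → Descent.Escape hexLattice S m f h
        go e∈ (at-sink i _ exit) = i , trans (cong f (sym (nx-pv i h))) (f-flat e∈) , exit
        go e∈ (at-source i source _) = ⊥-elim (true≢false (source i) (sink-in Mm h∈ sink i))

      reverse-escape : ∀ {h} → h ∈ S → Source m h → Descent.Escape (reverse hexLattice) S (reversed m) (λ h → - f h) h
      reverse-escape {h} h∈ source = let e , e∈ , c = A-chosen h∈ (source-alternating Mm h∈ source) in go e∈ c
        where
        go : ∀ {e} → e ∈ A → Chosen h e → Descent.Escape (reverse hexLattice) S (reversed m) (λ h → - f h) h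
        go e∈ (at-source i _ exit) = i , cong -_ (sym (f-flat e∈)) , exit
        go e∈ (at-sink i sink _) = ⊥-elim (true≢false (source i) (sink-in Mm h∈ sink i))

      f≤0 : ∀ h → f h ℤ.≤ + 0
      f≤0 = Descent.nonpositive hexLattice S Mm {f = f} {ht = ht} {κ = μ} f-off f-mono ht-up escape

      -- The same descent in the reversed lattice, where sources are sinks; both `f` and the height
      -- change sign, so that they again grow along arcs.
      -f≤0 : ∀ h → - f h ℤ.≤ + 0
      -f≤0 = Descent.nonpositive (reverse hexLattice) S (reverse-matching Mm) {f = λ h → - f h} {ht = λ h → - ht h} {κ = μ}
        (λ h∉ → cong -_ (f-off h∉))
        (λ {h} {i} o → ℤP.neg-mono-≤ (subst (f (pv i h) ℤ.≤_) (cong f (nx-pv i h)) (f-mono o)))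
        (λ {h} {i} h∈ q∈ o → lower (trans (sym (cong ht (nx-pv i h))) (ht-up q∈ (subst (_∈ S) (sym (nx-pv i h)) h∈) o)))
        reverse-escape
        where
        lower : ∀ {a b} → a ≡ b + + suc μ → - b ≡ - a + + suc μ
        lower {a} {b} refl = lemma b (+ suc μ)
          where
          lemma : ∀ b k → - b ≡ - (b + k) + k
          lemma = solve-∀

      f≡0 : ∀ h → f h ≡ + 0
      f≡0 h = ℤP.≤-antisym (f≤0 h) (subst (+ 0 ℤ.≤_) (ℤP.neg-involutive (f h)) (ℤP.neg-mono-≤ (-f≤0 h)))

      same : ∀ h i → m′ h i ≡ m h i
      same h i = value-injective (ℤP.i-j≡0⇒i≡j (value (m′ h i)) (value (m h i)) (x≡0 (ℤP.i*j≡0⇒i≡0∨j≡0 (+ suc κ) product)))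
        where
        product : + suc κ * x h i ≡ + 0
        product = trans (sym (ℤP.+-identityˡ _)) (trans (cong (λ z → z + + suc κ * x h i) (sym (f≡0 h)))
                    (trans (sym (f-step h i)) (f≡0 (nx i h))))
        x≡0 : + suc κ ≡ + 0 ⊎ x h i ≡ + 0 → x h i ≡ + 0
        x≡0 (inj₂ eq) = eq

    same-edges : ∀ e → (e ∈ M′ → e ∈ M) × (e ∈ M → e ∈ M′)
    same-edges e = to , from
      where
      to : e ∈ M′ → e ∈ M
      to e∈ =
        let h , i , e≡ = E-arc (IsPerfectMatching.inE PM′ e∈)
        in subst (_∈ M) (sym e≡) (true-indicator (trans (sym (same h i)) (indicator-true (subst (_∈ M′) e≡ e∈))))
      from : e ∈ M → e ∈ M′
      from e∈ =
        let h , i , e≡ = E-arc (IsPerfectMatching.inE PM e∈)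
        in subst (_∈ M′) (sym e≡) (true-indicator (trans (same h i) (indicator-true (subst (_∈ M) e≡ e∈))))

  A-antiforcing : IsAntiForcingSet S M A
  A-antiforcing = A-sound , avoiding , λ M′ PM′ → same-edges PM′

  A! : Unique A
  A! = DecUniqueP.deduplicate-! _≟E_ A₀

  af≡fr : AfIs S M (fr S M)
  af≡fr = (A , A-antiforcing , A! , ℕP.≤-antisym
      (subst (length A ℕ.≤_) (proj₁ (proj₂ chosen)) (unique-length A! (∈-deduplicate⁻ _≟E_ A₀)))
      (LowerBound.fr≤ Mm A-antiforcing S!))
    , λ B AF _ → LowerBound.fr≤ Mm AF S!

theorem4p2 : (S : List Hex) → IsHexagonalSystem S
    → ∃[ M ] IsPerfectMatching (graphOf S) M
    → (¬ HasNiceTriphenylene S)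
    ⇔ (∀ M → IsPerfectMatching (graphOf S) M → AfIs S M (fr S M))
theorem4p2 S HS _ = mk⇔ (λ no-triphenylene M PM → UpperBound.af≡fr HS no-triphenylene PM) no-nice
  where
  no-nice : (∀ M → IsPerfectMatching (graphOf S) M → AfIs S M (fr S M)) → ¬ HasNiceTriphenylene S
  no-nice all-equal triphenylene =
    let M , PM , ¬eq = obstruct (IsHexagonalSystem.distinct HS) (triphenylene-obstruction triphenylene)
    in ¬eq (all-equal M PM)
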